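{- Let $S$ be a recurrent specular set on the finite alphabet $A$ relative to the involution $\theta$. For any nonempty $w\in S$ such that $w$ and $w^{ -1}$ do not overlap, the set $\mathcal{MR}_S(w)$ of mixed return words to $w$ in $S$ is a monoidal basis of the group $G_\theta$.
   Context: Words are over a finite alphabet $A$; $\varepsilon$ is the empty word. A set $S$ of words on $A$ is factorial if it contains $A$ and all the factors of its elements. For $w\in S$ let $L(w)=\{a\in A\mid aw\in S\}$, $R(w)=\{a\in A\mid wa\in S\}$, $B(w)=\{(a,b)\in A\times A\mid awb\in S\}$. A factorial set $S$ is biextendable if $B(w)\neq\emptyset$ for all $w\in S$. The extension graph $\mathcal{E}(w)$ is the undirected graph whose vertex set is the disjoint union of $L(w)$ and $R(w)$ and whose edges are the pairs in $B(w)$. A biextendable set $S$ is a tree set of characteristic $c$ if $\mathcal{E}(w)$ is a tree for every nonempty $w\in S$ and $\mathcal{E}(\varepsilon)$ is a disjoint union of $c$ trees. Let $\theta$ be an involution on $A$ (possibly with fixed points) and let $G_\theta$ be the group generated by $A$ with relations $a\theta(a)=1$, $a\in A$ (so $a^{ -1}=\theta(a)$). A word is reduced if it has no factor $a\theta(a)$ with $a\in A$; every element of $G_\theta$ is represented by a unique reduced word, reduced words are identified with elements of $G_\theta$, and the inverse $w^{ -1}$ of a reduced word $w=a_1\cdots a_n$ is the reduced word $\theta(a_n)\cdots\theta(a_1)$. A laminary set on $A$ relative to $\theta$ is a biextendable set of reduced words closed under taking inverses. A specular set is a laminary set which is a tree set of characteristic $2$. A set $S\ne\{\varepsilon\}$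 is recurrent if it is factorial and for all $u,w\in S$ there is $v\in S$ with $uvw\in S$. A subset $X$ of a group $G$ is a monoidal basis of $G$ if it is symmetric (closed under taking inverses), the monoid it generates is $G$, and any product $x_1x_2\cdots x_m$ ($m\ge1$) of elements of $X$ such that $x_kx_{k+1}\neq 1$ for $1\le k\le m-1$ is different from $1$. For a set $X\subset S$ of nonempty words, a complete return word to $X$ is a word of $S$ with a proper prefix in $X$, a proper suffix in $X$ but no internal factor in $X$ ($v$ is an internal factor of $y$ if $y=uvw$ with $u,w$ nonempty). Two words $u,v$ overlap if a nonempty suffix of one of them is a prefix of the other. If $w,w^{ -1}$ do not overlap, with each complete return word $u$ to $\{w,w^{ -1}\}$ one associates the word $N(u)$ obtained from $u$ by erasing the prefix $w$ if $u$ has $w$ as a prefix, and erasing the suffix $w^{ -1}$ if $u$ has $w^{ -1}$ as a suffix. The set $\mathcal{MR}_S(w)$ of mixed return words to $w$ is the set of words $N(u)$ for $u$ a complete return word to $\{w,w^{ -1}\}$. -}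

module Defs where

open import Level using (Level; 0ℓ; _⊔_)
open import Algebra.Bundles using (Group)
open import Data.Bool.Base using (if_then_else_)
open import Data.Fin.Base using (Fin)
open import Data.Fin.Properties using (_≟_)
open import Data.List.Base
  using (List; []; _∷_; [_]; _++_; length; map; reverse; foldr; take; drop)
open import Data.List.Properties using (++-identityʳ)
open import Data.List.Relation.Binary.Prefix.Heterogeneous.Properties using (prefix?)
open import Data.List.Relation.Binary.Suffix.Heterogeneous.Properties using (suffix?)
open import Data.List.Relation.Unary.All using (All)
open import Data.List.Relation.Unary.Linked using (Linked)
open import Data.List.Relation.Unary.Unique.Propositional using (Unique)
open import Data.Nat.Base using (ℕ; _∸_)
open import Data.Product.Base using (∃; ∃₂; _×_; _,_)
open import Data.Sum.Base using (_⊎_; inj₁; inj₂)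
open import Function.Bundles using (_⇔_)
open import Relation.Binary.Construct.Closure.ReflexiveTransitive using (Star)
open import Relation.Binary.Core using (Rel)
open import Relation.Binary.Definitions using (Symmetric; Irreflexive)
open import Relation.Binary.PropositionalEquality.Core using (_≡_; _≢_; cong)
  renaming (refl to ≡-refl; sym to ≡-sym)
open import Relation.Nullary.Decidable.Core using (does)
open import Relation.Nullary.Negation.Core using (¬_)
open import Relation.Unary using (Pred)

-- Simple undirected graphs.  The vertex set is a predicate on an ambient type
-- rather than a Σ-type, so that different proofs of membership do not give
-- different vertices.

record Graph (U : Set) : Set₁ where
  field
    Vertex   : Pred U 0ℓ
    _~_      : Rel U 0ℓ
    ~-vertex : ∀ {x y} → x ~ y → Vertex x
    ~-sym    : Symmetric _~_
    ~-irrefl : Irreflexive _≡_ _~_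

module _ {U : Set} where

  Connected : Graph U → Set
  Connected G = ∀ {x y} → Vertex x → Vertex y → Star _~_ x y
    where open Graph G

  -- A cycle visits at least three pairwise distinct vertices and returns to
  -- the first one.
  Acyclic : Graph U → Set
  Acyclic G = ∀ x y z zs → Unique (x ∷ y ∷ z ∷ zs) →
              ¬ Linked _~_ (x ∷ y ∷ z ∷ zs ++ [ x ])
    where open Graph G

  -- Trees are nonempty; otherwise the number of trees in a disjoint union
  -- would be meaningless.
  record IsTree (G : Graph U) : Set where
    field
      nonempty  : ∃ (Graph.Vertex G)
      connected : Connected G
      acyclic   : Acyclic G

  record IsDisjointUnion {c : ℕ} (G : Graph U) (T : Fin c → Graph U) : Set where
    field
      vertices : ∀ {x} → Graph.Vertex G x ⇔ (∃ λ i → Graph.Vertex (T i) x)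
      edges    : ∀ {x y} → Graph._~_ G x y ⇔ (∃ λ i → Graph._~_ (T i) x y)
      disjoint : ∀ {i j x} → Graph.Vertex (T i) x → Graph.Vertex (T j) x → i ≡ j

  IsDisjointUnionOfTrees : ℕ → Graph U → Set₁
  IsDisjointUnionOfTrees c G =
    ∃ λ (T : Fin c → Graph U) → IsDisjointUnion G T × (∀ i → IsTree (T i))

module _ {c ℓ : Level} (G : Group c ℓ) where

  open Group G

  product : List Carrier → Carrier
  product = foldr _∙_ ε

  record IsMonoidalBasis {p : Level} (X : Pred Carrier p) : Set (c ⊔ ℓ ⊔ p) where
    field
      symmetric  : ∀ {x} → X x → X (x ⁻¹)
      generates  : ∀ g → ∃ λ xs → All X xs × product xs ≈ g
      nonTrivial : ∀ xs → xs ≢ [] → All X xs →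
                   Linked (λ x y → ¬ (x ∙ y ≈ ε)) xs → ¬ (product xs ≈ ε)

Word : ℕ → Set
Word n = List (Fin n)

Language : ℕ → Set₁
Language n = Pred (Word n) 0ℓ

infixl 7 _∙_
infix  8 _⁻¹

data Expr (n : ℕ) : Set where
  gen : Fin n → Expr n
  ε   : Expr n
  _∙_ : Expr n → Expr n → Expr n
  _⁻¹ : Expr n → Expr n

module _ {n : ℕ} where

  private
    A : Set
    A = Fin n

  Factor : Word n → Word n → Set
  Factor v w = ∃₂ λ p s → w ≡ p ++ v ++ s

  record IsFactorial (S : Language n) : Set where
    field
      letters : ∀ a → S [ a ]
      factors : ∀ {v w} → Factor v w → S w → S v

  module _ (S : Language n) where

    L : Word n → Pred A 0ℓ
    L w a = S (a ∷ w)

    R : Word n → Pred A 0ℓ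
    R w a = S (w ++ [ a ])

    B : Word n → Rel A 0ℓ
    B w a b = S (a ∷ w ++ [ b ])

    record IsBiextendable : Set where
      field
        factorial  : IsFactorial S
        extendable : ∀ {w} → S w → ∃₂ (B w)

      open IsFactorial factorial public

    record IsRecurrent : Set where
      field
        factorial  : IsFactorial S
        nontrivial : ¬ (∀ u → S u ⇔ u ≡ [])
        recurrent  : ∀ {u w} → S u → S w → ∃ λ v → S v × S (u ++ v ++ w)

    data ExtVertex (w : Word n) : Pred (A ⊎ A) 0ℓ where
      left  : ∀ {a} → L w a → ExtVertex w (inj₁ a)
      right : ∀ {b} → R w b → ExtVertex w (inj₂ b)

    data ExtEdge (w : Word n) : Rel (A ⊎ A) 0ℓ where
      left-right : ∀ {a b} → B w a b → ExtEdge w (inj₁ a) (inj₂ b)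
      right-left : ∀ {a b} → B w a b → ExtEdge w (inj₂ b) (inj₁ a)

  module _ {S : Language n} (factorial : IsFactorial S) where

    open IsFactorial factorial

    extensionGraph : Word n → Graph (A ⊎ A)
    extensionGraph w = record
      { Vertex   = ExtVertex S w
      ; _~_      = ExtEdge S w
      ; ~-vertex = λ where
          (left-right {b = b} awb) → left (factors ([] , [ b ] , ≡-refl) awb)
          (right-left {a = a} awb) → right (factors ([ a ] , [] , snoc-[] a) awb)
      ; ~-sym    = λ where
          (left-right awb) → right-left awb
          (right-left awb) → left-right awb
      ; ~-irrefl = λ { ≡-refl () }
      }
      where
      snoc-[] : ∀ a {v : Word n} → a ∷ v ≡ [ a ] ++ v ++ []
      snoc-[] a {v} = cong (a ∷_) (≡-sym (++-identityʳ v))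

  record IsTreeSet (c : ℕ) (S : Language n) : Set₁ where
    field
      biextendable : IsBiextendable S

    open IsBiextendable biextendable public

    field
      tree   : ∀ {w} → w ≢ [] → S w → IsTree (extensionGraph factorial w)
      forest : IsDisjointUnionOfTrees c (extensionGraph factorial [])

  Overlap : Rel (Word n) 0ℓ
  Overlap u v = SuffixIsPrefix u v ⊎ SuffixIsPrefix v u
    where
    SuffixIsPrefix : Rel (Word n) 0ℓ
    SuffixIsPrefix u v = ∃ λ s → s ≢ [] × (∃ λ p → u ≡ p ++ s) × (∃ λ t → v ≡ s ++ t)

  record IsCompleteReturn (S X : Language n) (y : Word n) : Set where
    field
      member       : S y
      properPrefix : ∃₂ λ p s → X p × s ≢ [] × y ≡ p ++ s
      properSuffix : ∃₂ λ p s → X s × p ≢ [] × y ≡ p ++ s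
      noInternal   : ∀ u v w → u ≢ [] → w ≢ [] → y ≡ u ++ v ++ w → ¬ X v

  module _ (θ : Fin n → Fin n) where

    IsReduced : Language n
    IsReduced w = ∀ a → ¬ Factor (a ∷ θ a ∷ []) w

    inv : Word n → Word n
    inv w = map θ (reverse w)

    record IsLaminary (S : Language n) : Set where
      field
        biextendable : IsBiextendable S
        reduced      : ∀ {w} → S w → IsReduced w
        inverse      : ∀ {w} → S w → S (inv w)

    record IsSpecular (S : Language n) : Set₁ where
      field
        laminary : IsLaminary S
        treeSet  : IsTreeSet 2 S

    ｛_｝± : Word n → Language n
    ｛ w ｝± v = v ≡ w ⊎ v ≡ inv w

    -- Both tests are made on u itself.  When w and inv w do not overlap and
    -- u is a complete return word satisfying both, the erased prefix and
    -- suffix occupy disjoint positions of u.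
    erase : Word n → Word n → Word n
    erase w u = drop i (take (length u ∸ j) u)
      where
      i j : ℕ
      i = if does (prefix? _≟_ w u) then length w else 0
      j = if does (suffix? _≟_ (inv w) u) then length (inv w) else 0

    MixedReturn : Language n → Word n → Language n
    MixedReturn S w x =
      ∃ λ u → IsCompleteReturn S ｛ w ｝± u × x ≡ erase w u

    -- The group presented by the generators Fin n and the relations
    -- a θ(a) = 1: group expressions modulo the least congruence containing
    -- the group axioms and the relations.

    infix 4 _≈_

    data _≈_ : Rel (Expr n) 0ℓ where
      relator   : ∀ a → gen a ∙ gen (θ a) ≈ ε
      refl      : ∀ {x} → x ≈ x
      sym       : ∀ {x y} → x ≈ y → y ≈ x
      trans     : ∀ {x y z} → x ≈ y → y ≈ z → x ≈ z
      ∙-cong    : ∀ {x y u v} → x ≈ y → u ≈ v → x ∙ u ≈ y ∙ v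
      ⁻¹-cong   : ∀ {x y} → x ≈ y → x ⁻¹ ≈ y ⁻¹
      assoc     : ∀ x y z → (x ∙ y) ∙ z ≈ x ∙ (y ∙ z)
      identityˡ : ∀ x → ε ∙ x ≈ x
      identityʳ : ∀ x → x ∙ ε ≈ x
      inverseˡ  : ∀ x → x ⁻¹ ∙ x ≈ ε
      inverseʳ  : ∀ x → x ∙ x ⁻¹ ≈ ε

    Gθ : Group 0ℓ 0ℓ
    Gθ = record
      { Carrier = Expr n
      ; _≈_     = _≈_
      ; _∙_     = _∙_
      ; ε       = ε
      ; _⁻¹     = _⁻¹
      ; isGroup = record
        { isMonoid = record
          { isSemigroup = record
            { isMagma = record
              { isEquivalence = record { refl = refl ; sym = sym ; trans = trans }
              ; ∙-cong = ∙-cong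
              }
            ; assoc = assoc
            }
          ; identity = identityˡ , identityʳ
          }
        ; inverse = inverseˡ , inverseʳ
        ; ⁻¹-cong = ⁻¹-cong
        }
      }

    ⟦_⟧ : Word n → Expr n
    ⟦ w ⟧ = foldr (λ a g → gen a ∙ g) ε w

    -- The subset of Gθ given by a set of words; it is saturated under _≈_,
    -- hence a subset of the quotient.
    elements : Language n → Pred (Expr n) 0ℓ
    elements X g = ∃ λ x → X x × ⟦ x ⟧ ≈ g

{-# OPTIONS --safe #-}

-- Mark every occurrence of w at its end and every occurrence of inv w at its
-- beginning.  Inversion exchanges the marked words of S, and the mixed return
-- words are the words read between consecutive marks.
--
-- Uniform recurrence.  Choose a default right extension of every nonempty word
-- of S, compatibly with the trees E(p).  A non-default extension of a word that
-- starts with w and has no other occurrence of w is determined by the last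
-- letter and the extending letter, so these words branch finitely often and
-- their lengths are bounded; hence long words of S contain w.
--
-- Generation.  The left coset of the word up to the first mark, modulo the
-- subgroup H generated by the mixed return words, depends only on a prefix of
-- the word.  Connectedness of the graphs E(p) shortens this prefix down to
-- nothing, and then a H = H for every letter a.
--
-- Freeness.  Let F be the free product in which the mixed return words x are
-- free generators up to x (inv x) = 1.  Multiplying the generators met between
-- the first and the last mark of a word gives a cocycle Π on the marked words of
-- S with values in F.  Since the graphs E(p) are trees, Π extends step by step to
-- shorter words, up to a change of base points.  At the end it is a homomorphism
-- from Gθ to F that sends each mixed return word, up to a common conjugation, to
-- its generator.
--
-- The involution θ exchanges the two trees of E([]): a path from a vertex to its
-- image, followed by the image of that path, would otherwise be a closed walk
-- that can only be reduced through a factor a θ(a) of S.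
--
-- Membership in S is decidable, because the edges of a tree can be read off its
-- connecting paths; this makes all the choices above effective.

module Submission where

open import Defs
import Algebra.Properties.Group as GroupProperties
import Relation.Binary.Reasoning.Setoid as SetoidReasoning
import Data.Bool.Properties as Bool
open import Algebra.Bundles using (Group)
open import Algebra.Definitions using (Involutive)
open import Data.Bool.Base using (if_then_else_; Bool; true; false; not)
open import Data.Empty using (⊥; ⊥-elim)
open import Data.Fin.Base using (Fin; zero; suc)
open import Data.Fin.Properties using (_≟_)
open import Data.List.Base
  using (List; []; _∷_; [_]; _++_; map; length; reverse; initLast; _∷ʳ′_; filter;
         cartesianProduct; allFin; take; drop)
open import Data.List.Membership.Propositional using (_∈_; lose)
open import Data.List.Membership.Propositional.Properties
  using (∈-filter⁺; ∈-cartesianProduct⁺; ∈-allFin)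
open import Data.List.Properties
  using (++-assoc; ++-identityʳ; length-++; map-++; reverse-++; length-map;
         length-reverse; ++-cancelˡ; ∷-injectiveʳ; ∷-injectiveˡ; filter-notAll;
         ++-cancelʳ; ≡-dec; ∷ʳ-injectiveˡ)
open import Data.List.Relation.Binary.Pointwise using (≡⇒Pointwise-≡; Pointwise-≡⇒≡)
open import Data.List.Relation.Binary.Prefix.Heterogeneous using (Prefix; []; _∷_)
open import Data.List.Relation.Binary.Prefix.Heterogeneous.Properties using (prefix?)
open import Data.List.Relation.Binary.Suffix.Heterogeneous using (Suffix; here; there)
open import Data.List.Relation.Binary.Suffix.Heterogeneous.Properties using (suffix?)
open import Data.List.Relation.Unary.All using (All; []; _∷_)
open import Data.List.Relation.Unary.All.Properties
  using (¬Any⇒All¬; All¬⇒¬Any)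
  renaming (++⁺ to All-++⁺)
open import Data.List.Relation.Unary.AllPairs using ([]; _∷_)
open import Data.List.Relation.Unary.Any using (here; there)
open import Data.List.Relation.Unary.Linked using (Linked; []; [-]; _∷_)
open import Data.List.Relation.Unary.Unique.Propositional using (Unique)
open import Data.List.Reverse using (Reverse; reverseView; []; _∶_∶ʳ_)
open import Data.Maybe.Base using (Maybe; just; nothing; maybe′)
open import Data.Nat.Base using (ℕ; zero; suc; _+_; _≤_; _<_; z≤n; s≤s; s≤s⁻¹; _⊔_; _∸_)
open import Data.Nat.Properties
  using (≤-refl; ≤-trans; ≤-reflexive; m≤m+n; m≤n+m; n≤1+n; +-suc; +-comm; m≤m⊔n; m≤n⊔m;
         1+n≰n; n≮0; +-monoʳ-≤; m+n∸n≡m; +-cancelʳ-≡; _≤?_)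
open import Data.Product.Base using (∃; ∃₂; _×_; _,_; proj₁; proj₂)
open import Data.Product.Properties using () renaming (≡-dec to ×-≡-dec)
open import Data.Sum.Base using (_⊎_; inj₁; inj₂; [_,_]′)
open import Data.Sum.Properties
  using (inj₁-injective; inj₂-injective)
  renaming (≡-dec to ⊎-≡-dec)
open import Data.Unit.Base using (⊤; tt)
open import Data.Vec.Base using (Vec; []; _∷_; lookup)
open import Function.Base using (_∘_)
open import Function.Bundles using (Equivalence)
open import Level using (0ℓ)
open import Relation.Binary.Construct.Closure.ReflexiveTransitive
  using (Star; _◅_; gmap)
  renaming (ε to εˢ)
open import Relation.Binary.Core using (Rel)
open import Relation.Binary.Definitions using (DecidableEquality; Symmetric)
open import Relation.Binary.PropositionalEquality.Core
  using (_≡_; _≢_; cong; cong₂; subst)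
  renaming (refl to ≡-refl; sym to ≡-sym; trans to ≡-trans)
open import Relation.Nullary.Decidable.Core
  using (Dec; yes; no; ¬?; _×-dec_; _⊎-dec_; map′; does)
open import Relation.Nullary.Negation.Core using (¬_)

-- Walks in graphs and their weights in a group

module Walks {U : Set} (_≟_ : DecidableEquality U) (_~_ : Rel U 0ℓ) (~-sym : Symmetric _~_) where

  -- The list omits the starting vertex, so that concatenating walks concatenates their lists.
  data Walk : U → List U → U → Set where
    []  : ∀ {x} → Walk x [] x
    _∷_ : ∀ {x y z zs} → x ~ z → Walk z zs y → Walk x (z ∷ zs) y

  data NonBacktracking : List U → Set where
    nb-[-] : ∀ {x} → NonBacktracking [ x ]
    nb-2   : ∀ {x y} → NonBacktracking (x ∷ y ∷ [])
    _∷_    : ∀ {x y z zs} → x ≢ z → NonBacktracking (y ∷ z ∷ zs) → NonBacktracking (x ∷ y ∷ z ∷ zs)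

  _++ʷ_ : ∀ {x y z xs ys} → Walk x xs y → Walk y ys z → Walk x (xs ++ ys) z
  []      ++ʷ q = q
  (e ∷ p) ++ʷ q = e ∷ (p ++ʷ q)

  fromStar : ∀ {x y} → Star _~_ x y → ∃ λ zs → Walk x zs y
  fromStar εˢ      = [] , []
  fromStar (e ◅ s) = let zs , p = fromStar s in _ , e ∷ p

  reverse-walk : ∀ {x y zs} → Walk x zs y → ∃ λ zs′ → Walk y zs′ x
  reverse-walk []      = [] , []
  reverse-walk (e ∷ p) = let _ , q = reverse-walk p in _ , q ++ʷ (~-sym e ∷ [])

  nb-tail : ∀ {x y zs} → NonBacktracking (x ∷ y ∷ zs) → NonBacktracking (y ∷ zs)
  nb-tail nb-2    = nb-[-]
  nb-tail (_ ∷ n) = n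

  module Labelled (F : Group 0ℓ 0ℓ) (δ : U → U → Group.Carrier F) where
    open Group F renaming (_∙_ to _·_; _≈_ to _≋_; ε to 𝟙; _⁻¹ to _⁻)

    weight : U → List U → Carrier
    weight x []       = 𝟙
    weight x (z ∷ zs) = δ x z · weight z zs

    weight-++ : ∀ {x y xs} ys → Walk x xs y → weight x (xs ++ ys) ≋ weight x xs · weight y ys
    weight-++ ys []      = Group.sym F (Group.identityˡ F _)
    weight-++ ys (e ∷ p) = Group.trans F (∙-congˡ (weight-++ ys p)) (Group.sym F (Group.assoc F _ _ _))

    potential : ∀ {x y} → Star _~_ x y → Carrier
    potential {x} s = weight x (proj₁ (fromStar s))

    Antisymmetric : Set
    Antisymmetric = ∀ {x y} → x ~ y → δ x y · δ y x ≋ 𝟙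

    -- The tail is reduced first; if its first step undoes the new edge, the two are cancelled. By
    -- antisymmetry their weights cancel as well.
    reduce : Antisymmetric → ∀ {x y zs} → Walk x zs y →
             ∃ λ zs′ → Walk x zs′ y × NonBacktracking (x ∷ zs′) × weight x zs ≋ weight x zs′
    reduce anti [] = [] , [] , nb-[-] , Group.refl F
    reduce anti {x} (_∷_ {z = z} {zs = ws} e p) with reduce anti p
    ... | [] , [] , _ , eq = _ , e ∷ [] , nb-2 , ∙-congˡ eq
    ... | (z′ ∷ zs′) , (e′ ∷ p′) , n , eq with x ≟ z′
    ...   | no x≢z′ = _ , e ∷ e′ ∷ p′ , x≢z′ ∷ n , ∙-congˡ eq
    ...   | yes ≡-refl = zs′ , p′ , nb-tail n , (begin
      δ x z · weight z ws               ≈⟨ ∙-congˡ eq ⟩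
      δ x z · (δ z x · weight x zs′)    ≈⟨ Group.assoc F _ _ _ ⟨
      (δ x z · δ z x) · weight x zs′    ≈⟨ ∙-congʳ (anti e) ⟩
      𝟙 · weight x zs′                  ≈⟨ Group.identityˡ F _ ⟩
      weight x zs′                      ∎)
      where open import Relation.Binary.Reasoning.Setoid setoid

-- Walks in acyclic graphs

linked-++⁻ˡ : ∀ {U : Set} {_~_ : Rel U 0ℓ} xs {ys} → Linked _~_ (xs ++ ys) → Linked _~_ xs
linked-++⁻ˡ []           l       = []
linked-++⁻ˡ (x ∷ [])     l       = [-]
linked-++⁻ˡ (x ∷ y ∷ xs) (e ∷ l) = e ∷ linked-++⁻ˡ (y ∷ xs) l

split-at : ∀ {U : Set} {x : U} {xs} → x ∈ xs → Unique xs →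
           ∃₂ λ ys zs → xs ≡ ys ++ x ∷ zs × Unique (x ∷ ys)
split-at (here ≡-refl) (_ ∷ u) = [] , _ , ≡-refl , [] ∷ []
split-at {x = x} (there {y} i) (a ∷ u) with split-at i u
... | ys , zs , eq , (x∉ ∷ u′) =
  y ∷ ys , zs , cong (y ∷_) eq ,
  ((λ x≡y → All¬⇒¬Any a (subst (_∈ _) x≡y i)) ∷ x∉) ∷ front ys eq a ∷ u′
  where
  front : ∀ ys {zs xs} → xs ≡ ys ++ zs → All (y ≢_) xs → All (y ≢_) ys
  front []       ≡-refl _       = []
  front (_ ∷ ys) ≡-refl (p ∷ a) = p ∷ front ys ≡-refl a

module AcyclicWalks {U : Set} (_≟_ : DecidableEquality U) (G : Graph U) (acyclic : Acyclic G) where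
  open Graph G
  open Walks _≟_ _~_ ~-sym public

  walk-linked : ∀ {x y zs} → Walk x zs y → Linked _~_ (x ∷ zs)
  walk-linked []           = [-]
  walk-linked (e ∷ [])     = e ∷ [-]
  walk-linked (e ∷ e′ ∷ p) = e ∷ walk-linked (e′ ∷ p)

  open import Data.List.Membership.DecPropositional _≟_ using (_∈?_)

  -- A return to `x` in the repetition-free tail would close a cycle. Returns after one or two steps
  -- are excluded by irreflexivity and by non-backtracking.
  nonBacktracking⇒unique : ∀ {x y zs} → Walk x zs y → NonBacktracking (x ∷ zs) → Unique (x ∷ zs)
  nonBacktracking⇒unique []                    _ = [] ∷ []
  nonBacktracking⇒unique {x} (_∷_ {z = z} {zs = zs} e p) n =
    ¬Any⇒All¬ _ x∉ ∷ u
    where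
    u : Unique (z ∷ zs)
    u = nonBacktracking⇒unique p (nb-tail n)
    no-return : ∀ ys {rs} → NonBacktracking (x ∷ ys ++ x ∷ rs) → Linked _~_ (x ∷ ys ++ x ∷ rs) →
                Unique (x ∷ ys) → ⊥
    no-return []            _         (e ∷ _) _ = ~-irrefl ≡-refl e
    no-return (y ∷ [])      (x≢x ∷ _) _       _ = x≢x ≡-refl
    no-return (y ∷ y′ ∷ ys) _         l       u =
      acyclic x y y′ ys u (linked-++⁻ˡ (x ∷ y ∷ y′ ∷ ys ++ [ x ])
        (subst (λ l → Linked _~_ (x ∷ y ∷ y′ ∷ l)) (≡-sym (++-assoc ys [ x ] _)) l))
    x∉ : ¬ x ∈ z ∷ zs
    x∉ x∈ with split-at x∈ u
    ... | ys , rs , eq , u′ =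
      no-return ys (subst (λ l → NonBacktracking (x ∷ l)) eq n)
                   (subst (λ l → Linked _~_ (x ∷ l)) eq (walk-linked (e ∷ p))) u′

  end∈ : ∀ {x y z zs} → Walk x (z ∷ zs) y → y ∈ z ∷ zs
  end∈ (e ∷ [])     = here ≡-refl
  end∈ (e ∷ e′ ∷ p) = there (end∈ (e′ ∷ p))

  not-closed : ∀ {x z zs} → Walk x (z ∷ zs) x → ¬ NonBacktracking (x ∷ z ∷ zs)
  not-closed p n with nonBacktracking⇒unique p n
  ... | a ∷ _ = All¬⇒¬Any a (end∈ p)

  private
    -- The reversal of the first walk followed by the second one would be a
    -- closed walk that backtracks at most at its base point.
    diverge : ∀ {x y xs z zs} → Walk x xs y → NonBacktracking (x ∷ xs) →
              Walk x (z ∷ zs) y → NonBacktracking (x ∷ z ∷ zs) →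
              (∀ {t ts} → xs ≡ t ∷ ts → t ≢ z) → ⊥
    diverge []      _  q nq _    = not-closed q nq
    diverge (e ∷ p) np q nq diff =
      diverge p (nb-tail np) (~-sym e ∷ q) (diff ≡-refl ∷ nq) (λ { ≡-refl → next np })
      where
      next : ∀ {x y z zs} → NonBacktracking (x ∷ y ∷ z ∷ zs) → z ≢ x
      next (d ∷ _) eq = d (≡-sym eq)

  first-step-unique : ∀ {x y t ts z zs} → Walk x (t ∷ ts) y → NonBacktracking (x ∷ t ∷ ts) →
                      Walk x (z ∷ zs) y → NonBacktracking (x ∷ z ∷ zs) → t ≡ z
  first-step-unique {t = t} {z = z} p np q nq with t ≟ z
  ... | yes t≡z = t≡z
  ... | no t≢z  = ⊥-elim (diverge p np q nq λ { ≡-refl → t≢z })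

  -- With weights in this group, the weighted reduction serves for bare walks.
  trivialGroup : Group 0ℓ 0ℓ
  trivialGroup = record
    { Carrier = ⊤ ; _≈_ = λ _ _ → ⊤ ; _∙_ = λ _ _ → tt ; ε = tt ; _⁻¹ = λ _ → tt
    ; isGroup = _ }

  nonBacktrackingWalk : ∀ {x y} → Star _~_ x y →
                        ∃ λ zs → Walk x zs y × NonBacktracking (x ∷ zs)
  nonBacktrackingWalk s with Labelled.reduce trivialGroup _ _ (proj₂ (fromStar s))
  ... | zs , p , n , _ = zs , p , n

  -- Adjacency is read off the reduced walk: an edge besides a reduced walk of length at least two
  -- would close a cycle.
  edge? : ∀ {x y} → x ≢ y → Star _~_ x y → Dec (x ~ y)
  edge? {x} {y} x≢y s with nonBacktrackingWalk s
  ... | []            , []     , _ = ⊥-elim (x≢y ≡-refl)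
  ... | z ∷ []        , e ∷ [] , _ = yes e
  ... | z ∷ z′ ∷ zs   , p      , n = no λ e →
    acyclic x z z′ zs (nonBacktracking⇒unique p n) (close p (~-sym e))
    where
    close : ∀ {x y zs t} → Walk x zs y → y ~ t → Linked _~_ (x ∷ zs ++ [ t ])
    close []           e = e ∷ [-]
    close (e′ ∷ [])    e = e′ ∷ e ∷ [-]
    close (e′ ∷ f ∷ p) e = e′ ∷ close (f ∷ p) e

  module Potential (F : Group 0ℓ 0ℓ) (δ : U → U → Group.Carrier F)
                   (anti : Walks.Labelled.Antisymmetric _≟_ _~_ ~-sym F δ) where
    open Group F renaming (_∙_ to _·_; _≈_ to _≋_; ε to 𝟙; _⁻¹ to _⁻)
    open Labelled F δ public

    -- In an acyclic graph a closed walk reduces to the empty one.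
    closed-weight : ∀ {x zs} → Walk x zs x → weight x zs ≋ 𝟙
    closed-weight p with reduce anti p
    ... | []     , _  , _ , eq = eq
    ... | z ∷ zs , p′ , n , _  = ⊥-elim (not-closed p′ n)

    -- Both walks are compared through a return walk `r` from `y` to `x`: `p ++ʷ r` and `r ++ʷ q`
    -- are closed, so their weights are trivial. Thus antisymmetric labels are the increments of a
    -- potential.
    weight-unique : ∀ {x y ys zs} → Walk x ys y → Walk x zs y → weight x ys ≋ weight x zs
    weight-unique {x} {y} {ys} {zs} p q = begin
      weight x ys                                ≈⟨ Group.identityʳ F _ ⟨
      weight x ys · 𝟙                            ≈⟨ ∙-congˡ (closed-weight (r ++ʷ q)) ⟨
      weight x ys · weight y (rs ++ zs)          ≈⟨ ∙-congˡ (weight-++ zs r) ⟩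
      weight x ys · (weight y rs · weight x zs)  ≈⟨ Group.assoc F _ _ _ ⟨
      (weight x ys · weight y rs) · weight x zs  ≈⟨ ∙-congʳ (weight-++ rs p) ⟨
      weight x (ys ++ rs) · weight x zs          ≈⟨ ∙-congʳ (closed-weight (p ++ʷ r)) ⟩
      𝟙 · weight x zs                            ≈⟨ Group.identityˡ F _ ⟩
      weight x zs                                ∎
      where
      open import Relation.Binary.Reasoning.Setoid setoid
      rs = proj₁ (reverse-walk p)
      r  = proj₂ (reverse-walk p)

    potential-edge : ∀ {r x y} (s : Star _~_ r x) (t : Star _~_ r y) → x ~ y →
                     potential s · δ x y ≋ potential t
    potential-edge {r} {x} {y} s t e = begin
      weight r (proj₁ (fromStar s)) · δ x y        ≈⟨ ∙-congˡ (Group.identityʳ F _) ⟨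
      weight r (proj₁ (fromStar s)) · (δ x y · 𝟙)  ≈⟨ weight-++ [ y ] (proj₂ (fromStar s)) ⟨
      weight r (proj₁ (fromStar s) ++ [ y ])       ≈⟨ weight-unique (proj₂ (fromStar s) ++ʷ (e ∷ [])) (proj₂ (fromStar t)) ⟩
      weight r (proj₁ (fromStar t))                ∎
      where open import Relation.Binary.Reasoning.Setoid setoid

    potential-root : ∀ {r} (s : Star _~_ r r) → potential s ≋ 𝟙
    potential-root s = closed-weight (proj₂ (fromStar s))

-- Extension graphs of a tree set and decidable membership

snoc-≢[] : ∀ {A : Set} (xs : List A) {x} → xs ++ [ x ] ≢ []
snoc-≢[] []       ()
snoc-≢[] (_ ∷ xs) ()

length-∷ʳ : ∀ {A : Set} {x} (xs : List A) → length (xs ++ [ x ]) ≡ suc (length xs)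
length-∷ʳ xs = ≡-trans (length-++ xs) (+-comm (length xs) 1)

_≟ᵛ_ : ∀ {n} → DecidableEquality (Fin n ⊎ Fin n)
_≟ᵛ_ = ⊎-≡-dec _≟_ _≟_

module Extension {n : ℕ} {S : Language n} (treeSet : IsTreeSet 2 S) ([]∈S : S []) where
  open IsTreeSet treeSet public

  E : Word n → Graph (Fin n ⊎ Fin n)
  E = extensionGraph factorial

  Path : Word n → Fin n ⊎ Fin n → Fin n ⊎ Fin n → Set
  Path q = Star (ExtEdge S q)

  prefix-S : ∀ p {s} → S (p ++ s) → S p
  prefix-S p = factors ([] , _ , ≡-refl)

  suffix-S : ∀ p {s} → S (p ++ s) → S s
  suffix-S p {s} = factors (p , [] , cong (p ++_) (≡-sym (++-identityʳ s)))

  right-part : ∀ {a} p {b} → S (a ∷ p ++ [ b ]) → S (p ++ [ b ])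
  right-part {a} p = suffix-S [ a ]

  left-part : ∀ {a} p {b} → S (a ∷ p ++ [ b ]) → S (a ∷ p)
  left-part {a} p = prefix-S (a ∷ p)

  extendʳ : ∀ p → S p → ∃ λ c → S (p ++ [ c ])
  extendʳ p s = let _ , c , e = extendable s in c , right-part p e

  connected-E : ∀ {q} → q ≢ [] → S q → Connected (E q)
  connected-E q≢[] s = IsTree.connected (tree q≢[] s)

  private
    trees : Fin 2 → Graph (Fin n ⊎ Fin n)
    trees = proj₁ forest
    union : IsDisjointUnion (E []) trees
    union = proj₁ (proj₂ forest)
    isTree : ∀ i → IsTree (trees i)
    isTree = proj₂ (proj₂ forest)
    open IsDisjointUnion union

  vertex-[] : ∀ x → ExtVertex S [] x
  vertex-[] (inj₁ a) = left (letters a)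
  vertex-[] (inj₂ b) = right (letters b)

  component : Fin n ⊎ Fin n → Fin 2
  component x = proj₁ (Equivalence.to vertices (vertex-[] x))

  private
    in-component : ∀ x → Graph.Vertex (trees (component x)) x
    in-component x = proj₂ (Equivalence.to vertices (vertex-[] x))

    component-unique : ∀ {i x} → Graph.Vertex (trees i) x → component x ≡ i
    component-unique v = disjoint (in-component _) v

    edge-in : ∀ {i x y} → Graph.Vertex (trees i) x → ExtEdge S [] x y → Graph._~_ (trees i) x y
    edge-in v e with Equivalence.to edges e
    ... | j , f = subst (λ k → Graph._~_ (trees k) _ _) (disjoint (Graph.~-vertex (trees j) f) v) f

    linked-in : ∀ {i x xs} → Graph.Vertex (trees i) x → Linked (ExtEdge S []) (x ∷ xs) →
                Linked (Graph._~_ (trees i)) (x ∷ xs)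
    linked-in v [-]     = [-]
    linked-in {i} v (e ∷ l) = let f = edge-in v e in
      f ∷ linked-in (Graph.~-vertex (trees i) (Graph.~-sym (trees i) f)) l

  component-edge : ∀ {x y} → ExtEdge S [] x y → component x ≡ component y
  component-edge {x} {y} e =
    ≡-sym (component-unique (Graph.~-vertex (trees _) (Graph.~-sym (trees _) (edge-in (in-component x) e))))

  component-connected : ∀ {x y} → component x ≡ component y → Path [] x y
  component-connected {x} {y} eq =
    gmap (λ v → v) (λ f → Equivalence.from edges (_ , f))
      (IsTree.connected (isTree (component x)) (in-component x)
        (subst (λ i → Graph.Vertex (trees i) y) (≡-sym eq) (in-component y)))

  acyclic-E : ∀ {q} → S q → Acyclic (E q)
  acyclic-E {[]}    s x y z zs u l =
    IsTree.acyclic (isTree (component x)) x y z zs u (linked-in (in-component x) l)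
  acyclic-E {_ ∷ _} s = IsTree.acyclic (tree (λ ()) s)

  module EWalks {q} (s : S q) = AcyclicWalks _≟ᵛ_ (E q) (acyclic-E s)

  private
    left-right⁻ : ∀ {q a b} → ExtEdge S q (inj₁ a) (inj₂ b) → S (a ∷ q ++ [ b ])
    left-right⁻ (left-right e) = e

    -- A path between the two letters decides whether they are adjacent. Connectedness supplies it
    -- for nonempty `q`; in `E []` the components are compared first.
    edge-S? : ∀ q a b → Dec (S (a ∷ q)) → Dec (S (q ++ [ b ])) → Dec (S (a ∷ q ++ [ b ]))
    edge-S? q a b (no ¬s)   _         = no (¬s ∘ left-part q)
    edge-S? q a b (yes _)   (no ¬s)   = no (¬s ∘ right-part q)
    edge-S? q a b (yes aq) (yes qb) = decide (path q aq qb)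
      where
      decide : Dec (Path q (inj₁ a) (inj₂ b)) → Dec (S (a ∷ q ++ [ b ]))
      decide (no ¬p) = no λ e → ¬p (left-right e Star.◅ Star.ε)
      decide (yes p) with EWalks.edge? (suffix-S [ a ] aq) (λ ()) p
      ... | yes e = yes (left-right⁻ e)
      ... | no ¬e = no (¬e ∘ left-right)
      path : ∀ q → S (a ∷ q) → S (q ++ [ b ]) → Dec (Path q (inj₁ a) (inj₂ b))
      path []      aq qb with component (inj₁ a) ≟ component (inj₂ b)
      ... | yes eq = yes (component-connected eq)
      ... | no neq = no λ p → neq (same p)
        where
        same : ∀ {x y} → Path [] x y → component x ≡ component y
        same Star.ε         = ≡-refl
        same (e Star.◅ p) = ≡-trans (component-edge e) (same p)
      path (_ ∷ _) aq qb = yes (connected-E (λ ()) (suffix-S [ a ] aq) (left aq) (right qb))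

    -- Membership of `a q b` is reduced to that of `a q` and `q b`. The bound `m` drives the
    -- recursion, since `a q` is not a sublist reached by pattern matching.
    S?-bounded : ∀ m u → length u ≤ m → Dec (S u)
    S?-bounded m       []      _ = yes []∈S
    S?-bounded (suc m) (a ∷ v) (s≤s |v|≤m) with initLast v
    ... | []       = yes (letters a)
    ... | q ∷ʳ′ b  = edge-S? q a b
      (S?-bounded m (a ∷ q) (≤-trans (≤-reflexive (≡-trans (+-comm 1 (length q)) (≡-sym (length-++ q)))) |v|≤m))
      (S?-bounded m (q ++ [ b ]) |v|≤m)

  S? : ∀ u → Dec (S u)
  S? u = S?-bounded (length u) u ≤-refl

-- Inversion of words

module Inverse {n : ℕ} (θ : Fin n → Fin n) (θ-inv : Involutive _≡_ θ) where

  inv-++ : ∀ u v → inv θ (u ++ v) ≡ inv θ v ++ inv θ u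
  inv-++ u v = ≡-trans (cong (map θ) (reverse-++ u v)) (map-++ θ (reverse v) (reverse u))

  inv-∷ : ∀ a u → inv θ (a ∷ u) ≡ inv θ u ++ [ θ a ]
  inv-∷ a u = inv-++ [ a ] u

  inv-∷ʳ : ∀ u b → inv θ (u ++ [ b ]) ≡ θ b ∷ inv θ u
  inv-∷ʳ u b = inv-++ u [ b ]

  inv-∷-∷ʳ : ∀ a u b → inv θ (a ∷ u ++ [ b ]) ≡ θ b ∷ inv θ u ++ [ θ a ]
  inv-∷-∷ʳ a u b = ≡-trans (inv-∷ʳ (a ∷ u) b) (cong (θ b ∷_) (inv-∷ a u))

  inv-involutive : ∀ u → inv θ (inv θ u) ≡ u
  inv-involutive []      = ≡-refl
  inv-involutive (a ∷ u) =
    ≡-trans (cong (inv θ) (inv-∷ a u))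
      (≡-trans (inv-∷ʳ (inv θ u) (θ a)) (cong₂ _∷_ (θ-inv a) (inv-involutive u)))

  length-inv : ∀ u → length (inv θ u) ≡ length u
  length-inv u = ≡-trans (length-map θ (reverse u)) (length-reverse u)

  inv-≢[] : ∀ {u} → u ≢ [] → inv θ u ≢ []
  inv-≢[] {[]}    u≢[] = u≢[]
  inv-≢[] {a ∷ u} _ eq = snoc-≢[] (inv θ u) (≡-trans (≡-sym (inv-∷ a u)) eq)

  -- The action of inversion on vertices: it carries `E q` to `E (inv θ q)` and exchanges the two
  -- sides.
  flip : Fin n ⊎ Fin n → Fin n ⊎ Fin n
  flip (inj₁ a) = inj₂ (θ a)
  flip (inj₂ b) = inj₁ (θ b)

  flip-involutive : ∀ x → flip (flip x) ≡ x
  flip-involutive (inj₁ a) = cong inj₁ (θ-inv a)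
  flip-involutive (inj₂ b) = cong inj₂ (θ-inv b)

  flip-injective : ∀ {x y} → flip x ≡ flip y → x ≡ y
  flip-injective {x} {y} eq =
    ≡-trans (≡-sym (flip-involutive x)) (≡-trans (cong flip eq) (flip-involutive y))

-- Inversion acting on the two trees of `E []`

module Laminary {n : ℕ} (θ : Fin n → Fin n) (θ-inv : Involutive _≡_ θ) {S : Language n}
                (specular : IsSpecular θ S) ([]∈S : S []) where
  open IsSpecular specular
  open Extension treeSet []∈S public
  open IsLaminary laminary using (reduced; inverse) public
  open Inverse θ θ-inv public

  flip-edge : ∀ {q x y} → ExtEdge S q x y → ExtEdge S (inv θ q) (flip x) (flip y)
  flip-edge {q} (left-right {a} {b} e) = right-left (subst S (inv-∷-∷ʳ a q b) (inverse e))
  flip-edge {q} (right-left {a} {b} e) = left-right (subst S (inv-∷-∷ʳ a q b) (inverse e))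

  private
    open EWalks []∈S

    nb-join : ∀ xs {t m s ys} → NonBacktracking (xs ++ t ∷ m ∷ []) → t ≢ s →
              NonBacktracking (m ∷ s ∷ ys) → NonBacktracking (xs ++ t ∷ m ∷ s ∷ ys)
    nb-join []               _        t≢s nb = t≢s ∷ nb
    nb-join (_ ∷ [])         (d ∷ _)  t≢s nb = d ∷ t≢s ∷ nb
    nb-join (_ ∷ y ∷ [])     (d ∷ na) t≢s nb = d ∷ nb-join [ y ] na t≢s nb
    nb-join (_ ∷ y ∷ z ∷ xs) (d ∷ na) t≢s nb = d ∷ nb-join (y ∷ z ∷ xs) na t≢s nb

    nb-init : ∀ x xs {y} → NonBacktracking (x ∷ xs ++ [ y ]) → NonBacktracking (x ∷ xs)
    nb-init _ []           _       = nb-[-]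
    nb-init _ (_ ∷ [])     _       = nb-2
    nb-init _ (_ ∷ _ ∷ xs) (d ∷ n) = d ∷ nb-init _ (_ ∷ xs) n

    nb-flip : ∀ {xs} → NonBacktracking xs → NonBacktracking (map flip xs)
    nb-flip nb-[-]  = nb-[-]
    nb-flip nb-2    = nb-2
    nb-flip (d ∷ n) = (d ∘ flip-injective) ∷ nb-flip n

    walk-flip : ∀ {x y zs} → Walk x zs y → Walk (flip x) (map flip zs) (flip y)
    walk-flip []      = []
    walk-flip (e ∷ p) = flip-edge e ∷ walk-flip p

    unsnoc : ∀ {x y z zs} → Walk x (z ∷ zs) y →
             ∃₂ λ ms t → Walk x ms t × ExtEdge S [] t y × z ∷ zs ≡ ms ++ [ y ]
    unsnoc (e ∷ [])     = [] , _ , [] , e , ≡-refl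
    unsnoc (e ∷ e′ ∷ p) with unsnoc (e′ ∷ p)
    ... | ms , t , p′ , f , eq = _ ∷ ms , t , e ∷ p′ , f , cong (_ ∷_) eq

    last-vertex : ∀ {x y zs} → Walk x zs y → ∃ λ xs → x ∷ zs ≡ xs ++ [ y ]
    last-vertex []      = [] , ≡-refl
    last-vertex {x} (e ∷ p) = let xs , eq = last-vertex p in x ∷ xs , cong (x ∷_) eq

    -- Such an edge is a word `a θ(a)` of `S`, but words of `S` are reduced.
    no-flip-edge : ∀ v → ¬ ExtEdge S [] v (flip v)
    no-flip-edge (inj₁ a) (left-right e) = reduced e a ([] , [] , ≡-refl)
    no-flip-edge (inj₂ b) (right-left e) =
      reduced e (θ b) ([] , [] , cong (λ c → θ b ∷ c ∷ []) (≡-sym (θ-inv b)))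

    -- A walk from v to flip v followed by its own flip is closed, hence
    -- backtracks at flip v; removing both end edges leaves a shorter such walk.
    no-flip-walk : ∀ m v zs → length zs ≤ m → Walk v zs (flip v) → ¬ NonBacktracking (v ∷ zs)
    no-flip-walk _       (inj₁ _) []          _ () _
    no-flip-walk _       (inj₂ _) []          _ () _
    no-flip-walk _       v        (z ∷ [])    _ (e ∷ []) _ = no-flip-edge v e
    no-flip-walk (suc m) v (z ∷ z′ ∷ zs) (s≤s le) (e ∷ p) nb
      with ms , t , pm , f , eq ← unsnoc p | t ≟ᵛ flip z
    ... | yes ≡-refl = no-flip-walk m z ms
            (≤-trans (≤-trans (m≤m+n _ 1) (≤-reflexive (≡-sym (≡-trans (cong length eq) (length-++ ms))))) le) pm
            (nb-init z ms (subst (λ l → NonBacktracking (z ∷ l)) eq (nb-tail nb)))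
    ... | no t≢ = closed (last-vertex (e ∷ pm))
      where
      closed : (∃ λ xs → v ∷ z ∷ ms ≡ xs ++ [ t ]) → ⊥
      closed (xs , eq′) = not-closed
        (subst (Walk v _) (flip-involutive v) ((e ∷ pm) ++ʷ (f ∷ walk-flip (e ∷ p))))
        (subst NonBacktracking list≡
          (nb-join xs {ys = map flip (z′ ∷ zs)}
            (subst NonBacktracking list≡′ nb) t≢ (nb-flip nb)))
        where
        list≡ : xs ++ t ∷ flip v ∷ flip z ∷ map flip (z′ ∷ zs) ≡
                v ∷ z ∷ ms ++ flip v ∷ map flip (z ∷ z′ ∷ zs)
        list≡ = ≡-trans (≡-sym (++-assoc xs [ t ] _)) (cong (_++ flip v ∷ map flip (z ∷ z′ ∷ zs)) (≡-sym eq′))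
        list≡′ : v ∷ z ∷ z′ ∷ zs ≡ xs ++ t ∷ flip v ∷ []
        list≡′ = ≡-trans (cong (λ l → v ∷ z ∷ l) eq)
          (≡-trans (cong (_++ [ flip v ]) eq′) (++-assoc xs [ t ] _))

  -- A path inside one tree would reduce to a walk excluded by `no-flip-walk`. As there are two
  -- trees, the flip exchanges them.
  component-flip : ∀ x → component x ≢ component (flip x)
  component-flip x eq with nonBacktrackingWalk (component-connected eq)
  ... | zs , p , nb = no-flip-walk (length zs) x zs ≤-refl p nb

-- Prefixes, factors and suffixes of words

prefix⁺ : ∀ {A : Set} (v : List A) {s} → Prefix _≡_ v (v ++ s)
prefix⁺ []      = []
prefix⁺ (_ ∷ v) = ≡-refl ∷ prefix⁺ v

prefix⁻ : ∀ {A : Set} {v u : List A} → Prefix _≡_ v u → ∃ λ s → u ≡ v ++ s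
prefix⁻ []           = _ , ≡-refl
prefix⁻ (≡-refl ∷ p) = let s , eq = prefix⁻ p in s , cong (_ ∷_) eq

-- Levi's lemma on two factorisations of one word.
++-overlap : ∀ {A : Set} (p p′ : List A) {s s′} → p ++ s ≡ p′ ++ s′ →
             (∃ λ r → p′ ≡ p ++ r × s ≡ r ++ s′) ⊎ (∃ λ r → p ≡ p′ ++ r × s′ ≡ r ++ s)
++-overlap []      p′       eq = inj₁ (p′ , ≡-refl , eq)
++-overlap (x ∷ p) []       eq = inj₂ (x ∷ p , ≡-refl , ≡-sym eq)
++-overlap (x ∷ p) (y ∷ p′) eq with ∷-injectiveˡ eq | ++-overlap p p′ (∷-injectiveʳ eq)
... | ≡-refl | inj₁ (r , e , f) = inj₁ (r , cong (x ∷_) e , f)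
... | ≡-refl | inj₂ (r , e , f) = inj₂ (r , cong (x ∷_) e , f)

module _ {n : ℕ} where

  factor-∷ : ∀ {v : Word n} {a u} → Factor v u → Factor v (a ∷ u)
  factor-∷ (p , s , eq) = _ ∷ p , s , cong (_ ∷_) eq

  factor-++ˡ : ∀ {v : Word n} p {u} → Factor v u → Factor v (p ++ u)
  factor-++ˡ []      f = f
  factor-++ˡ (_ ∷ p) f = factor-∷ (factor-++ˡ p f)

  factor-++ʳ : ∀ {v : Word n} {u} s → Factor v u → Factor v (u ++ s)
  factor-++ʳ {v} t (p , s , eq) =
    p , s ++ t , ≡-trans (cong (_++ t) eq) (≡-trans (++-assoc p (v ++ s) t) (cong (p ++_) (++-assoc v s t)))

  factor-∷⁻ : ∀ {v : Word n} {a u} → Factor v (a ∷ u) → Prefix _≡_ v (a ∷ u) ⊎ Factor v u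
  factor-∷⁻ ([]    , s , eq) = inj₁ (subst (Prefix _≡_ _) (≡-sym eq) (prefix⁺ _))
  factor-∷⁻ (_ ∷ p , s , eq) = inj₂ (p , s , ∷-injectiveʳ eq)

  prefix⇒factor : ∀ {v u : Word n} → Prefix _≡_ v u → Factor v u
  prefix⇒factor p = let s , eq = prefix⁻ p in [] , s , eq

  factor? : ∀ (v u : Word n) → Dec (Factor v u)
  factor? []      u       = yes ([] , u , ≡-refl)
  factor? (_ ∷ _) []      = no λ { ([] , _ , ()) ; (_ ∷ _ , _ , ()) }
  factor? v@(_ ∷ _) (a ∷ u) with prefix? _≟_ v (a ∷ u) | factor? v u
  ... | yes p | _     = yes (prefix⇒factor p)
  ... | no _  | yes f = yes (factor-∷ f)
  ... | no ¬p | no ¬f = no λ f → [ ¬p , ¬f ]′ (factor-∷⁻ f)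

  factor-length : ∀ {v u : Word n} → Factor v u → length v ≤ length u
  factor-length {v} (p , s , ≡-refl) =
    ≤-trans (m≤m+n (length v) (length s))
      (≤-trans (≤-reflexive (≡-sym (length-++ v)))
        (≤-trans (m≤n+m _ (length p)) (≤-reflexive (≡-sym (length-++ p)))))

  -- The comparison runs from the right because being a non-default extension passes to suffixes.
  suffix-compare : ∀ (u v : Word n) →
    (∃ λ p → u ≡ p ++ v) ⊎ (∃ λ p → v ≡ p ++ u) ⊎
    (∃₂ λ a b → ∃ λ q → ∃₂ λ p p′ → a ≢ b × u ≡ p ++ a ∷ q × v ≡ p′ ++ b ∷ q)
  suffix-compare []      v = inj₂ (inj₁ (v , ≡-sym (++-identityʳ v)))
  suffix-compare (a ∷ u) v with suffix-compare u v
  ... | inj₁ (p , eq) = inj₁ (a ∷ p , cong (a ∷_) eq)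
  ... | inj₂ (inj₂ (b , c , q , p , p′ , b≢c , eq , eq′)) =
    inj₂ (inj₂ (b , c , q , a ∷ p , p′ , b≢c , cong (a ∷_) eq , eq′))
  ... | inj₂ (inj₁ (p , eq)) with initLast p
  ... | []      = inj₁ ([ a ] , cong (a ∷_) (≡-sym eq))
  ... | p ∷ʳ′ b with a ≟ b | ≡-trans eq (++-assoc p [ b ] u)
  ... | yes ≡-refl | eq′ = inj₂ (inj₁ (p , eq′))
  ... | no a≢b     | eq′ = inj₂ (inj₂ (a , b , u , [] , p , a≢b , ≡-refl , eq′))

  lastFrom : Fin n → Word n → Fin n
  lastFrom a []      = a
  lastFrom _ (b ∷ u) = lastFrom b u

  lastFrom-++ : ∀ {b v} p {a} (q : Word n) → b ∷ v ≡ p ++ a ∷ q → lastFrom b v ≡ lastFrom a q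
  lastFrom-++ []           q ≡-refl = ≡-refl
  lastFrom-++ (_ ∷ [])     q ≡-refl = ≡-refl
  lastFrom-++ (_ ∷ c ∷ p)  q ≡-refl = lastFrom-++ (c ∷ p) q ≡-refl

-- Uniform recurrence

uniform-bound : ∀ {n} {P : Fin n → ℕ → Set} → (∀ {i m m′} → m ≤ m′ → P i m → P i m′) →
                (∀ i → ∃ (P i)) → ∃ λ M → ∀ i → P i M
uniform-bound {zero}  mono f = 0 , λ ()
uniform-bound {suc n} mono f =
  let m , p = f zero
      M , q = uniform-bound mono (f ∘ suc)
  in m ⊔ M , λ { zero → mono (m≤m⊔n m M) p ; (suc i) → mono (m≤n⊔m m M) (q i) }

module UniformRecurrence {n : ℕ} {S : Language n} (treeSet : IsTreeSet 2 S) ([]∈S : S [])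
                         (recurrence : ∀ {u v} → S u → S v → ∃ λ x → S (u ++ x ++ v)) where
  open Extension treeSet []∈S

  -- Every nonempty word of S has a default right extension: the default of
  -- a q is the neighbour of a on the path from a to the default of q in E(q).

  FirstStep : Word n → Fin n → Fin n → Fin n → Set
  FirstStep q a r c = ∃₂ λ (s : S q) zs → let open EWalks s in
    Walk (inj₁ a) (inj₂ c ∷ zs) (inj₂ r) × NonBacktracking (inj₁ a ∷ inj₂ c ∷ zs)

  private
    firstStep : ∀ {q a r} → q ≢ [] → S (a ∷ q) → S (q ++ [ r ]) → ∃ (FirstStep q a r)
    firstStep {a = a} q≢[] sa sr
      with s ← suffix-S [ a ] sa
      with EWalks.nonBacktrackingWalk s (connected-E q≢[] s (left sa) (right sr))
    ... | _ , Walks._∷_ (left-right e) p , nb = _ , s , _ , Walks._∷_ (left-right e) p , nb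

    step : ∀ b q a r → Dec (S (a ∷ b ∷ q)) → Dec (S (b ∷ q ++ [ r ])) → Fin n
    step b q a r (yes sa) (yes sr) = proj₁ (firstStep (λ ()) sa sr)
    step b q a r _        _        = a

    step-spec : ∀ {b q a r} d e → S (a ∷ b ∷ q) → S (b ∷ q ++ [ r ]) →
                FirstStep (b ∷ q) a r (step b q a r d e)
    step-spec (yes sa) (yes sr) _ _ = proj₂ (firstStep (λ ()) sa sr)
    step-spec (no ¬sa) _        s _ = ⊥-elim (¬sa s)
    step-spec (yes _)  (no ¬sr) _ s = ⊥-elim (¬sr s)

  default : Fin n → Word n → Fin n
  default a []      = proj₁ (extendʳ [ a ] (letters a))
  default a (b ∷ q) = step b q a (default b q) (S? (a ∷ b ∷ q)) (S? (b ∷ q ++ [ default b q ]))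

  default-S : ∀ a q → S (a ∷ q) → S (a ∷ q ++ [ default a q ])
  default-step : ∀ a b q → S (a ∷ b ∷ q) → FirstStep (b ∷ q) a (default b q) (default a (b ∷ q))

  default-S a []      s = proj₂ (extendʳ [ a ] (letters a))
  default-S a (b ∷ q) s with default-step a b q s
  ... | _ , _ , Walks._∷_ (left-right e) _ , _ = e

  default-step a b q s = step-spec (S? _) (S? _) s (default-S b q (suffix-S [ a ] s))

  NonDefault : Fin n → Word n → Fin n → Set
  NonDefault a q c = S (a ∷ q ++ [ c ]) × c ≢ default a q

  -- If `c` were the default of `b q`, the edge from `a` to `c` would be the whole reduced walk from
  -- `a` to that default, and `c` would be the default of `a b q` too.
  nonDefault-tail : ∀ {a b q c} → NonDefault a (b ∷ q) c → NonDefault b q c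
  nonDefault-tail {a} {b} {q} {c} (s , c≢) with default-step a b q (left-part (b ∷ q) s)
  ... | sq , zs , p , nb = suffix-S [ a ] s , λ c≡ →
    c≢ (inj₂-injective (first-step-unique (left-right s ∷ [])
      nb-2 (subst (Walk _ _) (cong inj₂ (≡-sym c≡)) p) nb))
    where open EWalks sq

  nonDefault-suffix : ∀ {a u c} p {b q} → NonDefault a u c → a ∷ u ≡ p ++ b ∷ q → NonDefault b q c
  nonDefault-suffix []          nd ≡-refl = nd
  nonDefault-suffix (_ ∷ [])    nd ≡-refl = nonDefault-tail nd
  nonDefault-suffix (_ ∷ x ∷ p) nd ≡-refl = nonDefault-suffix (x ∷ p) (nonDefault-tail nd) ≡-refl

  -- The walk from `a` through `c` to `a′`, continued to the default of `b q`, does not backtrack.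
  -- Its first step `c` would then be the default of `a b q`.
  nonDefault-disjoint : ∀ {a a′ b q c} → a ≢ a′ → NonDefault a (b ∷ q) c → NonDefault a′ (b ∷ q) c → ⊥
  nonDefault-disjoint {a} {a′} {b} {q} a≢a′ (s , c≢) (s′ , c≢′)
    with default-step a b q (left-part (b ∷ q) s) | default-step a′ b q (left-part (b ∷ q) s′)
  ... | sq , zs , p , nb | _ , zs′ , p′ , nb′ =
    c≢ (≡-sym (inj₂-injective (first-step-unique p nb
      (left-right s ∷ right-left s′ ∷ p′)
      ((a≢a′ ∘ inj₁-injective) ∷ (c≢′ ∘ inj₂-injective) ∷ nb′))))
    where
    open EWalks sq

  module ReturnBound (b : Fin n) (w′ : Word n) (w∈S : S (b ∷ w′)) where

    w : Word n
    w = b ∷ w′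

    -- The initial occurrence of `w` in `w ++ z` is the only one: any other lies in the word without
    -- its first letter.
    Pending : Word n → Set
    Pending z = S (w ++ z) × ¬ Factor w (w′ ++ z)

    pending? : ∀ z → Dec (Pending z)
    pending? z = S? (w ++ z) ×-dec ¬? (factor? w (w′ ++ z))

    pending-prefix : ∀ z {t} → Pending (z ++ t) → Pending z
    pending-prefix z {t} (s , ¬f) =
      prefix-S (w ++ z) (subst S (≡-sym (++-assoc w z t)) s) ,
      λ f → ¬f (subst (Factor w) (++-assoc w′ z t) (factor-++ʳ t f))

    -- No key is shared, since two distinct pending words are not suffixes of
    -- one another: they branch to the left of a nonempty common suffix q,
    -- where c would be a non-default neighbour of two vertices of E(q).
    key-injective : ∀ {z z′ c} → Pending z → Pending z′ →
      NonDefault b (w′ ++ z) c → NonDefault b (w′ ++ z′) c →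
      lastFrom b (w′ ++ z) ≡ lastFrom b (w′ ++ z′) → z ≡ z′
    key-injective {z} {z′} (_ , ¬f) (_ , ¬f′) nd nd′ eq with suffix-compare (w ++ z) (w ++ z′)
    ... | inj₁ ([]    , e) = ++-cancelˡ w z z′ e
    ... | inj₁ (_ ∷ p , e) = ⊥-elim (¬f (p , z′ , ∷-injectiveʳ e))
    ... | inj₂ (inj₁ ([]    , e)) = ≡-sym (++-cancelˡ w z′ z e)
    ... | inj₂ (inj₁ (_ ∷ p , e)) = ⊥-elim (¬f′ (p , z , ∷-injectiveʳ e))
    ... | inj₂ (inj₂ (a , a′ , [] , p , p′ , a≢a′ , e , e′)) =
      ⊥-elim (a≢a′ (≡-trans (≡-sym (lastFrom-++ p [] e)) (≡-trans eq (lastFrom-++ p′ [] e′))))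
    ... | inj₂ (inj₂ (a , a′ , _ ∷ q , p , p′ , a≢a′ , e , e′)) =
      ⊥-elim (nonDefault-disjoint a≢a′ (nonDefault-suffix p nd e) (nonDefault-suffix p′ nd′ e′))

    Key : Set
    Key = Fin n × Fin n

    key : Word n → Fin n → Key
    key z c = lastFrom b (w′ ++ z) , c

    Bounded : Word n → Set
    Bounded z = ∃ λ M → ∀ t → Pending (z ++ t) → length t ≤ M

    -- `ks` contains every key that can occur at `z` or beyond. It serves as a budget for branching,
    -- since by `key-injective` each key is spent at most once.
    Available : Word n → List Key → Set
    Available z ks = ∀ t c → Pending (z ++ t) → NonDefault b (w′ ++ z ++ t) c → key (z ++ t) c ∈ ks

    private
      snoc-assoc : ∀ z {e : Fin n} {t} → (z ++ [ e ]) ++ t ≡ z ++ e ∷ t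
      snoc-assoc z = ++-assoc z _ _

      bounded-∷ : ∀ {z} → (∀ e → Bounded (z ++ [ e ])) → Bounded z
      bounded-∷ {z} f with uniform-bound {P = λ e M → ∀ t → Pending ((z ++ [ e ]) ++ t) → length t ≤ M}
                             (λ le g t u → ≤-trans (g t u) le) f
      ... | M , g = suc M , λ where
        []      _ → z≤n
        (e ∷ t) u → s≤s (g e t (subst Pending (≡-sym (snoc-assoc z)) u))

      vacuous : ∀ {z} → ¬ Pending z → Bounded z
      vacuous {z} ¬u = 0 , λ t u → ⊥-elim (¬u (pending-prefix z u))

      available-∷ʳ : ∀ {z ks} e → Available z ks → Available (z ++ [ e ]) ks
      available-∷ʳ {z} e av t c u nd =
        subst (λ y → (lastFrom b (w′ ++ y) , c) ∈ _) (≡-sym (snoc-assoc z))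
          (av (e ∷ t) c (subst Pending (snoc-assoc z) u)
            (subst (λ y → NonDefault b (w′ ++ y) c) (snoc-assoc z) nd))

      _≟ᵏ_ : DecidableEquality Key
      _≟ᵏ_ = ×-≡-dec _≟_ _≟_

      remove : Key → List Key → List Key
      remove k = filter (λ k′ → ¬? (k′ ≟ᵏ k))

      -- A later use of the same key would, by `key-injective`, identify `z` with a proper extension
      -- of itself.
      available-remove : ∀ {z ks c} e → Pending z → NonDefault b (w′ ++ z) c →
                         Available z ks → Available (z ++ [ e ]) (remove (key z c) ks)
      available-remove {z} {c = c} e u nd av t c′ u′ nd′ =
        ∈-filter⁺ (λ k′ → ¬? (k′ ≟ᵏ key z c)) (available-∷ʳ {z} e av t c′ u′ nd′) λ eq → absurd (cong proj₁ eq) (cong proj₂ eq)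
        where
        absurd : lastFrom b (w′ ++ (z ++ [ e ]) ++ t) ≡ lastFrom b (w′ ++ z) → c′ ≡ c → ⊥
        absurd eq ≡-refl with key-injective u′ u nd′ nd eq
        ... | eq′ with ++-cancelˡ z (e ∷ t) [] (≡-trans (≡-sym (snoc-assoc z)) (≡-trans eq′ (≡-sym (++-identityʳ z))))
        ... | ()

      -- Recurrence provides a continuation in which `w` occurs again.
      return : ∀ {z} → Pending z → ∃ λ t → S (w ++ z ++ t) × ¬ Pending (z ++ t)
      return {z} (s , _) with recurrence s w∈S
      ... | v , r = v ++ w , subst S (++-assoc w z (v ++ w)) r ,
        λ { (_ , ¬f) → ¬f (factor-++ˡ w′ (factor-++ˡ z (factor-++ˡ v ([] , [] , ≡-sym (++-identityʳ w))))) }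

      nonDefault-either : ∀ {z c e} → c ≢ e → S (w ++ z ++ [ c ]) → S (w ++ z ++ [ e ]) →
                          ∃ (NonDefault b (w′ ++ z))
      nonDefault-either {z} {c} {e} c≢e sc se with c ≟ default b (w′ ++ z)
      ... | no c≢      = c , subst S (≡-sym (++-assoc w z [ c ])) sc , c≢
      ... | yes ≡-refl = e , subst S (≡-sym (++-assoc w z [ e ])) se , λ { ≡-refl → c≢e ≡-refl }

      -- A word leading back to `w` is followed letter by letter with the same budget. Where a
      -- pending word leaves it, `z` has two right extensions; one of them is non-default, and its
      -- key is removed before the branch is explored. The measure is the number of keys, then the
      -- length of the word followed.
      bounded : ∀ m z ks → length ks ≤ m → Pending z → Available z ks → Bounded z
      bounded-along : ∀ m z ks → length ks ≤ m → Pending z → Available z ks →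
                      ∀ t → S (w ++ z ++ t) → ¬ Pending (z ++ t) → Bounded z

      bounded m z ks le u av =
        let t , s , ¬u = return u in bounded-along m z ks le u av t s ¬u

      bounded-along m z ks le u av []      s ¬u = ⊥-elim (¬u (subst Pending (≡-sym (++-identityʳ z)) u))
      bounded-along m z ks le u av (c ∷ t) s ¬u = bounded-∷ {z} branch
        where
        branch : ∀ e → Bounded (z ++ [ e ])
        branch e with pending? (z ++ [ e ])
        ... | no ¬u′ = vacuous ¬u′
        ... | yes u′ with c ≟ e
        ... | yes ≡-refl = bounded-along m (z ++ [ c ]) ks le u′ (available-∷ʳ {z} c av) t
                (subst (λ y → S (w ++ y)) (≡-sym (snoc-assoc z)) s) (¬u ∘ subst Pending (snoc-assoc z))
        ... | no c≢e with nonDefault-either c≢e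
                (prefix-S (w ++ z ++ [ c ]) (subst S (≡-trans (cong (w ++_) (≡-sym (snoc-assoc z))) (≡-sym (++-assoc w (z ++ [ c ]) t))) s))
                (proj₁ u′)
        ... | d , nd = off-path m le
          where
          k∈ks : key z d ∈ ks
          k∈ks = subst (λ y → (lastFrom b (w′ ++ y) , d) ∈ ks) (++-identityʳ z)
            (av [] d (subst Pending (≡-sym (++-identityʳ z)) u)
                     (subst (λ y → NonDefault b (w′ ++ y) d) (≡-sym (++-identityʳ z)) nd))
          fewer : length (remove (key z d) ks) < length ks
          fewer = filter-notAll _ ks (lose k∈ks λ k≢k → k≢k ≡-refl)
          off-path : ∀ m → length ks ≤ m → Bounded (z ++ [ e ])
          off-path zero    le = ⊥-elim (n≮0 (≤-trans fewer le))
          off-path (suc m) le = bounded m (z ++ [ e ]) (remove (key z d) ks)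
            (s≤s⁻¹ (≤-trans fewer le)) u′ (available-remove {z} e u nd av)

      last-occurrence : ∀ u → Factor w u → ∃₂ λ p z → u ≡ p ++ w ++ z × ¬ Factor w (w′ ++ z)
      last-occurrence []      (_ ∷ _ , _ , ())
      last-occurrence []      ([]    , _ , ())
      last-occurrence (a ∷ u) f with factor? w u
      ... | yes g = let p , z , eq , ¬f = last-occurrence u g in a ∷ p , z , cong (a ∷_) eq , ¬f
      last-occurrence (a ∷ u) ([]    , z , eq) | no ¬g =
        [] , z , eq , subst (λ v → ¬ Factor w v) (∷-injectiveʳ eq) ¬g
      last-occurrence (a ∷ u) (_ ∷ p , z , eq) | no ¬g = ⊥-elim (¬g (p , z , ∷-injectiveʳ eq))

    pending-bounded : Bounded []
    pending-bounded = bounded _ [] (cartesianProduct (allFin n) (allFin n)) ≤-refl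
      (subst S (≡-sym (++-identityʳ w)) w∈S ,
       λ f → 1+n≰n (subst (λ v → length w ≤ length v) (++-identityʳ w′) (factor-length f)))
      (λ t c _ _ → ∈-cartesianProduct⁺ (∈-allFin _) (∈-allFin c))

    -- Recurrence gives a word `w x u` of `S`. If its last occurrence of `w` starts before `u`, then
    -- `u` is a suffix of `w z` with `z` pending, so its length is bounded.
    uniformly-recurrent : ∃ λ N → ∀ u → S u → N ≤ length u → Factor w u
    uniformly-recurrent = suc (length w + proj₁ pending-bounded) , occurs
      where
      occurs : ∀ u → S u → suc (length w + proj₁ pending-bounded) ≤ length u → Factor w u
      occurs u s le with recurrence w∈S s
      ... | x , r with last-occurrence (w ++ x ++ u) ([] , x ++ u , ≡-refl)
      ... | p , z , eq , ¬f with ++-overlap (w ++ x) p (≡-trans (++-assoc w x u) eq)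
      ... | inj₁ (y , _ , u≡) = y , z , u≡
      ... | inj₂ (y , _ , wz≡) = ⊥-elim (1+n≰n (≤-trans le (≤-trans
              (≤-trans (m≤n+m (length u) (length y)) (≤-reflexive (≡-trans (≡-sym (length-++ y)) (≡-trans (cong length (≡-sym wz≡)) (length-++ w)))))
              (+-monoʳ-≤ (length w) (proj₂ pending-bounded z (suffix-S p (subst S eq r) , ¬f))))))

-- Comparing and cutting prefixes and suffixes

suffix⁺ : ∀ {A : Set} p {v : List A} → Suffix _≡_ v (p ++ v)
suffix⁺ []      = here (≡⇒Pointwise-≡ ≡-refl)
suffix⁺ (_ ∷ p) = there (suffix⁺ p)

suffix⁻ : ∀ {A : Set} {v u : List A} → Suffix _≡_ v u → ∃ λ p → u ≡ p ++ v
suffix⁻ (here eq)  = [] , ≡-sym (Pointwise-≡⇒≡ eq)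
suffix⁻ (there s)  = let p , eq = suffix⁻ s in _ ∷ p , cong (_ ∷_) eq

prefix-unique : ∀ {A : Set} {u v x : List A} → Prefix _≡_ u x → Prefix _≡_ v x →
                length u ≡ length v → u ≡ v
prefix-unique []           []           _  = ≡-refl
prefix-unique (≡-refl ∷ p) (≡-refl ∷ q) eq = cong (_ ∷_) (prefix-unique p q (suc-inj eq))
  where
  suc-inj : ∀ {m n} → suc m ≡ suc n → m ≡ n
  suc-inj ≡-refl = ≡-refl

suffix-unique : ∀ {A : Set} (p q : List A) {u v} → p ++ u ≡ q ++ v → length u ≡ length v → u ≡ v
suffix-unique p q {u} {v} eq |u|≡|v| = ++-cancelˡ p u v
  (≡-trans eq (cong (_++ v) (≡-sym (prefix-unique (prefix⁺ p) (subst (Prefix _≡_ q) (≡-sym eq) (prefix⁺ q)) |p|≡|q|))))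
  where
  |p|≡|q| : length p ≡ length q
  |p|≡|q| = +-cancelʳ-≡ (length u) _ _
    (≡-trans (≡-sym (length-++ p)) (≡-trans (cong length eq)
      (≡-trans (length-++ q) (cong (length q +_) (≡-sym |u|≡|v|)))))

prefix-shorten : ∀ {A : Set} {v : List A} u {s} → length v ≤ length u →
                 Prefix _≡_ v (u ++ s) → Prefix _≡_ v u
prefix-shorten {v = []}    _       _        _       = []
prefix-shorten {v = _ ∷ _} (_ ∷ u) (s≤s le) (e ∷ p) = e ∷ prefix-shorten u le p

prefix-lengthen : ∀ {A : Set} {v u : List A} {s} → Prefix _≡_ v u → Prefix _≡_ v (u ++ s)
prefix-lengthen []      = []
prefix-lengthen (e ∷ p) = e ∷ prefix-lengthen p

drop-length : ∀ {A : Set} (p : List A) {s} → drop (length p) (p ++ s) ≡ s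
drop-length []      = ≡-refl
drop-length (_ ∷ p) = drop-length p

take-length : ∀ {A : Set} (p : List A) {s} → take (length p) (p ++ s) ≡ p
take-length []      = ≡-refl
take-length (a ∷ p) = cong (a ∷_) (take-length p)

-- Marks at the occurrences of `w` and its inverse

module Marks {n : ℕ} (θ : Fin n → Fin n) (θ-inv : Involutive _≡_ θ)
             (w : Word n) (w≢[] : w ≢ []) (¬overlap : ¬ Overlap w (inv θ w)) where
  open Inverse θ θ-inv

  w⁻ : Word n
  w⁻ = inv θ w

  X : Word n → Set
  X = ｛_｝± θ w

  w≢w⁻ : w ≢ w⁻
  w≢w⁻ eq = ¬overlap (inj₁ (w , w≢[] , ([] , ≡-refl) , ([] , ≡-trans (≡-sym eq) (≡-sym (++-identityʳ w)))))

  X-length : ∀ {m} → X m → length m ≡ length w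
  X-length (inj₁ ≡-refl) = ≡-refl
  X-length (inj₂ ≡-refl) = length-inv w

  X-≢[] : ∀ {m} → X m → m ≢ []
  X-≢[] (inj₁ ≡-refl) = w≢[]
  X-≢[] (inj₂ ≡-refl) = inv-≢[] w≢[]

  X-inv : ∀ {m} → X m → X (inv θ m)
  X-inv (inj₁ ≡-refl) = inj₂ ≡-refl
  X-inv (inj₂ ≡-refl) = inj₁ (inv-involutive w)

  -- The parts of an occurrence on the two sides of its mark, which is at the end of `w` and at the
  -- beginning of `w⁻`.
  before after : ∀ {m} → X m → Word n
  before (inj₁ _) = w
  before (inj₂ _) = []
  after  (inj₁ _) = []
  after  (inj₂ _) = w⁻

  before-after : ∀ {m} (x : X m) → m ≡ before x ++ after x
  before-after (inj₁ ≡-refl) = ≡-sym (++-identityʳ w)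
  before-after (inj₂ ≡-refl) = ≡-refl

  inv-before : ∀ {m} (x : X m) → inv θ (before x) ≡ after (X-inv x)
  inv-before (inj₁ ≡-refl) = ≡-refl
  inv-before (inj₂ ≡-refl) = ≡-refl

  inv-after : ∀ {m} (x : X m) → inv θ (after x) ≡ before (X-inv x)
  inv-after (inj₁ ≡-refl) = ≡-refl
  inv-after (inj₂ ≡-refl) = inv-involutive w

  Marked : Word n → Set
  Marked p = Factor w p ⊎ Factor w⁻ p

  marked? : ∀ p → Dec (Marked p)
  marked? p = factor? w p ⊎-dec factor? w⁻ p

  mark : ∀ {m p} → X m → Factor m p → Marked p
  mark (inj₁ ≡-refl) = inj₁
  mark (inj₂ ≡-refl) = inj₂

  unmark : ∀ {p} → Marked p → ∃ λ m → X m × Factor m p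
  unmark (inj₁ f) = w  , inj₁ ≡-refl , f
  unmark (inj₂ f) = w⁻ , inj₂ ≡-refl , f

  marked-∷ : ∀ {a p} → Marked p → Marked (a ∷ p)
  marked-∷ (inj₁ f) = inj₁ (factor-∷ f)
  marked-∷ (inj₂ f) = inj₂ (factor-∷ f)

  marked-++ʳ : ∀ {p} s → Marked p → Marked (p ++ s)
  marked-++ʳ s (inj₁ f) = inj₁ (factor-++ʳ s f)
  marked-++ʳ s (inj₂ f) = inj₂ (factor-++ʳ s f)

  factor-inv : ∀ {v u} → Factor v u → Factor (inv θ v) (inv θ u)
  factor-inv {v} (p , s , ≡-refl) = inv θ s , inv θ p ,
    ≡-trans (inv-++ p (v ++ s)) (≡-trans (cong (_++ inv θ p) (inv-++ v s)) (++-assoc (inv θ s) (inv θ v) (inv θ p)))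

  marked-inv : ∀ {p} → Marked p → Marked (inv θ p)
  marked-inv m = let _ , x , f = unmark m in mark (X-inv x) (factor-inv f)

  marked-length : ∀ {p} → Marked p → length w ≤ length p
  marked-length m = let _ , x , f = unmark m in ≤-trans (≤-reflexive (≡-sym (X-length x))) (factor-length f)

  ¬marked-[] : ¬ Marked []
  ¬marked-[] m = w≢[] (length⁻ w (marked-length m))
    where
    length⁻ : ∀ (v : Word n) → length v ≤ 0 → v ≡ []
    length⁻ [] _ = ≡-refl

  Starts : Word n → Set
  Starts p = Prefix _≡_ w p ⊎ Prefix _≡_ w⁻ p

  starts? : ∀ p → Dec (Starts p)
  starts? p = prefix? _≟_ w p ⊎-dec prefix? _≟_ w⁻ p

  starts : ∀ {m} → X m → ∀ s → Starts (m ++ s)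
  starts (inj₁ ≡-refl) s = inj₁ (prefix⁺ w)
  starts (inj₂ ≡-refl) s = inj₂ (prefix⁺ w⁻)

  starts⁻ : ∀ {u} → Starts u → ∃ λ m → X m × ∃ λ s → u ≡ m ++ s
  starts⁻ (inj₁ p) = w  , inj₁ ≡-refl , prefix⁻ p
  starts⁻ (inj₂ p) = w⁻ , inj₂ ≡-refl , prefix⁻ p

  starts⇒marked : ∀ {u} → Starts u → Marked u
  starts⇒marked (inj₁ p) = inj₁ (prefix⇒factor p)
  starts⇒marked (inj₂ p) = inj₂ (prefix⇒factor p)

  starts-shorten : ∀ u {s} → length w ≤ length u → Starts (u ++ s) → Starts u
  starts-shorten u le (inj₁ p) = inj₁ (prefix-shorten u le p)
  starts-shorten u le (inj₂ p) = inj₂ (prefix-shorten u (≤-trans (≤-reflexive (length-inv w)) le) p)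

  starts-lengthen : ∀ {u} s → Starts u → Starts (u ++ s)
  starts-lengthen s (inj₁ p) = inj₁ (prefix-lengthen p)
  starts-lengthen s (inj₂ p) = inj₂ (prefix-lengthen p)

  marked-∷⁻ : ∀ {a p} → Marked (a ∷ p) → Starts (a ∷ p) ⊎ Marked p
  marked-∷⁻ (inj₁ f) = [ inj₁ ∘ inj₁ , inj₂ ∘ inj₁ ]′ (factor-∷⁻ f)
  marked-∷⁻ (inj₂ f) = [ inj₁ ∘ inj₂ , inj₂ ∘ inj₂ ]′ (factor-∷⁻ f)

  X-prefix-unique : ∀ {u} → Prefix _≡_ w u → Prefix _≡_ w⁻ u → ⊥
  X-prefix-unique p q = w≢w⁻ (prefix-unique p q (≡-sym (length-inv w)))

  toMark : Word n → Word n
  toMark-∷ : ∀ a p → Dec (Prefix _≡_ w (a ∷ p)) → Dec (Prefix _≡_ w⁻ (a ∷ p)) → Word n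
  -- Up to the first mark; junk for unmarked words.
  toMark []      = []
  toMark (a ∷ p) = toMark-∷ a p (prefix? _≟_ w (a ∷ p)) (prefix? _≟_ w⁻ (a ∷ p))
  toMark-∷ a p (yes _) _       = w
  toMark-∷ a p (no _)  (yes _) = []
  toMark-∷ a p (no _)  (no _)  = a ∷ toMark p

  toMark-starts : ∀ {m} (x : X m) s → toMark (m ++ s) ≡ before x
  toMark-starts {[]}    x s = ⊥-elim (X-≢[] x ≡-refl)
  toMark-starts {a ∷ m} x s = go x (prefix? _≟_ w (a ∷ m ++ s)) (prefix? _≟_ w⁻ (a ∷ m ++ s))
    where
    prefix : ∀ {v} → a ∷ m ≡ v → Prefix _≡_ v (a ∷ m ++ s)
    prefix eq = subst (λ v → Prefix _≡_ v (a ∷ m ++ s)) eq (prefix⁺ (a ∷ m))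
    go : ∀ (x : X (a ∷ m)) d d⁻ → toMark-∷ a (m ++ s) d d⁻ ≡ before x
    go (inj₁ eq) (yes _) _       = ≡-refl
    go (inj₁ eq) (no ¬p) _       = ⊥-elim (¬p (prefix eq))
    go (inj₂ eq) (yes p) _       = ⊥-elim (X-prefix-unique p (prefix eq))
    go (inj₂ eq) (no _)  (yes _) = ≡-refl
    go (inj₂ eq) (no _)  (no ¬p) = ⊥-elim (¬p (prefix eq))

  toMark-skip : ∀ {a p} → ¬ Starts (a ∷ p) → toMark (a ∷ p) ≡ a ∷ toMark p
  toMark-skip {a} {p} ¬s with prefix? _≟_ w (a ∷ p) | prefix? _≟_ w⁻ (a ∷ p)
  ... | yes q | _     = ⊥-elim (¬s (inj₁ q))
  ... | no _  | yes q = ⊥-elim (¬s (inj₂ q))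
  ... | no _  | no _  = ≡-refl

  -- No occurrence ends inside `y ++ m`. All words of `X` have the same length, so `m` is the first
  -- occurrence.
  IsFirst : Word n → Word n → Set
  IsFirst y m = ∀ q v s → s ≢ [] → X v → y ++ m ≡ q ++ v ++ s → ⊥

  record First (p : Word n) : Set where
    constructor firstMark
    field
      {m}     : Word n
      x       : X m
      y r     : Word n
      split   : p ≡ y ++ m ++ r
      isFirst : IsFirst y m

  private
    too-long : ∀ {u v s : Word n} q → length u ≡ length v → s ≢ [] → u ≢ q ++ v ++ s
    too-long {s = []}    q eq s≢[] _ = s≢[] ≡-refl
    too-long {u} {v} {c ∷ s} q eq _ e = 1+n≰n (≤-trans le (≤-reflexive eq))
      where
      le : suc (length v) ≤ length u
      le = ≤-trans (≤-trans (≤-trans (s≤s (m≤m+n _ (length s))) (≤-reflexive (≡-sym (≡-trans (length-++ v) (+-suc (length v) (length s))))))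
             (≤-trans (m≤n+m _ (length q)) (≤-reflexive (≡-sym (length-++ q))))) (≤-reflexive (cong length (≡-sym e)))

  first : ∀ {p} → Marked p → First p
  first {[]}    mk = ⊥-elim (¬marked-[] mk)
  first {a ∷ p} mk with starts? (a ∷ p)
  ... | yes st with starts⁻ st
  ... | m , x , s , eq = firstMark x [] s eq λ q v t t≢[] x′ →
    too-long q (≡-trans (X-length x) (≡-sym (X-length x′))) t≢[]
  first {a ∷ p} mk | no ¬st with first ([ (λ st → ⊥-elim (¬st st)) , (λ m → m) ]′ (marked-∷⁻ mk))
  ... | firstMark {m} x y r ≡-refl isF = firstMark x (a ∷ y) r ≡-refl λ where
    []      v s s≢[] x′ eq → ¬st (subst (λ l → Starts (a ∷ l)) (++-assoc y m r)
      (starts-lengthen r (subst Starts (≡-sym eq) (starts x′ s))))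
    (_ ∷ q) v s s≢[] x′ eq → isF q v s s≢[] x′ (∷-injectiveʳ eq)

  toMark-first : ∀ {m} (x : X m) y r → IsFirst y m → toMark (y ++ m ++ r) ≡ y ++ before x
  toMark-first         x []      r isF = toMark-starts x r
  toMark-first {m = m} x (a ∷ y) r isF = ≡-trans (toMark-skip ¬st) (cong (a ∷_)
      (toMark-first x y r λ q v s s≢[] x′ eq → isF (a ∷ q) v s s≢[] x′ (cong (a ∷_) eq)))
    where
    ¬st : ¬ Starts (a ∷ y ++ m ++ r)
    ¬st st with starts⁻ (starts-shorten (a ∷ y ++ m) {r} le (subst (λ l → Starts (a ∷ l)) (≡-sym (++-assoc y m r)) st))
      where
      le : length w ≤ length (a ∷ y ++ m)
      le = ≤-trans (≤-reflexive (≡-sym (X-length x)))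
        (≤-trans (m≤n+m (length m) (suc (length y))) (≤-reflexive (cong suc (≡-sym (length-++ y)))))
    ... | v , x′ , s@(_ ∷ _) , eq = isF [] v s (λ ()) x′ eq
    -- An occurrence filling the whole word would be longer than `m`.
    ... | v , x′ , [] , eq = 1+n≰n (≤-trans
            (s≤s (≤-trans (m≤n+m (length m) (length y)) (≤-reflexive (≡-sym (length-++ y)))))
            (≤-reflexive (≡-trans (cong length (≡-trans eq (++-identityʳ v)))
              (≡-trans (X-length x′) (≡-sym (X-length x))))))

-- Complete return words and mixed return words

module Returns {n : ℕ} (θ : Fin n → Fin n) (θ-inv : Involutive _≡_ θ)
               (w : Word n) (w≢[] : w ≢ []) (¬overlap : ¬ Overlap w (inv θ w))
               {S : Language n} (factorial : IsFactorial S)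
               (inverse : ∀ {u} → S u → S (inv θ u)) where
  open Inverse θ θ-inv
  open Marks θ θ-inv w w≢[] ¬overlap public
  open IsFactorial factorial

  Return : Word n → Set
  Return = IsCompleteReturn S X

  MR : Word n → Set
  MR = MixedReturn θ S w

  private
    cut : ∀ u → ℕ → ℕ → Word n
    cut u i j = drop i (take (length u ∸ j) u)

    cut-middle : ∀ (p N s : Word n) → cut (p ++ N ++ s) (length p) (length s) ≡ N
    cut-middle p N s =
      ≡-trans (cong (drop (length p)) (≡-trans (cong₂ take len (≡-sym (++-assoc p N s))) (take-length (p ++ N))))
              (drop-length p)
      where
      len : length (p ++ N ++ s) ∸ length s ≡ length (p ++ N)
      len = ≡-trans (cong (_∸ length s) (≡-trans (cong length (≡-sym (++-assoc p N s))) (length-++ (p ++ N))))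
                    (m+n∸n≡m (length (p ++ N)) (length s))

    prefix-cut : ∀ {m u s} (x : X m) → u ≡ m ++ s →
                 (if does (prefix? _≟_ w u) then length w else 0) ≡ length (before x)
    prefix-cut {m} {u} {s} x eq = go x (prefix? _≟_ w u)
      where
      prefix : ∀ {v} → m ≡ v → Prefix _≡_ v u
      prefix {v} e = subst (Prefix _≡_ v) (≡-sym (≡-trans eq (cong (_++ s) e))) (prefix⁺ v)
      go : ∀ (x : X m) (d : Dec (Prefix _≡_ w u)) → (if does d then length w else 0) ≡ length (before x)
      go (inj₁ e) (yes _) = ≡-refl
      go (inj₁ e) (no ¬p) = ⊥-elim (¬p (prefix e))
      go (inj₂ e) (yes p) = ⊥-elim (X-prefix-unique p (prefix e))
      go (inj₂ e) (no _)  = ≡-refl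

    suffix-cut : ∀ {m u p} (x : X m) → u ≡ p ++ m →
                 (if does (suffix? _≟_ w⁻ u) then length w⁻ else 0) ≡ length (after x)
    suffix-cut {m} {u} {p} x eq = go x (suffix? _≟_ w⁻ u)
      where
      go : ∀ (x : X m) (d : Dec (Suffix _≡_ w⁻ u)) → (if does d then length w⁻ else 0) ≡ length (after x)
      go (inj₁ e) (no _)  = ≡-refl
      go (inj₁ e) (yes s) with q , eq′ ← suffix⁻ s =
        ⊥-elim (w≢w⁻ (suffix-unique p q (≡-trans (cong (p ++_) (≡-sym e)) (≡-trans (≡-sym eq) eq′))
          (≡-sym (length-inv w))))
      go (inj₂ e) (yes _) = ≡-refl
      go (inj₂ e) (no ¬s) = ⊥-elim (¬s (subst (Suffix _≡_ w⁻) (≡-sym (≡-trans eq (cong (p ++_) e))) (suffix⁺ p)))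

  -- As the words of `X` have equal length, `u` begins with only one of them and ends with only one.
  -- The tests in `erase` therefore remove exactly `before x` and `after x′`, and what remains is
  -- read between the two marks.
  erase-unique : ∀ {m m′ u s p N} (x : X m) (x′ : X m′) → u ≡ m ++ s → u ≡ p ++ m′ →
                 u ≡ before x ++ N ++ after x′ → erase θ w u ≡ N
  erase-unique {u = u} {N = N} x x′ pre suf eq =
    ≡-trans (cong₂ (cut u) (prefix-cut x pre) (suffix-cut x′ suf))
      (≡-trans (cong (λ v → cut v (length (before x)) (length (after x′))) eq)
        (cut-middle (before x) N (after x′)))

  -- The case that needs an argument is `w` in front and `w⁻` at the end: if the two met in a
  -- nonempty word, it would be a suffix of `w` and a prefix of `w⁻`.
  middle : ∀ {m m′ s p} (x : X m) (x′ : X m′) → m ++ s ≡ p ++ m′ →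
           ∃ λ N → m ++ s ≡ before x ++ N ++ after x′
  middle {s = s} (inj₁ ≡-refl) (inj₁ ≡-refl) eq = s , cong (w ++_) (≡-sym (++-identityʳ s))
  middle {p = p} (inj₂ ≡-refl) (inj₂ ≡-refl) eq = p , eq
  middle {s = s} (inj₂ ≡-refl) (inj₁ ≡-refl) eq = w⁻ ++ s , ≡-sym (++-identityʳ (w⁻ ++ s))
  middle {s = s} {p = p} (inj₁ ≡-refl) (inj₂ ≡-refl) eq with ++-overlap w p eq
  ... | inj₁ (r , _ , s≡)       = r , cong (w ++_) s≡
  ... | inj₂ ([] , _ , w⁻≡)     = [] , cong (w ++_) (≡-sym w⁻≡)
  ... | inj₂ (c ∷ r , w≡ , w⁻≡) = ⊥-elim (¬overlap (inj₁ (c ∷ r , (λ ()) , (p , w≡) , (s , w⁻≡))))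

  record Ends (u : Word n) : Set where
    field
      {m m′}   : Word n
      x        : X m
      x′       : X m′
      {s p}    : Word n
      prefix   : u ≡ m ++ s
      suffix   : u ≡ p ++ m′
      s≢[]     : s ≢ []
      p≢[]     : p ≢ []
      erased   : u ≡ before x ++ erase θ w u ++ after x′

  ends : ∀ {u} → Return u → Ends u
  ends {u} ret with IsCompleteReturn.properPrefix ret | IsCompleteReturn.properSuffix ret
  ... | m , s , x , s≢[] , pre | p , m′ , x′ , p≢[] , suf with middle x x′ (≡-trans (≡-sym pre) suf)
  ... | N , eq = record
    { x = x ; x′ = x′ ; prefix = pre ; suffix = suf ; s≢[] = s≢[] ; p≢[] = p≢[]
    ; erased = ≡-trans u≡ (cong (λ v → before x ++ v ++ after x′) (≡-sym (erase-unique x x′ pre suf u≡))) }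
    where
    u≡ : u ≡ before x ++ N ++ after x′
    u≡ = ≡-trans pre eq

  return-inv : ∀ {u} → Return u → Return (inv θ u)
  return-inv {u} ret = record
    { member       = inverse member
    ; properPrefix = inv θ m′ , inv θ p , X-inv x′ , inv-≢[] p≢[] , ≡-trans (cong (inv θ) suffix) (inv-++ p m′)
    ; properSuffix = inv θ s , inv θ m , X-inv x , inv-≢[] s≢[] , ≡-trans (cong (inv θ) prefix) (inv-++ m s)
    ; noInternal   = λ a v b a≢[] b≢[] eq xv → noInternal (inv θ b) (inv θ v) (inv θ a)
        (inv-≢[] b≢[]) (inv-≢[] a≢[]) (inv-split a v b eq) (X-inv xv)
    }
    where
    open IsCompleteReturn ret
    open Ends (ends ret)
    inv-split : ∀ a v b → inv θ u ≡ a ++ v ++ b → u ≡ inv θ b ++ inv θ v ++ inv θ a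
    inv-split a v b eq = ≡-trans (≡-sym (inv-involutive u)) (≡-trans (cong (inv θ) eq)
      (≡-trans (inv-++ a (v ++ b)) (≡-trans (cong (_++ inv θ a) (inv-++ v b)) (++-assoc (inv θ b) (inv θ v) (inv θ a)))))

  erase-inv : ∀ {u} → Return u → erase θ w (inv θ u) ≡ inv θ (erase θ w u)
  erase-inv {u} ret = erase-unique (X-inv x′) (X-inv x)
    (≡-trans (cong (inv θ) suffix) (inv-++ p m′)) (≡-trans (cong (inv θ) prefix) (inv-++ m s))
    (≡-trans (cong (inv θ) erased)
      (≡-trans (inv-++ (before x) (N ++ after x′))
        (≡-trans (cong (_++ inv θ (before x)) (inv-++ N (after x′)))
          (≡-trans (++-assoc (inv θ (after x′)) (inv θ N) (inv θ (before x)))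
            (cong₂ (λ f g → f ++ inv θ N ++ g) (inv-after x′) (inv-before x))))))
    where
    open Ends (ends ret)
    N = erase θ w u

  MR-inv : ∀ {v} → MR v → MR (inv θ v)
  MR-inv (u , ret , ≡-refl) = inv θ u , return-inv ret , ≡-sym (erase-inv ret)

  toMark-++ʳ : ∀ {p} s → Marked p → toMark (p ++ s) ≡ toMark p
  toMark-++ʳ s mk with first mk
  ... | firstMark {m} x y r ≡-refl isF =
    ≡-trans (cong toMark (≡-trans (++-assoc y (m ++ r) s) (cong (y ++_) (++-assoc m r s))))
      (≡-trans (toMark-first x y (r ++ s) isF) (≡-sym (toMark-first x y r isF)))

  -- Completed by `after x′`, both sides spell the return word. So the mixed return word is the step
  -- from the first mark of `a ∷ q` to that of `q`.
  return-step : ∀ {a q} → Return (a ∷ q) → a ∷ toMark q ≡ toMark (a ∷ q) ++ erase θ w (a ∷ q)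
  return-step {a} {q} ret with ends ret
  ... | record { p = [] ; p≢[] = p≢[] } = ⊥-elim (p≢[] ≡-refl)
  ... | record { m = m ; m′ = m′ ; x = x ; x′ = x′ ; s = s ; p = b ∷ y ; prefix = pre ; suffix = suf ; erased = er } =
    ++-cancelʳ (after x′) _ _ (≡-trans lhs (≡-trans er (≡-sym rhs)))
    where
    N = erase θ w (a ∷ q)
    q≡ : q ≡ y ++ m′ ++ []
    q≡ = ≡-trans (∷-injectiveʳ suf) (cong (y ++_) (≡-sym (++-identityʳ m′)))
    isF : IsFirst y m′
    isF q′ v t t≢[] xv eq = IsCompleteReturn.noInternal ret (a ∷ q′) v t (λ ()) t≢[]
      (cong (a ∷_) (≡-trans (∷-injectiveʳ suf) eq)) xv
    lhs : (a ∷ toMark q) ++ after x′ ≡ a ∷ q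
    lhs = cong (a ∷_) (≡-trans (cong (_++ after x′) (≡-trans (cong toMark q≡) (toMark-first x′ y [] isF)))
      (≡-trans (++-assoc y (before x′) (after x′))
        (≡-trans (cong (y ++_) (≡-sym (before-after x′))) (≡-sym (∷-injectiveʳ suf)))))
    rhs : (toMark (a ∷ q) ++ N) ++ after x′ ≡ before x ++ N ++ after x′
    rhs = ≡-trans (++-assoc (toMark (a ∷ q)) N (after x′))
      (cong (_++ N ++ after x′) (≡-trans (cong toMark pre) (toMark-starts x s)))

  return-marked : ∀ {a q} → Return (a ∷ q) → Marked q
  return-marked {a} {q} ret with ends ret
  ... | record { p = [] ; p≢[] = p≢[] } = ⊥-elim (p≢[] ≡-refl)
  ... | record { m′ = m′ ; x′ = x′ ; p = b ∷ y ; suffix = suf } =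
    mark x′ (y , [] , ≡-trans (∷-injectiveʳ suf) (cong (y ++_) (≡-sym (++-identityʳ m′))))

  return-starts : ∀ {u} → Return u → Starts u
  return-starts ret = subst Starts (≡-sym prefix) (starts x s)
    where open Ends (ends ret)

  -- The word is cut after the first occurrence of a word of `X` in `p`.
  first-return : ∀ {a p} → S (a ∷ p) → Starts (a ∷ p) → Marked p →
                 ∃₂ λ u r → p ≡ u ++ r × Return (a ∷ u)
  first-return {a} {p} sap st mk with first mk
  ... | firstMark {m′} x′ y r ≡-refl isF
    with starts⁻ (starts-shorten (a ∷ y ++ m′) {r} le (subst (λ l → Starts (a ∷ l)) (≡-sym (++-assoc y m′ r)) st))
    where
    le : length w ≤ length (a ∷ y ++ m′)
    le = ≤-trans (≤-reflexive (≡-sym (X-length x′)))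
      (≤-trans (m≤n+m (length m′) (suc (length y))) (≤-reflexive (cong suc (≡-sym (length-++ y)))))
  ... | m , x , s , eq = y ++ m′ , r , ≡-sym (++-assoc y m′ r) , record
    { member       = factors ([] , r , cong (a ∷_) (≡-sym (++-assoc y m′ r))) sap
    ; properPrefix = m , s , x , s≢[] , eq
    ; properSuffix = a ∷ y , m′ , x′ , (λ ()) , ≡-refl
    ; noInternal   = λ where
        []      v t a≢[] _    _ _  → a≢[] ≡-refl
        (_ ∷ q) v t _    t≢[] e xv → isF q v t t≢[] xv (∷-injectiveʳ e)
    }
    where
    s≢[] : s ≢ []
    s≢[] ≡-refl = 1+n≰n (≤-trans
      (s≤s (≤-trans (m≤n+m (length m′) (length y)) (≤-reflexive (≡-sym (length-++ y)))))
      (≤-reflexive (≡-trans (cong length (≡-trans eq (++-identityʳ m))) (≡-trans (X-length x) (≡-sym (X-length x′))))))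

  starts-return : ∀ {a q} r → Return (a ∷ q) → toMark (a ∷ q ++ r) ≡ toMark (a ∷ q)
  starts-return r ret = toMark-++ʳ r (starts⇒marked (return-starts ret))

  mixed-step : ∀ {a p} → S (a ∷ p) → Starts (a ∷ p) → Marked p →
               ∃ λ v → MR v × a ∷ toMark p ≡ toMark (a ∷ p) ++ v
  mixed-step {a} sap st mk with first-return sap st mk
  ... | u , r , ≡-refl , ret = erase θ w (a ∷ u) , (a ∷ u , ret , ≡-refl) ,
    ≡-trans (cong (a ∷_) (toMark-++ʳ r (return-marked ret)))
      (≡-trans (return-step ret) (cong (_++ erase θ w (a ∷ u)) (≡-sym (starts-return r ret))))

two-values : ∀ {i j k : Fin 2} → i ≢ j → k ≢ j → i ≡ k
two-values {zero}     {zero}     {k}        i≢j _   = ⊥-elim (i≢j ≡-refl)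
two-values {suc zero} {suc zero} {k}        i≢j _   = ⊥-elim (i≢j ≡-refl)
two-values {zero}     {suc zero} {zero}     _   _   = ≡-refl
two-values {zero}     {suc zero} {suc zero} _   k≢j = ⊥-elim (k≢j ≡-refl)
two-values {suc zero} {zero}     {suc zero} _   _   = ≡-refl
two-values {suc zero} {zero}     {zero}     _   k≢j = ⊥-elim (k≢j ≡-refl)

-- Products along words and evaluation in `Gθ`

module WordProduct {c ℓ} (G : Group c ℓ) where
  open Group G renaming (_∙_ to _·_; _≈_ to _≋_; ε to 𝟙; _⁻¹ to _⁻)
  open SetoidReasoning setoid

  product-++ : ∀ xs ys → product G (xs ++ ys) ≋ product G xs · product G ys
  product-++ []       ys = Group.sym G (Group.identityˡ G _)
  product-++ (x ∷ xs) ys = Group.trans G (∙-congˡ (product-++ xs ys)) (Group.sym G (Group.assoc G _ _ _))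

  product-map-++ : ∀ {A : Set} (f : A → Carrier) u v →
                   product G (map f (u ++ v)) ≋ product G (map f u) · product G (map f v)
  product-map-++ f []      v = Group.sym G (Group.identityˡ G _)
  product-map-++ f (a ∷ u) v = Group.trans G (∙-congˡ (product-map-++ f u v)) (Group.sym G (Group.assoc G _ _ _))

  product-map-inv : ∀ {n} {θ : Fin n → Fin n} (θ-inv : Involutive _≡_ θ) (f : Fin n → Carrier) →
                    (∀ a → f a · f (θ a) ≋ 𝟙) → ∀ u →
                    product G (map f u) · product G (map f (inv θ u)) ≋ 𝟙
  product-map-inv θ-inv f rel []      = Group.identityˡ G 𝟙
  product-map-inv {θ = θ} θ-inv f rel (a ∷ u) = begin
    (f a · P u) · P (inv θ (a ∷ u))            ≡⟨ cong (λ v → (f a · P u) · P v) (inv-∷ a u) ⟩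
    (f a · P u) · P (inv θ u ++ [ θ a ])       ≈⟨ ∙-congˡ (product-map-++ f (inv θ u) _) ⟩
    (f a · P u) · (P (inv θ u) · (f (θ a) · 𝟙)) ≈⟨ Group.assoc G _ _ _ ⟩
    f a · (P u · (P (inv θ u) · (f (θ a) · 𝟙))) ≈⟨ ∙-congˡ (Group.assoc G _ _ _) ⟨
    f a · ((P u · P (inv θ u)) · (f (θ a) · 𝟙)) ≈⟨ ∙-congˡ (Group.∙-cong G (product-map-inv θ-inv f rel u) (Group.identityʳ G _)) ⟩
    f a · (𝟙 · f (θ a))                        ≈⟨ ∙-congˡ (Group.identityˡ G _) ⟩
    f a · f (θ a)                              ≈⟨ rel a ⟩
    𝟙                                          ∎
    where
    open Inverse θ θ-inv
    P : _ → Carrier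
    P v = product G (map f v)

module Evaluation {n : ℕ} (θ : Fin n → Fin n) (θ-inv : Involutive _≡_ θ) where
  open Inverse θ θ-inv
  open GroupProperties (Gθ θ) using (inverseʳ-unique)

  infix 4 _≋_
  _≋_ : Expr n → Expr n → Set
  _≋_ = _≈_ θ

  ⟦⟧-map : ∀ u → ⟦_⟧ θ u ≋ product (Gθ θ) (map gen u)
  ⟦⟧-map []      = refl
  ⟦⟧-map (a ∷ u) = ∙-cong refl (⟦⟧-map u)

  ⟦⟧-++ : ∀ u v → ⟦_⟧ θ (u ++ v) ≋ ⟦_⟧ θ u ∙ ⟦_⟧ θ v
  ⟦⟧-++ []      v = sym (identityˡ _)
  ⟦⟧-++ (a ∷ u) v = trans (∙-cong refl (⟦⟧-++ u v)) (sym (assoc _ _ _))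

  ⟦⟧-inverseʳ : ∀ u → ⟦_⟧ θ u ∙ ⟦_⟧ θ (inv θ u) ≋ ε
  ⟦⟧-inverseʳ u = trans (∙-cong (⟦⟧-map u) (⟦⟧-map (inv θ u)))
    (WordProduct.product-map-inv (Gθ θ) θ-inv gen relator u)

  ⟦⟧-inv : ∀ u → ⟦_⟧ θ (inv θ u) ≋ ⟦_⟧ θ u ⁻¹
  ⟦⟧-inv u = inverseʳ-unique _ _ (⟦⟧-inverseʳ u)

-- The mixed return words generate the group

module Generation {n : ℕ} (θ : Fin n → Fin n) (θ-inv : Involutive _≡_ θ) {S : Language n}
    (specular : IsSpecular θ S) ([]∈S : S [])
    (recurrence : ∀ {u v} → S u → S v → ∃ λ x → S (u ++ x ++ v))
    (w : Word n) (w∈S : S w) (w≢[] : w ≢ []) (¬overlap : ¬ Overlap w (inv θ w)) where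
  open Laminary θ θ-inv specular []∈S
  open Returns θ θ-inv w w≢[] ¬overlap factorial inverse
  open Evaluation θ θ-inv
  open SetoidReasoning (Group.setoid (Gθ θ))
  open GroupProperties (Gθ θ) using (⁻¹-involutive; ⁻¹-anti-homo-∙; ∙-cancelˡ)

  Generated : Expr n → Set
  Generated g = ∃ λ xs → All (elements θ MR) xs × product (Gθ θ) xs ≋ g

  elements-⁻¹ : ∀ {g} → elements θ MR g → elements θ MR (g ⁻¹)
  elements-⁻¹ (v , mr , eq) = inv θ v , MR-inv mr , trans (⟦⟧-inv v) (⁻¹-cong eq)

  generated-ε : Generated ε
  generated-ε = [] , [] , refl

  generated-∙ : ∀ {g h} → Generated g → Generated h → Generated (g ∙ h)
  generated-∙ (xs , as , e) (ys , bs , f) =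
    xs ++ ys , All-++⁺ as bs , trans (WordProduct.product-++ (Gθ θ) xs ys) (∙-cong e f)

  generated-≋ : ∀ {g h} → g ≋ h → Generated g → Generated h
  generated-≋ e (xs , as , f) = xs , as , trans f e

  generated-⁻¹ : ∀ {g} → Generated g → Generated (g ⁻¹)
  generated-⁻¹ (xs , as , e) = generated-≋ (⁻¹-cong e) (go as)
    where
    go : ∀ {xs} → All (elements θ MR) xs → Generated (product (Gθ θ) xs ⁻¹)
    go []       = generated-≋ (trans (sym (inverseʳ ε)) (identityˡ _)) generated-ε
    go (a ∷ as) = generated-≋ (sym (⁻¹-anti-homo-∙ _ _))
      (generated-∙ (go as) (_ ∷ [] , elements-⁻¹ a ∷ [] , identityʳ _))

  infix 4 _∼_
  -- Equality of the left cosets of `g` and `h`. The products of mixed return words form a subgroup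
  -- because inverses of mixed return words are mixed return words.
  _∼_ : Expr n → Expr n → Set
  g ∼ h = ∃ λ k → Generated k × g ∙ k ≋ h

  ∼-≋ : ∀ {g h} → g ≋ h → g ∼ h
  ∼-≋ e = ε , generated-ε , trans (identityʳ _) e

  ∼-sym : ∀ {g h} → g ∼ h → h ∼ g
  ∼-sym {g} {h} (k , gk , e) = k ⁻¹ , generated-⁻¹ gk , (begin
    h ∙ k ⁻¹          ≈⟨ ∙-cong e refl ⟨
    (g ∙ k) ∙ k ⁻¹    ≈⟨ assoc _ _ _ ⟩
    g ∙ (k ∙ k ⁻¹)    ≈⟨ ∙-cong refl (inverseʳ k) ⟩
    g ∙ ε             ≈⟨ identityʳ g ⟩
    g                 ∎)

  ∼-trans : ∀ {f g h} → f ∼ g → g ∼ h → f ∼ h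
  ∼-trans (k , gk , e) (l , gl , e′) =
    k ∙ l , generated-∙ gk gl , trans (sym (assoc _ _ _)) (trans (∙-cong e refl) e′)

  ∼-congˡ : ∀ f {g h} → g ∼ h → f ∙ g ∼ f ∙ h
  ∼-congˡ f (k , gk , e) = k , gk , trans (assoc _ _ _) (∙-cong refl e)

  ∼-cancelˡ : ∀ f {g h} → f ∙ g ∼ f ∙ h → g ∼ h
  ∼-cancelˡ f (k , gk , e) = k , gk , ∙-cancelˡ f _ _ (trans (sym (assoc _ _ _)) e)

  coset : Word n → Expr n
  coset p = ⟦_⟧ θ (toMark p)

  coset-++ʳ : ∀ {p} s → Marked p → coset (p ++ s) ≡ coset p
  coset-++ʳ s mk = cong (⟦_⟧ θ) (toMark-++ʳ s mk)

  -- If no occurrence starts at `a`, the first mark stays in place. Otherwise the first marks of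
  -- `a ∷ p` and of `p` are consecutive, with a mixed return word between them.
  coset-∷ : ∀ {a p} → S (a ∷ p) → Marked p → gen a ∙ coset p ∼ coset (a ∷ p)
  coset-∷ {a} {p} s mk with starts? (a ∷ p)
  ... | no ¬st = ∼-≋ (Group.reflexive (Gθ θ) (cong (⟦_⟧ θ) (≡-sym (toMark-skip ¬st))))
  ... | yes st with mixed-step s st mk
  ... | v , mr , eq = ∼-sym (⟦_⟧ θ v , (_ ∷ [] , (v , mr , refl) ∷ [] , identityʳ _) ,
    trans (sym (⟦⟧-++ (toMark (a ∷ p)) v)) (Group.reflexive (Gθ θ) (cong (⟦_⟧ θ) (≡-sym eq))))

  coset-++ˡ : ∀ u {p} → S (u ++ p) → Marked p → ⟦_⟧ θ u ∙ coset p ∼ coset (u ++ p)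
  coset-++ˡ []      s mk = ∼-≋ (identityˡ _)
  coset-++ˡ (a ∷ u) s mk = ∼-trans (∼-≋ (assoc _ _ _))
    (∼-trans (∼-congˡ (gen a) (coset-++ˡ u (suffix-S [ a ] s) mk)) (coset-∷ s (marked-++ˡ u mk)))
    where
    marked-++ˡ : ∀ u {p} → Marked p → Marked (u ++ p)
    marked-++ˡ []      mk = mk
    marked-++ˡ (_ ∷ u) mk = marked-∷ (marked-++ˡ u mk)

  private
    -- By `only` there is a single occurrence, so its inverse is the first one in the inverse word.
    toMark-inv : ∀ {m} (x : X m) s → (∀ {p a} → m ++ s ≡ a ∷ p → ¬ Marked p) →
                 toMark (inv θ (m ++ s)) ≡ inv θ s ++ inv θ (after x)
    toMark-inv {m} x s only = ≡-trans (cong toMark eq)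
      (≡-trans (toMark-first (X-inv x) (inv θ s) [] isF) (cong (inv θ s ++_) (≡-sym (inv-after x))))
      where
      eq : inv θ (m ++ s) ≡ inv θ s ++ inv θ m ++ []
      eq = ≡-trans (inv-++ m s) (cong (inv θ s ++_) (≡-sym (++-identityʳ (inv θ m))))
      isF : IsFirst (inv θ s) (inv θ m)
      isF q v t t≢[] xv e with inv θ t in t⁻≡
      ... | []     = inv-≢[] t≢[] t⁻≡
      ... | a ∷ t⁻ = only {p = t⁻ ++ inv θ v ++ inv θ q}
        (≡-trans (≡-sym (inv-involutive (m ++ s))) (≡-trans (cong (inv θ) (≡-trans (inv-++ m s) e))
          (≡-trans (inv-++ q (v ++ t)) (≡-trans (cong (_++ inv θ q) (≡-trans (inv-++ v t) (cong (_++ inv θ v) t⁻≡)))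
            (++-assoc (a ∷ t⁻) (inv θ v) (inv θ q))))))
        (mark (X-inv xv) (t⁻ , inv θ q , ≡-refl))

  -- What precedes the first mark of the inverse is the inverse of what follows the last mark of
  -- `p`; so the left side is `p` read up to its last mark. Letters are removed on the left until a
  -- single mark is left.
  coset-inv : ∀ p → S p → Marked p → ⟦_⟧ θ p ∙ coset (inv θ p) ∼ coset p
  coset-inv []      s mk = ⊥-elim (¬marked-[] mk)
  coset-inv (a ∷ p) s mk with marked? p
  ... | yes mk′ = ∼-trans (∼-≋ (trans (assoc _ _ _) (∙-cong refl (∙-cong refl
                    (Group.reflexive (Gθ θ) (≡-trans (cong coset (inv-∷ a p)) (coset-++ʳ _ (marked-inv mk′))))))))
                    (∼-trans (∼-congˡ (gen a) (coset-inv p (suffix-S [ a ] s) mk′)) (coset-∷ s mk′))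
  ... | no ¬mk′ with starts⁻ ([ (λ st → st) , (λ mk′ → ⊥-elim (¬mk′ mk′)) ]′ (marked-∷⁻ mk))
  ... | m , x , t , eq = ∼-≋ (begin
    ⟦_⟧ θ (a ∷ p) ∙ coset (inv θ (a ∷ p))
      ≡⟨ cong (λ u → ⟦_⟧ θ u ∙ coset (inv θ u)) eq ⟩
    ⟦_⟧ θ (m ++ t) ∙ coset (inv θ (m ++ t))
      ≡⟨ cong (λ u → ⟦_⟧ θ (m ++ t) ∙ ⟦_⟧ θ u) (toMark-inv x t λ e → ¬mk′ ∘ subst Marked (≡-sym (∷-injectiveʳ (≡-trans eq e)))) ⟩
    ⟦_⟧ θ (m ++ t) ∙ ⟦_⟧ θ (inv θ t ++ inv θ (after x))
      ≡⟨ cong₂ (λ u v → ⟦_⟧ θ u ∙ ⟦_⟧ θ v)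
           (≡-trans (cong (_++ t) (before-after x)) (++-assoc (before x) (after x) t)) (≡-sym (inv-++ (after x) t)) ⟩
    ⟦_⟧ θ (before x ++ after x ++ t) ∙ ⟦_⟧ θ (inv θ (after x ++ t))
      ≈⟨ ∙-cong (⟦⟧-++ (before x) _) refl ⟩
    (⟦_⟧ θ (before x) ∙ ⟦_⟧ θ (after x ++ t)) ∙ ⟦_⟧ θ (inv θ (after x ++ t))
      ≈⟨ assoc _ _ _ ⟩
    ⟦_⟧ θ (before x) ∙ (⟦_⟧ θ (after x ++ t) ∙ ⟦_⟧ θ (inv θ (after x ++ t)))
      ≈⟨ ∙-cong refl (⟦⟧-inverseʳ (after x ++ t)) ⟩
    ⟦_⟧ θ (before x) ∙ ε
      ≈⟨ identityʳ _ ⟩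
    ⟦_⟧ θ (before x)
      ≡⟨ cong (⟦_⟧ θ) (≡-trans (cong toMark eq) (toMark-starts x t)) ⟨
    coset (a ∷ p) ∎)

  Agree : Word n → Set
  Agree p = ∀ z z′ → S (p ++ z) → S (p ++ z′) → Marked (p ++ z) → Marked (p ++ z′) →
            coset (p ++ z) ∼ coset (p ++ z′)

  marked-extension : ∀ u → S u → ∃ λ z → S (u ++ z) × ∀ {p} → Marked (p ++ z)
  marked-extension u s with recurrence s w∈S
  ... | v , r = v ++ w , r , λ {p} →
    inj₁ (factor-++ˡ p (factor-++ˡ v ([] , [] , ≡-sym (++-identityʳ w))))

  module Spread (q : Word n) (agreeˡ : ∀ a → Agree (a ∷ q)) (agreeʳ : ∀ c → Agree (q ++ [ c ]))
                (y : Expr n) where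

    Constant : Fin n ⊎ Fin n → Set
    Constant (inj₁ a) = ∀ z → S (a ∷ q ++ z) → Marked (a ∷ q ++ z) → gen a ∙ y ∼ coset (a ∷ q ++ z)
    Constant (inj₂ c) = ∀ z → S (q ++ c ∷ z) → Marked (q ++ c ∷ z) → y ∼ coset (q ++ c ∷ z)

    agreeʳ′ : ∀ c z z′ → S (q ++ c ∷ z) → S (q ++ c ∷ z′) → Marked (q ++ c ∷ z) → Marked (q ++ c ∷ z′) →
              coset (q ++ c ∷ z) ∼ coset (q ++ c ∷ z′)
    agreeʳ′ c z z′ with agreeʳ c z z′
    ... | ag rewrite ++-assoc q [ c ] z | ++-assoc q [ c ] z′ = ag

    -- A marked extension of `a q c` begins with `a q` and, without `a`, with `q c`, which compares
    -- the values at the two ends of the edge. `agreeˡ` and `agreeʳ` carry the result to all other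
    -- continuations.
    spread-edge : ∀ {x x′} → ExtEdge S q x x′ → Constant x → Constant x′
    spread-edge (left-right {a} {c} e) const z s mk
      with marked-extension _ e
    ... | t , r , mk′ = let r′ = subst S (cong (a ∷_) (++-assoc q [ c ] t)) r
                            mk″ = λ {p} → subst Marked (++-assoc p [ c ] t) mk′
                            rq  = suffix-S [ a ] r′ in
      ∼-trans (∼-cancelˡ (gen a) (∼-trans (const (c ∷ t) r′ (mk″ {a ∷ q})) (∼-sym (coset-∷ r′ (mk″ {q})))))
        (agreeʳ′ c t z rq s (mk″ {q}) mk)
    spread-edge (right-left {a} {c} e) const z s mk
      with marked-extension _ e
    ... | t , r , mk′ = let r′ = subst S (cong (a ∷_) (++-assoc q [ c ] t)) r
                            mk″ = λ {p} → subst Marked (++-assoc p [ c ] t) mk′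
                            rq  = suffix-S [ a ] r′ in
      ∼-trans (∼-congˡ (gen a) (const t rq (mk″ {q})))
        (∼-trans (coset-∷ r′ (mk″ {q})) (agreeˡ a (c ∷ t) z r′ s (mk″ {a ∷ q}) mk))

    spread : ∀ {x x′} → Path q x x′ → Constant x → Constant x′
    spread Star.ε  const = const
    spread (e ◅ p) const = spread p (spread-edge e const)

  module _ (N : ℕ) (uniform : ∀ u → S u → N ≤ length u → Marked u) where

    -- Descending induction on the length of `p`, with `m` bounding its distance to `N`. A marked
    -- `p` contains its first mark; an unmarked one is continued by two right vertices of the
    -- connected graph of `p`, and the value spreads from one to the other.
    agree-bounded : ∀ m p → N ≤ m + length p → p ≢ [] → Agree p
    agree-bounded m p le p≢[] z z′ s s′ mk mk′ with marked? p
    ... | yes mkp = ∼-≋ (Group.reflexive (Gθ θ) (≡-trans (coset-++ʳ z mkp) (≡-sym (coset-++ʳ z′ mkp))))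
    agree-bounded zero    p le p≢[] z z′ s s′ mk mk′ | no ¬mk = ⊥-elim (¬mk (uniform p (prefix-S p s) le))
    agree-bounded (suc m) p le p≢[] []      z′ s s′ mk mk′ | no ¬mk = ⊥-elim (¬mk (subst Marked (++-identityʳ p) mk))
    agree-bounded (suc m) p le p≢[] (c ∷ z) [] s s′ mk mk′ | no ¬mk = ⊥-elim (¬mk (subst Marked (++-identityʳ p) mk′))
    agree-bounded (suc m) p le p≢[] (c ∷ z) (c′ ∷ z′) s s′ mk mk′ | no ¬mk =
      spread (connected-E p≢[] (prefix-S p s) (right (snoc s)) (right (snoc s′)))
        (λ t st mkt → agreeʳ′ c z t s st mk mkt) z′ s′ mk′
      where
      snoc : ∀ {c z} → S (p ++ c ∷ z) → S (p ++ [ c ])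
      snoc {c} {z} s = prefix-S (p ++ [ c ]) (subst S (≡-sym (++-assoc p [ c ] z)) s)
      open Spread p
        (λ a → agree-bounded m (a ∷ p) (≤-trans le (≤-reflexive (≡-sym (+-suc m (length p))))) (λ ()))
        (λ c → agree-bounded m (p ++ [ c ])
          (≤-trans le (≤-reflexive (≡-trans (≡-sym (+-suc m (length p)))
            (cong (m +_) (≡-trans (+-comm 1 (length p)) (≡-sym (length-++ p))))))) (snoc-≢[] p))
        (coset (p ++ c ∷ z))

    agree : ∀ p → p ≢ [] → Agree p
    agree p = agree-bounded N p (m≤m+n N (length p))

    agree-letter : ∀ c → Agree [ c ]
    agree-letter c = agree [ c ] (λ ())

    -- For the empty word the value to be spread is the trivial coset.
    open Spread [] agree-letter agree-letter ε

    w⁻-letter : ∃₂ λ c z → w⁻ ≡ c ∷ z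
    w⁻-letter with w⁻ in eq
    ... | []    = ⊥-elim (inv-≢[] w≢[] eq)
    ... | c ∷ z = c , z , ≡-refl

    -- The word `w⁻` has its mark at the very beginning, so its coset is trivial.
    constant-root : Constant (inj₂ (proj₁ w⁻-letter))
    constant-root t s mk with w⁻-letter
    ... | c , z , eq = ∼-trans
      (∼-≋ (Group.reflexive (Gθ θ) (cong (⟦_⟧ θ) (≡-sym (≡-trans (cong toMark (≡-trans (≡-sym eq) (≡-sym (++-identityʳ w⁻)))) (toMark-starts (inj₂ ≡-refl) []))))))
      (agree-letter c z t (subst S eq (inverse w∈S)) s (subst Marked eq (inj₂ ([] , [] , ≡-sym (++-identityʳ w⁻)))) mk)

    -- A word `q c z` of `S` with `q` marked is chosen. By the relation for `c` and the hypothesis,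
    -- the trivial coset is that of `c` times the coset of `θ c ∷ inv θ q`. By `coset-inv` for
    -- `q c`, multiplying this by `q` gives the coset of `q c z`; then `q` cancels.
    constant-flip : ∀ c → Constant (inj₁ (θ c)) → Constant (inj₂ c)
    constant-flip c const z s mk
      with recurrence w∈S s
    ... | x , r = ∼-trans (∼-trans (∼-≋ (trans (sym (relator c)) (∙-cong refl (sym (identityʳ _)))))
        (∼-congˡ (gen c) (const (inv θ q) θcq mkq)))
        (∼-cancelˡ (⟦_⟧ θ q) (∼-trans (∼-trans (∼-≋ (sym regroup)) (∼-trans (coset-inv (q ++ [ c ]) qc (marked-++ʳ [ c ] (inj₁ ([] , x , ≡-refl))))
          (∼-≋ (Group.reflexive (Gθ θ) (≡-trans (coset-++ʳ [ c ] mkq′) (≡-sym (coset-++ʳ (c ∷ z) mkq′))))) ))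
          (∼-sym (coset-++ˡ q r′ mk))))
      where
      q : Word n
      q = w ++ x
      mkq′ : Marked q
      mkq′ = inj₁ ([] , x , ≡-refl)
      r′ : S (q ++ c ∷ z)
      r′ = subst S (≡-sym (++-assoc w x (c ∷ z))) r
      qc : S (q ++ [ c ])
      qc = prefix-S (q ++ [ c ]) (subst S (≡-sym (++-assoc q [ c ] z)) r′)
      θcq : S (θ c ∷ inv θ q)
      θcq = subst S (inv-∷ʳ q c) (inverse qc)
      mkq : Marked (θ c ∷ inv θ q)
      mkq = marked-∷ (marked-inv mkq′)
      regroup : ⟦_⟧ θ (q ++ [ c ]) ∙ coset (inv θ (q ++ [ c ])) ≋
                ⟦_⟧ θ q ∙ (gen c ∙ coset (θ c ∷ inv θ q))
      regroup = begin
        ⟦_⟧ θ (q ++ [ c ]) ∙ coset (inv θ (q ++ [ c ]))  ≡⟨ cong (λ v → ⟦_⟧ θ (q ++ [ c ]) ∙ coset v) (inv-∷ʳ q c) ⟩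
        ⟦_⟧ θ (q ++ [ c ]) ∙ k                           ≈⟨ ∙-cong (⟦⟧-++ q [ c ]) refl ⟩
        (⟦_⟧ θ q ∙ (gen c ∙ ε)) ∙ k                      ≈⟨ assoc _ _ _ ⟩
        ⟦_⟧ θ q ∙ ((gen c ∙ ε) ∙ k)                      ≈⟨ ∙-cong refl (∙-cong (identityʳ _) refl) ⟩
        ⟦_⟧ θ q ∙ (gen c ∙ k)                            ∎
        where k = coset (θ c ∷ inv θ q)

    -- The value spreads over the tree of the root. If `c` is in the other tree, its flip is in this
    -- one.
    constant : ∀ c → Constant (inj₂ c)
    constant c with component (inj₂ c₀) ≟ component (inj₂ c)
      where c₀ = proj₁ w⁻-letter
    ... | yes eq = spread (component-connected eq) constant-root
    ... | no neq = constant-flip c (spread (component-connected (two-values neq (component-flip (inj₂ c) ∘ ≡-sym))) constant-root)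

    -- The words `c t` and `a c t` both have the trivial coset, and the cosets differ by the factor
    -- `a`.
    generated-gen : ∀ a → Generated (gen a)
    generated-gen a with extendʳ [ a ] (letters a)
    ... | c , ac with marked-extension _ ac
    ... | t , r , mk =
      let k , gk , e = ∼-sym (∼-trans (∼-congˡ (gen a) (constant c t (suffix-S [ a ] r) (mk {[ c ]})))
                      (∼-trans (coset-∷ r (mk {[ c ]})) (∼-sym (constant a (c ∷ t) r (mk {a ∷ [ c ]})))))
      in generated-≋ (trans (sym (identityˡ k)) (trans e (identityʳ _))) gk

    generates : ∀ g → Generated g
    generates (gen a) = generated-gen a
    generates ε       = generated-ε
    generates (g ∙ h) = generated-∙ (generates g) (generates h)
    generates (g ⁻¹)  = generated-⁻¹ (generates g)

-- Solving group identities by free reduction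

module GroupSolver (G : Group 0ℓ 0ℓ) where
  open Group G using (Carrier; setoid; ∙-congˡ; ∙-congʳ)
    renaming (_∙_ to _·_; _≈_ to _≋_; ε to 𝟙; _⁻¹ to _⁻)
  open GroupProperties G using (⁻¹-involutive; ⁻¹-anti-homo-∙; ε⁻¹≈ε)
  open SetoidReasoning setoid

  module _ {k : ℕ} (ρ : Vec Carrier k) where

    eval : Expr k → Carrier
    eval (gen i) = lookup ρ i
    eval ε       = 𝟙
    eval (e ∙ f) = eval e · eval f
    eval (e ⁻¹)  = eval e ⁻

    letter : Bool × Fin k → Carrier
    letter (true  , i) = lookup ρ i
    letter (false , i) = lookup ρ i ⁻

    evalWord : List (Bool × Fin k) → Carrier
    evalWord []      = 𝟙
    evalWord (l ∷ u) = letter l · evalWord u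

  push : ∀ {k} → Bool × Fin k → List (Bool × Fin k) → List (Bool × Fin k)
  push l [] = l ∷ []
  push (s , i) ((t , j) ∷ u) with i ≟ j | s Bool.≟ t
  ... | yes _ | no _ = u
  ... | _     | _    = (s , i) ∷ (t , j) ∷ u

  -- The Boolean is a sign: `false` stands for the inverse of the expression. The reduced word is
  -- built in front of the accumulator `u`.
  normalise : ∀ {k} → Bool → Expr k → List (Bool × Fin k) → List (Bool × Fin k)
  normalise s     (gen i) u = push (s , i) u
  normalise s     ε       u = u
  normalise true  (e ∙ f) u = normalise true e (normalise true f u)
  normalise false (e ∙ f) u = normalise false f (normalise false e u)
  normalise s     (e ⁻¹)  u = normalise (not s) e u

  module _ {k : ℕ} (ρ : Vec Carrier k) where

    push-sound : ∀ l u → evalWord ρ (push l u) ≋ letter ρ l · evalWord ρ u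
    push-sound l [] = Group.refl G
    push-sound (s , i) ((t , j) ∷ u) with i ≟ j | s Bool.≟ t
    ... | yes _ | yes _ = Group.refl G
    ... | no _  | yes _ = Group.refl G
    ... | no _  | no _  = Group.refl G
    push-sound (s , i) ((t , i) ∷ u) | yes ≡-refl | no s≢t = begin
      evalWord ρ u                                         ≈⟨ Group.identityˡ G _ ⟨
      𝟙 · evalWord ρ u                                     ≈⟨ ∙-congʳ (cancel s t s≢t) ⟨
      (letter ρ (s , i) · letter ρ (t , i)) · evalWord ρ u ≈⟨ Group.assoc G _ _ _ ⟩
      letter ρ (s , i) · (letter ρ (t , i) · evalWord ρ u) ∎
      where
      cancel : ∀ s t → s ≢ t → letter ρ (s , i) · letter ρ (t , i) ≋ 𝟙
      cancel true  true  d = ⊥-elim (d ≡-refl)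
      cancel true  false _ = Group.inverseʳ G _
      cancel false true  _ = Group.inverseˡ G _
      cancel false false d = ⊥-elim (d ≡-refl)

    signed : Bool → Carrier → Carrier
    signed true  g = g
    signed false g = g ⁻

    normalise-sound : ∀ s e u → evalWord ρ (normalise s e u) ≋ signed s (eval ρ e) · evalWord ρ u
    normalise-sound true  (gen i) u = push-sound (true , i) u
    normalise-sound false (gen i) u = push-sound (false , i) u
    normalise-sound true  ε       u = Group.sym G (Group.identityˡ G _)
    normalise-sound false ε       u =
      Group.sym G (Group.trans G (∙-congʳ ε⁻¹≈ε) (Group.identityˡ G _))
    normalise-sound true  (e ∙ f) u = begin
      evalWord ρ (normalise true e (normalise true f u))  ≈⟨ normalise-sound true e _ ⟩
      eval ρ e · evalWord ρ (normalise true f u)          ≈⟨ ∙-congˡ (normalise-sound true f u) ⟩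
      eval ρ e · (eval ρ f · evalWord ρ u)                ≈⟨ Group.assoc G _ _ _ ⟨
      (eval ρ e · eval ρ f) · evalWord ρ u                ∎
    normalise-sound false (e ∙ f) u = begin
      evalWord ρ (normalise false f (normalise false e u))  ≈⟨ normalise-sound false f _ ⟩
      eval ρ f ⁻ · evalWord ρ (normalise false e u)         ≈⟨ ∙-congˡ (normalise-sound false e u) ⟩
      eval ρ f ⁻ · (eval ρ e ⁻ · evalWord ρ u)              ≈⟨ Group.assoc G _ _ _ ⟨
      (eval ρ f ⁻ · eval ρ e ⁻) · evalWord ρ u              ≈⟨ ∙-congʳ (⁻¹-anti-homo-∙ _ _) ⟨
      (eval ρ e · eval ρ f) ⁻ · evalWord ρ u                ∎
    normalise-sound true  (e ⁻¹)  u = normalise-sound false e u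
    normalise-sound false (e ⁻¹)  u =
      Group.trans G (normalise-sound true e u) (∙-congʳ (Group.sym G (⁻¹-involutive _)))

    solve : ∀ e f → normalise true e [] ≡ normalise true f [] → eval ρ e ≋ eval ρ f
    solve e f eq = begin
      eval ρ e                           ≈⟨ Group.identityʳ G _ ⟨
      eval ρ e · 𝟙                       ≈⟨ normalise-sound true e [] ⟨
      evalWord ρ (normalise true e [])   ≡⟨ cong (evalWord ρ) eq ⟩
      evalWord ρ (normalise true f [])   ≈⟨ normalise-sound true f [] ⟩
      eval ρ f · 𝟙                       ≈⟨ Group.identityʳ G _ ⟩
      eval ρ f                           ∎

x₀ : ∀ {k} → Expr (suc k)
x₁ : ∀ {k} → Expr (2 + k)
x₂ : ∀ {k} → Expr (3 + k)
x₃ : ∀ {k} → Expr (4 + k)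
x₄ : ∀ {k} → Expr (5 + k)
x₅ : ∀ {k} → Expr (6 + k)
x₆ : ∀ {k} → Expr (7 + k)
x₀ = gen zero
x₁ = gen (suc zero)
x₂ = gen (suc (suc zero))
x₃ = gen (suc (suc (suc zero)))
x₄ = gen (suc (suc (suc (suc zero))))
x₅ = gen (suc (suc (suc (suc (suc zero)))))
x₆ = gen (suc (suc (suc (suc (suc (suc zero))))))

-- Cocycles on words and their extension to homomorphisms

-- Functions Π from words to a group F that multiply along overlaps in a set P
-- of words.  On a tree set each of them is the restriction of a homomorphism
-- from Gθ to F, up to a change β of base points: descending in the length of
-- the overlaps, Π extends to a word q outside P along the tree E(q).

module Cocycles {n : ℕ} (θ : Fin n → Fin n) (θ-inv : Involutive _≡_ θ) {S : Language n}
    (specular : IsSpecular θ S) ([]∈S : S []) (a₀ : Fin n) (F : Group 0ℓ 0ℓ) where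
  open Laminary θ θ-inv specular []∈S
  open Group F using (Carrier; setoid; ∙-congˡ; ∙-congʳ)
    renaming (_∙_ to _·_; _≈_ to _≋_; ε to 𝟙; _⁻¹ to _⁻; ∙-cong to ·-cong; ⁻¹-cong to ⁻-cong;
              refl to ≋-refl; sym to ≋-sym; trans to ≋-trans; reflexive to ≋-reflexive)
  open SetoidReasoning setoid
  open GroupSolver F using (solve)

  record Region (P : Word n → Set) : Set where
    field
      region?    : ∀ p → Dec (P p)
      region-∷   : ∀ {a p} → P p → P (a ∷ p)
      region-∷ʳ  : ∀ {c p} → P p → P (p ++ [ c ])
      region-inv : ∀ {p} → P p → P (inv θ p)

    region-inv⁻ : ∀ {p} → P (inv θ p) → P p
    region-inv⁻ {p} r = subst P (inv-involutive p) (region-inv r)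

  record Cocycle (P : Word n → Set) (Π : Word n → Carrier) : Set where
    field
      overlapping : ∀ {a p c} → P p → S (a ∷ p ++ [ c ]) →
                Π (a ∷ p ++ [ c ]) ≋ Π (a ∷ p) · Π p ⁻ · Π (p ++ [ c ])
      inverts : ∀ {p} → P p → S p → Π (inv θ p) ≋ Π p ⁻

  -- By `β-∷`, `β p` belongs to the right end of `p`; the left end of `p` is the right end of its
  -- inverse.
  record Extends (P : Word n → Set) (Π : Word n → Carrier) : Set where
    field
      φ         : Fin n → Carrier
      relation  : ∀ a → φ a · φ (θ a) ≋ 𝟙
      β         : Word n → Carrier
      β-∷       : ∀ {a p} → P p → β (a ∷ p) ≋ β p
      extension : ∀ {p} → P p → S p → Π p ≋ β (inv θ p) ⁻ · product F (map φ p) · β p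

  module Defect (Π : Word n → Carrier) where

    -- If the cocycle identity held at `q`, this would be `Π q ⁻` on every edge of `E q`.
    defect : Word n → Fin n → Fin n → Carrier
    defect q a c = Π (a ∷ q) ⁻ · Π (a ∷ q ++ [ c ]) · Π (q ++ [ c ]) ⁻

  -- One extension from `P` to `P′`. Outside `P` the new value at `q` is `κ q`, and `B q a` changes
  -- the base point at the right end of `a q`. By `B-edge`, every edge of `E q` has defect `κ q ⁻`
  -- after the change.
  module Step {P P′ : Word n → Set} {Π : Word n → Carrier} (region : Region P) (cocycle : Cocycle P Π)
      (frontierˡ : ∀ {a q} → P′ q → S (a ∷ q) → P (a ∷ q))
      (frontierʳ : ∀ {c q} → P′ q → S (q ++ [ c ]) → P (q ++ [ c ]))
      (B : Word n → Fin n → Carrier) (κ : Word n → Carrier)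
      (κ-inv : ∀ {q} → S q → ¬ P q → P′ q → κ (inv θ q) ≋ κ q ⁻)
      (B-edge : ∀ {q a c} → ¬ P q → P′ q → S (a ∷ q ++ [ c ]) →
                B q a ⁻ · κ q ⁻ · B (inv θ q) (θ c) ≋ Defect.defect Π q a c) where
    open Region region
    open Cocycle cocycle
    open Defect Π

    -- Letters are removed on the left as long as the rest is in `P`; then `B` is applied. On `P`
    -- the result thus depends only on the right end of the word.
    b : Word n → Carrier
    b-step : ∀ a p → Dec (P p) → Carrier
    b []      = 𝟙
    b (a ∷ p) = b-step a p (region? p)
    b-step a p (yes _) = b p
    b-step a p (no _)  = B p a

    b-∷ : ∀ {a p} → P p → b (a ∷ p) ≡ b p
    b-∷ {a} {p} Pp with region? p
    ... | yes _  = ≡-refl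
    ... | no ¬Pp = ⊥-elim (¬Pp Pp)

    b-frontier : ∀ {a p} → ¬ P p → b (a ∷ p) ≡ B p a
    b-frontier {a} {p} ¬Pp with region? p
    ... | yes Pp = ⊥-elim (¬Pp Pp)
    ... | no _   = ≡-refl

    Π′-step : ∀ p → Dec (P p) → Carrier
    Π′-step p (yes _) = b (inv θ p) · Π p · b p ⁻
    Π′-step p (no _)  = κ p

    Π′ : Word n → Carrier
    Π′ p = Π′-step p (region? p)

    Π′-region : ∀ {p} → P p → Π′ p ≡ b (inv θ p) · Π p · b p ⁻
    Π′-region {p} Pp with region? p
    ... | yes _  = ≡-refl
    ... | no ¬Pp = ⊥-elim (¬Pp Pp)

    Π′-frontier : ∀ {p} → ¬ P p → Π′ p ≡ κ p
    Π′-frontier {p} ¬Pp with region? p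
    ... | yes Pp = ⊥-elim (¬Pp Pp)
    ... | no _   = ≡-refl

    private
      Π′-long : ∀ {a p c} → P (a ∷ p) → P (p ++ [ c ]) →
                Π′ (a ∷ p ++ [ c ]) ≡ b (inv θ (a ∷ p)) · Π (a ∷ p ++ [ c ]) · b (p ++ [ c ]) ⁻
      Π′-long {a} {p} {c} Pap Ppc = ≡-trans (Π′-region (region-∷ Ppc))
        (cong₂ (λ g h → g · Π (a ∷ p ++ [ c ]) · h ⁻)
          (≡-trans (cong b (inv-∷ʳ (a ∷ p) c)) (b-∷ (region-inv Pap))) (b-∷ Ppc))

      Π′-right : ∀ {p c} → P (p ++ [ c ]) →
                 Π′ (p ++ [ c ]) ≡ b (θ c ∷ inv θ p) · Π (p ++ [ c ]) · b (p ++ [ c ]) ⁻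
      Π′-right {p} {c} Ppc = ≡-trans (Π′-region Ppc)
        (cong (λ u → b u · Π (p ++ [ c ]) · b (p ++ [ c ]) ⁻) (inv-∷ʳ p c))

    cocycle′ : Cocycle P′ Π′
    cocycle′ = record { overlapping = overlapping′ ; inverts = inverts′ }
      where
      overlapping′ : ∀ {a p c} → P′ p → S (a ∷ p ++ [ c ]) →
                 Π′ (a ∷ p ++ [ c ]) ≋ Π′ (a ∷ p) · Π′ p ⁻ · Π′ (p ++ [ c ])
      overlapping′ {a} {p} {c} P′p s with region? p
      ... | yes Pp = begin
        Π′ (a ∷ p ++ [ c ])
          ≡⟨ Π′-long (region-∷ Pp) (region-∷ʳ Pp) ⟩
        b₁ · Π (a ∷ p ++ [ c ]) · b₂ ⁻
          ≈⟨ ∙-congʳ (∙-congˡ (overlapping Pp s)) ⟩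
        b₁ · (Π (a ∷ p) · Π p ⁻ · Π (p ++ [ c ])) · b₂ ⁻
          ≈⟨ solve (b₁ ∷ b₂ ∷ b₃ ∷ b₄ ∷ Π (a ∷ p) ∷ Π p ∷ Π (p ++ [ c ]) ∷ [])
               (x₀ ∙ (x₄ ∙ x₅ ⁻¹ ∙ x₆) ∙ x₁ ⁻¹)
               ((x₀ ∙ x₄ ∙ x₂ ⁻¹) ∙ (x₃ ∙ x₅ ∙ x₂ ⁻¹) ⁻¹ ∙ (x₃ ∙ x₆ ∙ x₁ ⁻¹)) ≡-refl ⟩
        (b₁ · Π (a ∷ p) · b₃ ⁻) · (b₄ · Π p · b₃ ⁻) ⁻ · (b₄ · Π (p ++ [ c ]) · b₂ ⁻)
          ≡⟨ cong₂ (λ g h → g · (b₄ · Π p · b₃ ⁻) ⁻ · h)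
               (≡-trans (Π′-region (region-∷ Pp)) (cong (λ g → b₁ · Π (a ∷ p) · g ⁻) (b-∷ Pp)))
               (≡-trans (Π′-right (region-∷ʳ Pp))
                 (cong (λ g → g · Π (p ++ [ c ]) · b₂ ⁻) (b-∷ (region-inv Pp)))) ⟨
        Π′ (a ∷ p) · (b₄ · Π p · b₃ ⁻) ⁻ · Π′ (p ++ [ c ]) ∎
        where
        b₁ = b (inv θ (a ∷ p))
        b₂ = b (p ++ [ c ])
        b₃ = b p
        b₄ = b (inv θ p)
      ... | no ¬Pp = begin
        Π′ (a ∷ p ++ [ c ])
          ≡⟨ Π′-long Pap Ppc ⟩
        b₁ · Π (a ∷ p ++ [ c ]) · b₂ ⁻
          ≈⟨ solve (b₁ ∷ b₂ ∷ Π (a ∷ p) ∷ Π (a ∷ p ++ [ c ]) ∷ Π (p ++ [ c ]) ∷ [])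
               (x₀ ∙ x₃ ∙ x₁ ⁻¹) (x₀ ∙ x₂ ∙ (x₂ ⁻¹ ∙ x₃ ∙ x₄ ⁻¹) ∙ (x₄ ∙ x₁ ⁻¹)) ≡-refl ⟩
        b₁ · Π (a ∷ p) · defect p a c · (Π (p ++ [ c ]) · b₂ ⁻)
          ≈⟨ ∙-congʳ (∙-congˡ (B-edge ¬Pp P′p s)) ⟨
        b₁ · Π (a ∷ p) · (B p a ⁻ · κ p ⁻ · B (inv θ p) (θ c)) · (Π (p ++ [ c ]) · b₂ ⁻)
          ≈⟨ solve (b₁ ∷ b₂ ∷ B p a ∷ B (inv θ p) (θ c) ∷ Π (a ∷ p) ∷ κ p ∷ Π (p ++ [ c ]) ∷ [])
               (x₀ ∙ x₄ ∙ (x₂ ⁻¹ ∙ x₅ ⁻¹ ∙ x₃) ∙ (x₆ ∙ x₁ ⁻¹))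
               ((x₀ ∙ x₄ ∙ x₂ ⁻¹) ∙ x₅ ⁻¹ ∙ (x₃ ∙ x₆ ∙ x₁ ⁻¹)) ≡-refl ⟩
        (b₁ · Π (a ∷ p) · B p a ⁻) · κ p ⁻ · (B (inv θ p) (θ c) · Π (p ++ [ c ]) · b₂ ⁻)
          ≡⟨ cong₂ (λ g h → g · κ p ⁻ · h)
               (≡-trans (Π′-region Pap) (cong (λ g → b₁ · Π (a ∷ p) · g ⁻) (b-frontier ¬Pp)))
               (≡-trans (Π′-right Ppc)
                 (cong (λ g → g · Π (p ++ [ c ]) · b₂ ⁻) (b-frontier (¬Pp ∘ region-inv⁻)))) ⟨
        Π′ (a ∷ p) · κ p ⁻ · Π′ (p ++ [ c ]) ∎
        where
        Pap = frontierˡ P′p (left-part p s)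
        Ppc = frontierʳ P′p (right-part p s)
        b₁ = b (inv θ (a ∷ p))
        b₂ = b (p ++ [ c ])

      inverts′ : ∀ {p} → P′ p → S p → Π′ (inv θ p) ≋ Π′ p ⁻
      inverts′ {p} P′p s with region? p
      ... | no ¬Pp = ≋-trans (≋-reflexive (Π′-frontier (¬Pp ∘ region-inv⁻))) (κ-inv s ¬Pp P′p)
      ... | yes Pp = begin
        Π′ (inv θ p)                                    ≡⟨ Π′-region (region-inv Pp) ⟩
        b (inv θ (inv θ p)) · Π (inv θ p) · b (inv θ p) ⁻ ≡⟨ cong (λ u → b u · Π (inv θ p) · b (inv θ p) ⁻) (inv-involutive p) ⟩
        b p · Π (inv θ p) · b (inv θ p) ⁻               ≈⟨ ∙-congʳ (∙-congˡ (inverts Pp s)) ⟩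
        b p · Π p ⁻ · b (inv θ p) ⁻                     ≈⟨ solve (b p ∷ Π p ∷ b (inv θ p) ∷ []) (x₀ ∙ x₁ ⁻¹ ∙ x₂ ⁻¹) ((x₂ ∙ x₁ ∙ x₀ ⁻¹) ⁻¹) ≡-refl ⟩
        (b (inv θ p) · Π p · b p ⁻) ⁻                   ∎

    extends-step : (∀ {p} → P p → P′ p) → Extends P′ Π′ → Extends P Π
    extends-step P⊆P′ ext = record
      { φ = φ ; relation = relation
      ; β = λ p → β p · b p
      ; β-∷ = λ Pp → ·-cong (β-∷ (P⊆P′ Pp)) (≋-reflexive (b-∷ Pp))
      ; extension = λ {p} Pp s → begin
          Π p
            ≈⟨ solve (Π p ∷ b (inv θ p) ∷ b p ∷ []) x₀ (x₁ ⁻¹ ∙ (x₁ ∙ x₀ ∙ x₂ ⁻¹) ∙ x₂) ≡-refl ⟩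
          b (inv θ p) ⁻ · (b (inv θ p) · Π p · b p ⁻) · b p
            ≡⟨ cong (λ g → b (inv θ p) ⁻ · g · b p) (Π′-region Pp) ⟨
          b (inv θ p) ⁻ · Π′ p · b p
            ≈⟨ ∙-congʳ (∙-congˡ (extension (P⊆P′ Pp) s)) ⟩
          b (inv θ p) ⁻ · (β (inv θ p) ⁻ · product F (map φ p) · β p) · b p
            ≈⟨ solve (b (inv θ p) ∷ β (inv θ p) ∷ product F (map φ p) ∷ β p ∷ b p ∷ [])
                 (x₀ ⁻¹ ∙ (x₁ ⁻¹ ∙ x₂ ∙ x₃) ∙ x₄) ((x₁ ∙ x₀) ⁻¹ ∙ x₂ ∙ (x₃ ∙ x₄)) ≡-refl ⟩
          (β (inv θ p) · b (inv θ p)) ⁻ · product F (map φ p) · (β p · b p) ∎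
      }
      where open Extends ext

  -- With all overlaps available and `Π []` trivial, induction from the right end makes `Π`
  -- multiplicative, so its values on letters define the homomorphism.
  everything : ∀ {Π} → Cocycle (λ _ → ⊤) Π → Π [] ≋ 𝟙 → Extends (λ _ → ⊤) Π
  everything {Π} cocycle Π[] = record
    { φ = λ a → Π [ a ]
    ; relation = λ a → ≋-trans (∙-congˡ (inverts tt (letters a))) (Group.inverseʳ F _)
    ; β = λ _ → 𝟙
    ; β-∷ = λ _ → ≋-refl
    ; extension = λ {p} _ s → ≋-trans (multiplicative p s)
        (solve (product F (map (λ a → Π [ a ]) p) ∷ []) x₀ (ε ⁻¹ ∙ x₀ ∙ ε) ≡-refl)
    }
    where
    open Cocycle cocycle
    cons : ∀ a {p} → Reverse p → S (a ∷ p) → Π (a ∷ p) ≋ Π [ a ] · Π p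
    cons a [] s = ≋-sym (≋-trans (∙-congˡ Π[]) (Group.identityʳ F _))
    cons a (p ∶ r ∶ʳ c) s = begin
      Π (a ∷ p ++ [ c ])                       ≈⟨ overlapping tt s ⟩
      Π (a ∷ p) · Π p ⁻ · Π (p ++ [ c ])       ≈⟨ ∙-congʳ (∙-congʳ (cons a r (left-part p s))) ⟩
      Π [ a ] · Π p · Π p ⁻ · Π (p ++ [ c ])   ≈⟨ solve (Π [ a ] ∷ Π p ∷ Π (p ++ [ c ]) ∷ []) (x₀ ∙ x₁ ∙ x₁ ⁻¹ ∙ x₂) (x₀ ∙ x₂) ≡-refl ⟩
      Π [ a ] · Π (p ++ [ c ])                 ∎
    multiplicative : ∀ p → S p → Π p ≋ product F (map (λ a → Π [ a ]) p)
    multiplicative []      s = Π[]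
    multiplicative (a ∷ p) s =
      ≋-trans (cons a (reverseView p) s) (∙-congˡ (multiplicative p (suffix-S [ a ] s)))
  private
    vertex? : ∀ q x → Dec (ExtVertex S q x)
    vertex? q (inj₁ a) = map′ left (λ { (left s) → s }) (S? (a ∷ q))
    vertex? q (inj₂ c) = map′ right (λ { (right s) → s }) (S? (q ++ [ c ]))

    rootLetter : ∀ q → Dec (S q) → Fin n
    rootLetter q (yes s) = proj₁ (extendable s)
    rootLetter q (no _)  = a₀

    -- Potentials on `E q` are measured from this left vertex. Outside `S` the letter `a₀` is junk;
    -- for the empty word it selects one of the two trees.
    root : Word n → Fin n
    root []        = a₀
    root q@(_ ∷ _) = rootLetter q (S? q)

    root-S : ∀ q → S q → S (root q ∷ q)
    root-S []        s = letters a₀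
    root-S q@(_ ∷ _) s with S? q
    ... | yes s′ = left-part q (proj₂ (proj₂ (extendable s′)))
    ... | no ¬s  = ⊥-elim (¬s s)

    pathInTree : ∀ b q x → Dec (S (b ∷ q)) → Dec (ExtVertex S (b ∷ q) (inj₁ (root (b ∷ q)))) →
                 Dec (ExtVertex S (b ∷ q) x) → Maybe (Path (b ∷ q) (inj₁ (root (b ∷ q))) x)
    pathInTree b q x (yes s) (yes v) (yes v′) = just (connected-E (λ ()) s v v′)
    pathInTree b q x _       _       _        = nothing

    pathInComponent : ∀ x → Dec (component (inj₁ a₀) ≡ component x) → Maybe (Path [] (inj₁ a₀) x)
    pathInComponent x (yes eq) = just (component-connected eq)
    pathInComponent x (no _)   = nothing

    -- `nothing` stands for words outside `S`, for non-vertices and, in `E []`, for the tree without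
    -- `inj₁ a₀`. The path comes from decisions, hence does not depend on membership proofs.
    findPath : ∀ q x → Maybe (Path q (inj₁ (root q)) x)
    findPath []      x = pathInComponent x (component (inj₁ a₀) ≟ component x)
    findPath (b ∷ q) x = pathInTree b q x (S? (b ∷ q)) (vertex? (b ∷ q) (inj₁ (root (b ∷ q)))) (vertex? (b ∷ q) x)

    Reached : Word n → Fin n ⊎ Fin n → Set
    Reached q x = ∃ λ p → findPath q x ≡ just p

    reached : ∀ {q x} → q ≢ [] → S q → ExtVertex S q x → Reached q x
    reached {[]}    q≢[] _ _ = ⊥-elim (q≢[] ≡-refl)
    reached {b ∷ q} {x} _ s v = go (S? (b ∷ q)) (vertex? (b ∷ q) (inj₁ (root (b ∷ q)))) (vertex? (b ∷ q) x)
      where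
      go : ∀ d d₀ d′ → ∃ λ p → pathInTree b q x d d₀ d′ ≡ just p
      go (yes _) (yes _)  (yes _) = _ , ≡-refl
      go (no ¬s) _        _       = ⊥-elim (¬s s)
      go (yes _) (no ¬v₀) _       = ⊥-elim (¬v₀ (left (root-S (b ∷ q) s)))
      go (yes _) (yes _)  (no ¬v) = ⊥-elim (¬v v)

    reached-[] : ∀ {x} → component (inj₁ a₀) ≡ component x → Reached [] x
    reached-[] {x} eq with component (inj₁ a₀) ≟ component x
    ... | yes _  = _ , ≡-refl
    ... | no neq = ⊥-elim (neq eq)

  module Gauge {P : Word n → Set} {Π : Word n → Carrier} (region : Region P) (cocycle : Cocycle P Π) where
    open Region region
    open Cocycle cocycle
    open Defect Π

    δ : Word n → Fin n ⊎ Fin n → Fin n ⊎ Fin n → Carrier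
    δ q (inj₁ a) (inj₂ c) = defect q a c
    δ q (inj₂ c) (inj₁ a) = defect q a c ⁻
    δ q _        _        = 𝟙

    δ-anti : ∀ q {x y} → ExtEdge S q x y → δ q x y · δ q y x ≋ 𝟙
    δ-anti q (left-right e) = Group.inverseʳ F _
    δ-anti q (right-left e) = Group.inverseˡ F _

    f : Word n → Fin n ⊎ Fin n → Carrier
    f q x = maybe′ (Walks.Labelled.potential _≟ᵛ_ (ExtEdge S q) (Graph.~-sym (E q)) F (δ q)) 𝟙 (findPath q x)

    f-edge : ∀ {q x y} → S q → Reached q x → Reached q y → ExtEdge S q x y → f q x · δ q x y ≋ f q y
    f-edge {q} {x} {y} s (p , eq) (p′ , eq′) e rewrite eq | eq′ =
      EWalks.Potential.potential-edge s F (δ q) (δ-anti q) p p′ e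

    f-root : ∀ {q} → S q → Reached q (inj₁ (root q)) → f q (inj₁ (root q)) ≋ 𝟙
    f-root {q} s (p , eq) rewrite eq = EWalks.Potential.potential-root s F (δ q) (δ-anti q) p

    Frontier : Word n → Set
    Frontier q = (∀ {a} → S (a ∷ q) → P (a ∷ q)) × (∀ {c} → S (q ++ [ c ]) → P (q ++ [ c ]))

    defect-inv : ∀ {q a c} → Frontier q → S (a ∷ q ++ [ c ]) →
                 defect (inv θ q) (θ c) (θ a) ≋ defect q a c ⁻
    defect-inv {q} {a} {c} (frontierˡ , frontierʳ) s = begin
      Π (θ c ∷ inv θ q) ⁻ · Π (θ c ∷ inv θ q ++ [ θ a ]) · Π (inv θ q ++ [ θ a ]) ⁻
        ≡⟨ cong₂ _·_ (cong₂ (λ u v → Π u ⁻ · Π v) (inv-∷ʳ q c) (inv-∷-∷ʳ a q c)) (cong (λ u → Π u ⁻) (inv-∷ a q)) ⟨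
      Π (inv θ (q ++ [ c ])) ⁻ · Π (inv θ (a ∷ q ++ [ c ])) · Π (inv θ (a ∷ q)) ⁻
        ≈⟨ ·-cong (·-cong (⁻-cong (inverts Pqc (right-part q s))) (inverts (region-∷ Pqc) s))
                  (⁻-cong (inverts (frontierˡ (left-part q s)) (left-part q s))) ⟩
      Π (q ++ [ c ]) ⁻ ⁻ · Π (a ∷ q ++ [ c ]) ⁻ · Π (a ∷ q) ⁻ ⁻
        ≈⟨ solve (Π (q ++ [ c ]) ∷ Π (a ∷ q ++ [ c ]) ∷ Π (a ∷ q) ∷ [])
             (x₀ ⁻¹ ⁻¹ ∙ x₁ ⁻¹ ∙ x₂ ⁻¹ ⁻¹) ((x₂ ⁻¹ ∙ x₁ ∙ x₀ ⁻¹) ⁻¹) ≡-refl ⟩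
      defect q a c ⁻ ∎
      where Pqc = frontierʳ (right-part q s)

    -- The flip exchanges sides, which inverts the label, and `defect-inv` inverts it once more.
    δ-flip : ∀ {q x y} → Frontier q → ExtEdge S q x y → δ (inv θ q) (flip x) (flip y) ≋ δ q x y
    δ-flip fr (left-right e) = ≋-trans (⁻-cong (defect-inv fr e)) (GroupProperties.⁻¹-involutive F _)
    δ-flip fr (right-left e) = defect-inv fr e

    -- The potential at left vertices. In `E []`, a vertex outside the tree of `a₀` takes the
    -- potential of its flip, which lies in that tree.
    gauge : Word n → Fin n → Carrier
    gauge-[] : ∀ a → Dec (component (inj₁ a₀) ≡ component (inj₁ a)) → Carrier
    gauge []        a = gauge-[] a (component (inj₁ a₀) ≟ component (inj₁ a))
    gauge q@(_ ∷ _) a = f q (inj₁ a)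
    gauge-[] a (yes _) = f [] (inj₁ a)
    gauge-[] a (no _)  = f [] (inj₂ (θ a))

    flipRoot : Word n → Fin n ⊎ Fin n
    flipRoot q = inj₂ (θ (root (inv θ q)))

    -- The constant left factor between two potentials on `E q`: its own, and that of `E (inv θ q)`
    -- transported by the flip. The latter is trivial at `flipRoot q`.
    κ : Word n → Carrier
    κ []        = 𝟙
    κ q@(_ ∷ _) = f q (flipRoot q) ⁻

    module Nonempty {q} (q≢[] : q ≢ []) (s : S q) (frontier : Frontier q) where

      q⁻ : Word n
      q⁻ = inv θ q

      flip-vertex : ∀ {x} → ExtVertex S q x → ExtVertex S q⁻ (flip x)
      flip-vertex (left {a} t)  = right (subst S (inv-∷ a q) (inverse t))
      flip-vertex (right {c} t) = left (subst S (inv-∷ʳ q c) (inverse t))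

      reach : ∀ {x} → ExtVertex S q x → Reached q x
      reach = reached q≢[] s

      reach⁻ : ∀ {x} → ExtVertex S q⁻ x → Reached q⁻ x
      reach⁻ = reached (inv-≢[] q≢[]) (inverse s)

      g : Fin n ⊎ Fin n → Carrier
      g x = f q⁻ (flip x)

      g-edge : ∀ {x y} → ExtEdge S q x y → g x · δ q x y ≋ g y
      g-edge e = ≋-trans (∙-congˡ (≋-sym (δ-flip frontier e)))
        (f-edge (inverse s) (reach⁻ (flip-vertex (Graph.~-vertex (E q) e)))
          (reach⁻ (flip-vertex (Graph.~-vertex (E q) (Graph.~-sym (E q) e)))) (flip-edge e))

      -- Along an edge both potentials are multiplied on the right by the same label, which cancels
      -- in the quotient.
      ratio-edge : ∀ {x y} → ExtEdge S q x y → f q x · g x ⁻ ≋ f q y · g y ⁻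
      ratio-edge {x} {y} e = begin
        f q x · g x ⁻
          ≈⟨ solve (f q x ∷ δ q x y ∷ g x ∷ []) (x₀ ∙ x₂ ⁻¹) ((x₀ ∙ x₁) ∙ (x₂ ∙ x₁) ⁻¹) ≡-refl ⟩
        (f q x · δ q x y) · (g x · δ q x y) ⁻
          ≈⟨ ·-cong (f-edge s (reach (Graph.~-vertex (E q) e)) (reach (Graph.~-vertex (E q) (Graph.~-sym (E q) e))) e)
                    (⁻-cong (g-edge e)) ⟩
        f q y · g y ⁻ ∎

      ratio-constant : ∀ {x y} → Path q x y → f q x · g x ⁻ ≋ f q y · g y ⁻
      ratio-constant Star.ε  = ≋-refl
      ratio-constant (e ◅ p) = ≋-trans (ratio-edge e) (ratio-constant p)

      flipRoot-vertex : ExtVertex S q (flipRoot q)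
      flipRoot-vertex = right (subst S (≡-trans (inv-∷ (root q⁻) q⁻) (cong (_++ [ θ (root q⁻) ]) (inv-involutive q)))
        (inverse (root-S q⁻ (inverse s))))

      g-flipRoot : g (flipRoot q) ≋ 𝟙
      g-flipRoot = ≋-trans (≋-reflexive (cong (λ a → f q⁻ (inj₁ a)) (θ-inv (root q⁻))))
        (f-root (inverse s) (reach⁻ (left (root-S q⁻ (inverse s)))))

      g-potential : ∀ {x} → ExtVertex S q x → g x ≋ f q (flipRoot q) ⁻ · f q x
      g-potential {x} v = begin
        g x
          ≈⟨ solve (g x ∷ f q x ∷ []) x₀ ((x₁ ∙ x₀ ⁻¹) ⁻¹ ∙ x₁) ≡-refl ⟩
        (f q x · g x ⁻) ⁻ · f q x
          ≈⟨ ∙-congʳ (⁻-cong (ratio-constant (connected-E q≢[] s v flipRoot-vertex))) ⟩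
        (f q (flipRoot q) · g (flipRoot q) ⁻) ⁻ · f q x
          ≈⟨ ∙-congʳ (⁻-cong (∙-congˡ (⁻-cong g-flipRoot))) ⟩
        (f q (flipRoot q) · 𝟙 ⁻) ⁻ · f q x
          ≈⟨ solve (f q (flipRoot q) ∷ f q x ∷ []) ((x₀ ∙ ε ⁻¹) ⁻¹ ∙ x₁) (x₀ ⁻¹ ∙ x₁) ≡-refl ⟩
        f q (flipRoot q) ⁻ · f q x ∎

      κ-nonempty : ∀ {p} → p ≢ [] → κ p ≡ f p (flipRoot p) ⁻
      κ-nonempty {[]}    p≢[] = ⊥-elim (p≢[] ≡-refl)
      κ-nonempty {_ ∷ _} _    = ≡-refl

      gauge-nonempty : ∀ {p a} → p ≢ [] → gauge p a ≡ f p (inj₁ a)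
      gauge-nonempty {[]}    p≢[] = ⊥-elim (p≢[] ≡-refl)
      gauge-nonempty {_ ∷ _} _    = ≡-refl

      κ-inv : κ q⁻ ≋ κ q ⁻
      κ-inv = begin
        κ q⁻
          ≡⟨ κ-nonempty (inv-≢[] q≢[]) ⟩
        f q⁻ (flipRoot q⁻) ⁻
          ≡⟨ cong (λ u → f q⁻ (inj₂ (θ (root u))) ⁻) (inv-involutive q) ⟩
        g (inj₁ (root q)) ⁻
          ≈⟨ ⁻-cong (g-potential (left (root-S q s))) ⟩
        (f q (flipRoot q) ⁻ · f q (inj₁ (root q))) ⁻
          ≈⟨ ⁻-cong (∙-congˡ (f-root s (reach (left (root-S q s))))) ⟩
        (f q (flipRoot q) ⁻ · 𝟙) ⁻
          ≈⟨ ⁻-cong (Group.identityʳ F _) ⟩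
        f q (flipRoot q) ⁻ ⁻
          ≡⟨ cong _⁻ (κ-nonempty q≢[]) ⟨
        κ q ⁻ ∎

      gauge-edge : ∀ {a c} → S (a ∷ q ++ [ c ]) → gauge q a ⁻ · κ q ⁻ · gauge q⁻ (θ c) ≋ defect q a c
      gauge-edge {a} {c} e = begin
        gauge q a ⁻ · κ q ⁻ · gauge q⁻ (θ c)
          ≡⟨ cong₂ (λ u v → u · v ⁻ · gauge q⁻ (θ c)) (cong _⁻ (gauge-nonempty q≢[])) (κ-nonempty q≢[]) ⟩
        f q (inj₁ a) ⁻ · f q (flipRoot q) ⁻ ⁻ · gauge q⁻ (θ c)
          ≡⟨ cong (f q (inj₁ a) ⁻ · f q (flipRoot q) ⁻ ⁻ ·_) (gauge-nonempty (inv-≢[] q≢[])) ⟩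
        f q (inj₁ a) ⁻ · f q (flipRoot q) ⁻ ⁻ · g (inj₂ c)
          ≈⟨ ∙-congˡ (≋-trans (g-potential vc) (∙-congˡ (≋-sym (f-edge s (reach va) (reach vc) (left-right e))))) ⟩
        f q (inj₁ a) ⁻ · f q (flipRoot q) ⁻ ⁻ · (f q (flipRoot q) ⁻ · (f q (inj₁ a) · defect q a c))
          ≈⟨ solve (f q (inj₁ a) ∷ f q (flipRoot q) ∷ defect q a c ∷ [])
               (x₀ ⁻¹ ∙ x₁ ⁻¹ ⁻¹ ∙ (x₁ ⁻¹ ∙ (x₀ ∙ x₂))) x₂ ≡-refl ⟩
        defect q a c ∎
        where
        va = left (left-part q e)
        vc = right (right-part q e)

    -- The letter `c` lies in the tree of `a`, and its flip `θ c` in the other one. So exactly one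
    -- of the left vertices `a` and `θ c` is in the tree of `a₀`.
    gauge-edge-[] : ∀ {a c} → Frontier [] → S (a ∷ [] ++ [ c ]) → gauge [] a ⁻ · κ [] ⁻ · gauge [] (θ c) ≋ defect [] a c
    gauge-edge-[] {a} {c} frontier e with component (inj₁ a₀) ≟ component (inj₁ a) | component (inj₁ a₀) ≟ component (inj₁ (θ c))
    ... | yes eq | yes eq′ = ⊥-elim (component-flip (inj₂ c)
            (≡-trans (≡-sym (component-edge (left-right e))) (≡-trans (≡-sym eq) eq′)))
    ... | no neq | no neq′ = ⊥-elim (component-flip (inj₂ c)
            (≡-trans (≡-sym (component-edge (left-right e))) (two-values (neq ∘ ≡-sym) (neq′ ∘ ≡-sym))))
    ... | yes eq | no neq′ = begin
      f [] (inj₁ a) ⁻ · 𝟙 ⁻ · f [] (inj₂ (θ (θ c)))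
        ≡⟨ cong (λ d → f [] (inj₁ a) ⁻ · 𝟙 ⁻ · f [] (inj₂ d)) (θ-inv c) ⟩
      f [] (inj₁ a) ⁻ · 𝟙 ⁻ · f [] (inj₂ c)
        ≈⟨ ∙-congˡ (f-edge []∈S (reached-[] eq) (reached-[] (≡-trans eq (component-edge (left-right e)))) (left-right e)) ⟨
      f [] (inj₁ a) ⁻ · 𝟙 ⁻ · (f [] (inj₁ a) · defect [] a c)
        ≈⟨ solve (f [] (inj₁ a) ∷ defect [] a c ∷ []) (x₀ ⁻¹ ∙ ε ⁻¹ ∙ (x₀ ∙ x₁)) x₁ ≡-refl ⟩
      defect [] a c ∎
    -- The edge itself is in the other tree; its flip, from `θ c` to `θ a`, is in the tree of `a₀`.
    ... | no neq | yes eq′ = begin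
      f [] (inj₂ (θ a)) ⁻ · 𝟙 ⁻ · f [] (inj₁ (θ c))
        ≈⟨ ∙-congʳ (∙-congʳ (⁻-cong (f-edge []∈S (reached-[] eq′) (reached-[] (≡-trans eq′ (component-edge e⁻))) e⁻))) ⟨
      (f [] (inj₁ (θ c)) · defect [] (θ c) (θ a)) ⁻ · 𝟙 ⁻ · f [] (inj₁ (θ c))
        ≈⟨ solve (f [] (inj₁ (θ c)) ∷ defect [] (θ c) (θ a) ∷ []) ((x₀ ∙ x₁) ⁻¹ ∙ ε ⁻¹ ∙ x₀) (x₁ ⁻¹) ≡-refl ⟩
      defect [] (θ c) (θ a) ⁻
        ≈⟨ δ-flip {[]} frontier (left-right e) ⟩
      defect [] a c ∎
      where
      e⁻ : ExtEdge S [] (inj₁ (θ c)) (inj₂ (θ a))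
      e⁻ = flip-edge {[]} (right-left e)

  -- Induction on a length `k` from which on all words of `S` are in `P`. Each step adjoins the
  -- words of length one less; the last one adjoins the empty word, where the graph has two trees
  -- and the gauge for `[]` is used.
  extends : ∀ k {P Π} → Region P → Cocycle P Π → ¬ P [] →
            (∀ p → S p → k ≤ length p → P p) → Extends P Π
  extends zero region cocycle ¬P[] long = ⊥-elim (¬P[] (long [] []∈S z≤n))
  extends (suc zero) {P} {Π} region cocycle ¬P[] long =
    extends-step (λ _ → tt) (everything cocycle′ (≋-reflexive (Π′-frontier ¬P[])))
    where
    open Gauge region cocycle
    open Defect Π
    only-[] : ∀ {q} → S q → ¬ P q → q ≡ []
    only-[] {[]}    s ¬Pq = ≡-refl
    only-[] {_ ∷ _} s ¬Pq = ⊥-elim (¬Pq (long _ s (s≤s z≤n)))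
    nonempty-∷ʳ : ∀ {c} (q : Word n) → 1 ≤ length (q ++ [ c ])
    nonempty-∷ʳ []      = s≤s z≤n
    nonempty-∷ʳ (_ ∷ q) = s≤s z≤n
    frontier : Frontier []
    frontier = (λ s → long _ s (s≤s z≤n)) , (λ s → long _ s (s≤s z≤n))
    frontierˡ : ∀ {a q} → ⊤ → S (a ∷ q) → P (a ∷ q)
    frontierˡ _ s = long _ s (s≤s z≤n)
    frontierʳ : ∀ {c q} → ⊤ → S (q ++ [ c ]) → P (q ++ [ c ])
    frontierʳ {q = q} _ s = long _ s (nonempty-∷ʳ q)
    κ-inv : ∀ {q} → S q → ¬ P q → ⊤ → κ (inv θ q) ≋ κ q ⁻
    κ-inv s ¬Pq _ = subst (λ q → κ (inv θ q) ≋ κ q ⁻) (≡-sym (only-[] s ¬Pq))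
      (≋-sym (GroupProperties.ε⁻¹≈ε F))
    gauge-edge : ∀ {q a c} → ¬ P q → ⊤ → S (a ∷ q ++ [ c ]) →
                 gauge q a ⁻ · κ q ⁻ · gauge (inv θ q) (θ c) ≋ defect q a c
    gauge-edge {q} {a} {c} ¬Pq _ e =
      subst (λ q → S (a ∷ q ++ [ c ]) → gauge q a ⁻ · κ q ⁻ · gauge (inv θ q) (θ c) ≋ defect q a c)
        (≡-sym (only-[] (prefix-S q (right-part q e)) ¬Pq)) (gauge-edge-[] frontier) e
    open Step {P′ = λ _ → ⊤} region cocycle frontierˡ frontierʳ gauge κ κ-inv gauge-edge
  extends (suc (suc k)) {P} {Π} region cocycle ¬P[] long =
    extends-step inj₁ (extends (suc k) region′ cocycle′ (λ { (inj₁ P[]) → ¬P[] P[] }) (λ _ _ → inj₂))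
    where
    open Region region
    open Gauge region cocycle
    open Defect Π
    P′ : Word n → Set
    P′ q = P q ⊎ suc k ≤ length q
    region′ : Region P′
    region′ = record
      { region?    = λ p → region? p ⊎-dec (suc k ≤? length p)
      ; region-∷   = λ { (inj₁ Pp) → inj₁ (region-∷ Pp) ; (inj₂ le) → inj₂ (≤-trans le (n≤1+n _)) }
      ; region-∷ʳ  = λ { (inj₁ Pp) → inj₁ (region-∷ʳ Pp)
                       ; {p = p} (inj₂ le) → inj₂ (≤-trans le (≤-trans (n≤1+n _) (≤-reflexive (≡-sym (length-∷ʳ p))))) }
      ; region-inv = λ { (inj₁ Pp) → inj₁ (region-inv Pp)
                       ; {p = p} (inj₂ le) → inj₂ (≤-trans le (≤-reflexive (≡-sym (length-inv p)))) }
      }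
    frontierˡ : ∀ {a q} → P′ q → S (a ∷ q) → P (a ∷ q)
    frontierˡ (inj₁ Pq) s = region-∷ Pq
    frontierˡ (inj₂ le) s = long _ s (s≤s le)
    frontierʳ : ∀ {c q} → P′ q → S (q ++ [ c ]) → P (q ++ [ c ])
    frontierʳ         (inj₁ Pq) s = region-∷ʳ Pq
    frontierʳ {q = q} (inj₂ le) s = long _ s (≤-trans (s≤s le) (≤-reflexive (≡-sym (length-∷ʳ q))))
    nonempty : ∀ {q} → P′ q → q ≢ []
    nonempty (inj₁ P[]) ≡-refl = ¬P[] P[]
    nonempty (inj₂ ())  ≡-refl
    κ-inv : ∀ {q} → S q → ¬ P q → P′ q → κ (inv θ q) ≋ κ q ⁻
    κ-inv s _ P′q = Nonempty.κ-inv (nonempty P′q) s (frontierˡ P′q , frontierʳ P′q)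
    gauge-edge : ∀ {q a c} → ¬ P q → P′ q → S (a ∷ q ++ [ c ]) →
                 gauge q a ⁻ · κ q ⁻ · gauge (inv θ q) (θ c) ≋ defect q a c
    gauge-edge {q} _ P′q e = Nonempty.gauge-edge (nonempty P′q)
      (prefix-S q (right-part q e)) (frontierˡ P′q , frontierʳ P′q) e
    open Step {P′ = P′} region cocycle frontierˡ frontierʳ gauge κ κ-inv gauge-edge

-- The free product with paired generators

-- The free product generated by I with relations x (ι x) = 1, realised as a
-- group of permutations of the reduced words.
module InvolutiveFreeGroup {I : Set} (_≟_ : DecidableEquality I) {ι : I → I} (ι-inv : Involutive _≡_ ι) where

  Reduced : List I → Set
  Reduced = Linked (λ x y → y ≢ ι x)

  act-step : ∀ x y (l : List I) → Dec (y ≡ ι x) → List I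
  act-step x y l (yes _) = l
  act-step x y l (no _)  = x ∷ y ∷ l

  act : I → List I → List I
  act x []      = [ x ]
  act x (y ∷ l) = act-step x y l (y ≟ ι x)

  reduced-tail : ∀ {x l} → Reduced (x ∷ l) → Reduced l
  reduced-tail [-]     = []
  reduced-tail (_ ∷ r) = r

  act-reduced : ∀ x {l} → Reduced l → Reduced (act x l)
  act-reduced x {[]}    r = [-]
  act-reduced x {y ∷ l} r with y ≟ ι x
  ... | yes _ = reduced-tail r
  ... | no d  = d ∷ r

  act-cons : ∀ {x l} → Reduced (x ∷ l) → act x l ≡ x ∷ l
  act-cons [-] = ≡-refl
  act-cons {x} (_∷_ {y = y} d r) with y ≟ ι x
  ... | yes eq = ⊥-elim (d eq)
  ... | no _   = ≡-refl

  act-cancel : ∀ {x y} l → y ≡ ι x → act x (y ∷ l) ≡ l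
  act-cancel {x} {y} l eq with y ≟ ι x
  ... | yes _ = ≡-refl
  ... | no d  = ⊥-elim (d eq)

  act-inverse : ∀ x {l} → Reduced l → act (ι x) (act x l) ≡ l
  act-inverse x {[]}    r = act-cancel [] (≡-sym (ι-inv x))
  act-inverse x {y ∷ l} r with y ≟ ι x
  ... | yes ≡-refl = act-cons r
  ... | no _       = act-cancel (y ∷ l) (≡-sym (ι-inv x))

  act-inverse′ : ∀ x {l} → Reduced l → act x (act (ι x) l) ≡ l
  act-inverse′ x {l} r = subst (λ y → act y (act (ι x) l) ≡ l) (ι-inv x) (act-inverse (ι x) r)

  -- The maps act on all lists, while their laws and their equality refer to reduced lists only; so
  -- no list has to carry a proof.
  record Perm : Set where
    field
      to from      : List I → List I
      to-reduced   : ∀ {l} → Reduced l → Reduced (to l)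
      from-reduced : ∀ {l} → Reduced l → Reduced (from l)
      to-from      : ∀ {l} → Reduced l → to (from l) ≡ l
      from-to      : ∀ {l} → Reduced l → from (to l) ≡ l
  open Perm

  _≗ʳ_ : Perm → Perm → Set
  f ≗ʳ g = ∀ {l} → Reduced l → to f l ≡ to g l

  F : Group 0ℓ 0ℓ
  F = record
    { Carrier = Perm
    ; _≈_     = _≗ʳ_
    ; _∙_     = λ f g → record
      { to           = to f ∘ to g
      ; from         = from g ∘ from f
      ; to-reduced   = to-reduced f ∘ to-reduced g
      ; from-reduced = from-reduced g ∘ from-reduced f
      ; to-from      = λ r → ≡-trans (cong (to f) (to-from g (from-reduced f r))) (to-from f r)
      ; from-to      = λ r → ≡-trans (cong (from g) (from-to f (to-reduced g r))) (from-to g r)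
      }
    ; ε       = record
      { to = λ l → l ; from = λ l → l ; to-reduced = λ r → r ; from-reduced = λ r → r
      ; to-from = λ _ → ≡-refl ; from-to = λ _ → ≡-refl }
    ; _⁻¹     = λ f → record
      { to = from f ; from = to f ; to-reduced = from-reduced f ; from-reduced = to-reduced f
      ; to-from = from-to f ; from-to = to-from f }
    ; isGroup = record
      { isMonoid = record
        { isSemigroup = record
          { isMagma = record
            { isEquivalence = record
              { refl  = λ _ → ≡-refl
              ; sym   = λ e r → ≡-sym (e r)
              ; trans = λ e e′ r → ≡-trans (e r) (e′ r)
              }
            ; ∙-cong = λ {f} {f′} {g} {g′} e e′ r →
                ≡-trans (cong (to f) (e′ r)) (e (to-reduced g′ r))
            }
          ; assoc = λ _ _ _ _ → ≡-refl
          }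
        ; identity = (λ _ _ → ≡-refl) , (λ _ _ → ≡-refl)
        }
      ; inverse = (λ f r → from-to f r) , (λ f r → to-from f r)
      ; ⁻¹-cong = λ {f} {g} e {l} r →
          ≡-trans (cong (from f) (≡-trans (≡-sym (to-from g r)) (≡-sym (e (from-reduced g r)))))
                  (from-to f (from-reduced g r))
      }
    }

  generator : I → Perm
  generator x = record
    { to           = act x
    ; from         = act (ι x)
    ; to-reduced   = act-reduced x
    ; from-reduced = act-reduced (ι x)
    ; to-from      = act-inverse′ x
    ; from-to      = act-inverse x
    }

  generator-inv : ∀ x → Group._≈_ F (Group._∙_ F (generator x) (generator (ι x))) (Group.ε F)
  generator-inv x r = act-inverse′ x r

  -- Van der Waerden's argument: acting on the empty list, a reduced product meets no cancellation
  -- and rebuilds its own list of generators.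
  product-reduced : ∀ {xs} → Reduced xs → to (product F (map generator xs)) [] ≡ xs
  product-reduced []          = ≡-refl
  product-reduced [-]         = ≡-refl
  product-reduced {x ∷ _} (d ∷ r) = ≡-trans (cong (act x) (product-reduced r)) (act-cons (d ∷ r))

  reduced-nontrivial : ∀ {xs} → Reduced xs → xs ≢ [] →
                       ¬ (Group._≈_ F (product F (map generator xs)) (Group.ε F))
  reduced-nontrivial r xs≢[] eq = xs≢[] (≡-trans (≡-sym (product-reduced r)) (eq []))

-- Nontrivial products of mixed return words

module Freeness {n : ℕ} (θ : Fin n → Fin n) (θ-inv : Involutive _≡_ θ) {S : Language n}
    (specular : IsSpecular θ S) ([]∈S : S [])
    (w : Word n) (w∈S : S w) (w≢[] : w ≢ []) (¬overlap : ¬ Overlap w (inv θ w)) (a₀ : Fin n)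
    (F : Group 0ℓ 0ℓ) (generator : Word n → Group.Carrier F)
    (generator-inv : ∀ v → Group._≈_ F (Group._∙_ F (generator v) (generator (inv θ v))) (Group.ε F)) where
  open Laminary θ θ-inv specular []∈S
  open Returns θ θ-inv w w≢[] ¬overlap factorial inverse
  open Evaluation θ θ-inv
  open Group F using (setoid; ∙-congˡ; ∙-congʳ)
    renaming (Carrier to FCarrier; _∙_ to _·_; _≈_ to _≋ᶠ_; ε to 𝟙; _⁻¹ to _⁻; ∙-cong to ·-cong; ⁻¹-cong to ⁻-cong;
              refl to ≋-refl; sym to ≋-sym; trans to ≋-trans; reflexive to ≋-reflexive)
  open SetoidReasoning setoid
  open GroupSolver F using (solve)
  open GroupProperties F using (inverseˡ-unique; inverseʳ-unique; ε⁻¹≈ε)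
  open Cocycles θ θ-inv specular []∈S a₀ F

  generator-⁻ : ∀ v → generator (inv θ v) ⁻ ≋ᶠ generator v
  generator-⁻ v = ≋-sym (inverseˡ-unique _ _ (generator-inv v))

  -- For a marked `p` and `a ∷ p` in `S`, `mixed-step` shows that dropping `toMark (a ∷ p)` leaves
  -- the mixed return word. The formula uses no proof of membership in `S`.
  newMark-step : ∀ a p → Dec (Starts (a ∷ p)) → FCarrier
  newMark-step a p (yes _) = generator (drop (length (toMark (a ∷ p))) (a ∷ toMark p))
  newMark-step a p (no _)  = 𝟙

  -- The mixed return word completed by prefixing a to a marked word p.
  newMark : Fin n → Word n → FCarrier
  newMark a p = newMark-step a p (starts? (a ∷ p))

  Π-step : ∀ a p → Dec (Marked p) → FCarrier
  -- The product of the generators attached to the successive mixed return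
  -- words between the first and the last mark of a word.
  Π : Word n → FCarrier
  Π []      = 𝟙
  Π (a ∷ p) = Π-step a p (marked? p)
  Π-step a p (yes _) = newMark a p · Π p
  Π-step a p (no _)  = 𝟙

  Π-marked : ∀ {a p} → Marked p → Π (a ∷ p) ≡ newMark a p · Π p
  Π-marked {a} {p} mk with marked? p
  ... | yes _  = ≡-refl
  ... | no ¬mk = ⊥-elim (¬mk mk)

  Π-unmarked : ∀ {a p} → ¬ Marked p → Π (a ∷ p) ≡ 𝟙
  Π-unmarked {a} {p} ¬mk with marked? p
  ... | yes mk = ⊥-elim (¬mk mk)
  ... | no _   = ≡-refl

  newMark-none : ∀ {a p} → ¬ Starts (a ∷ p) → newMark a p ≡ 𝟙
  newMark-none {a} {p} ¬st with starts? (a ∷ p)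
  ... | yes st = ⊥-elim (¬st st)
  ... | no _   = ≡-refl

  newMark-∷ʳ : ∀ {a p c} → Marked p → newMark a (p ++ [ c ]) ≡ newMark a p
  newMark-∷ʳ {a} {p} {c} mk with starts? (a ∷ p) | starts? (a ∷ p ++ [ c ])
  ... | yes _  | yes _  = cong₂ (λ u v → generator (drop (length u) (a ∷ v)))
                            (toMark-++ʳ {a ∷ p} [ c ] (marked-∷ mk)) (toMark-++ʳ [ c ] mk)
  ... | no _   | no _   = ≡-refl
  ... | yes st | no ¬st = ⊥-elim (¬st (starts-lengthen [ c ] st))
  ... | no ¬st | yes st = ⊥-elim (¬st (starts-shorten (a ∷ p) (≤-trans (marked-length mk) (n≤1+n _)) st))

  newMark-return : ∀ {a p} → Return (a ∷ p) → newMark a p ≡ generator (erase θ w (a ∷ p))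
  newMark-return {a} {p} ret with starts? (a ∷ p)
  ... | no ¬st = ⊥-elim (¬st (return-starts ret))
  ... | yes _  = cong generator
    (≡-trans (cong (drop (length (toMark (a ∷ p)))) (return-step ret)) (drop-length (toMark (a ∷ p))))

  -- Every occurrence ends at the last letter `c`, so there are no two marks to read between.
  Π-unmarked-∷ʳ : ∀ p {c} → ¬ Marked p → Π (p ++ [ c ]) ≋ᶠ 𝟙
  Π-unmarked-∷ʳ []      _ = ≋-reflexive (Π-unmarked ¬marked-[])
  Π-unmarked-∷ʳ (a ∷ p) {c} ¬mk with marked? (p ++ [ c ])
  ... | no _    = ≋-refl
  ... | yes mk′ = ≋-trans (·-cong (≋-reflexive (newMark-none ¬st)) (Π-unmarked-∷ʳ p (¬mk ∘ marked-∷))) (Group.identityˡ F _)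
    where
    ¬st : ¬ Starts (a ∷ p ++ [ c ])
    ¬st st = ¬mk (starts⇒marked (starts-shorten (a ∷ p) (≤-trans (marked-length mk′) (≤-reflexive (length-∷ʳ p))) st))

  -- The mirror image of the recursion defining `Π`: a mixed return word completed by appending `c`
  -- is the inverse of the one completed by prefixing `θ c` to the inverse word.
  Π-∷ʳ : ∀ p {c} → Marked p → S (p ++ [ c ]) → Π (p ++ [ c ]) ≋ᶠ Π p · newMark (θ c) (inv θ p) ⁻
  Π-∷ʳ []      mk = ⊥-elim (¬marked-[] mk)
  Π-∷ʳ (a ∷ p) {c} mk s with marked? p
  ... | yes mk′ = begin
    Π (a ∷ p ++ [ c ])
      ≡⟨ Π-marked (marked-++ʳ [ c ] mk′) ⟩
    newMark a (p ++ [ c ]) · Π (p ++ [ c ])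
      ≈⟨ ·-cong (≋-reflexive (newMark-∷ʳ mk′)) (Π-∷ʳ p mk′ (suffix-S [ a ] s)) ⟩
    newMark a p · (Π p · newMark (θ c) (inv θ p) ⁻)
      ≈⟨ Group.assoc F (newMark a p) (Π p) _ ⟨
    newMark a p · Π p · newMark (θ c) (inv θ p) ⁻
      ≡⟨ cong (λ g → newMark a p · Π p · g ⁻)
           (≡-trans (cong (newMark (θ c)) (inv-∷ a p)) (newMark-∷ʳ (marked-inv mk′))) ⟨
    newMark a p · Π p · newMark (θ c) (inv θ (a ∷ p)) ⁻ ∎
  -- The only occurrence in `a ∷ p` is at its start. Either `c` completes no further occurrence, or
  -- `a p c` is itself a complete return word.
  ... | no ¬mk′ with marked? (p ++ [ c ])
  ... | no ¬mk″ = ≋-sym (≋-trans (Group.identityˡ F _) (≋-trans (⁻-cong (≋-reflexive (newMark-none ¬st))) ε⁻¹≈ε))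
    where
    ¬st : ¬ Starts (θ c ∷ inv θ (a ∷ p))
    ¬st st = ¬mk″ (subst Marked (inv-involutive (p ++ [ c ])) (marked-inv (starts⇒marked
      (starts-shorten (inv θ (p ++ [ c ]))
        (≤-trans (marked-length mk) (≤-reflexive (≡-sym (≡-trans (length-inv (p ++ [ c ])) (length-∷ʳ p)))))
        (subst Starts (≡-trans (≡-sym (inv-∷ʳ (a ∷ p) c)) (inv-∷ a (p ++ [ c ]))) st)))))
  ... | yes mk″ = begin
    newMark a (p ++ [ c ]) · Π (p ++ [ c ])
      ≈⟨ ·-cong (≋-reflexive (newMark-return ret)) (Π-unmarked-∷ʳ p ¬mk′) ⟩
    generator N · 𝟙
      ≈⟨ solve (generator N ∷ []) (x₀ ∙ ε) (ε ∙ x₀) ≡-refl ⟩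
    𝟙 · generator N
      ≈⟨ ∙-congˡ (generator-⁻ N) ⟨
    𝟙 · generator (inv θ N) ⁻
      ≡⟨ cong (λ v → 𝟙 · generator v ⁻)
           (≡-trans (cong (erase θ w) (≡-sym (inv-∷ʳ (a ∷ p) c))) (erase-inv ret)) ⟨
    𝟙 · generator (erase θ w (θ c ∷ inv θ (a ∷ p))) ⁻
      ≡⟨ cong (λ g → 𝟙 · g ⁻) (newMark-return (subst Return (inv-∷ʳ (a ∷ p) c) (return-inv ret))) ⟨
    𝟙 · newMark (θ c) (inv θ (a ∷ p)) ⁻ ∎
    where
    N = erase θ w (a ∷ p ++ [ c ])
    st : Starts (a ∷ p ++ [ c ])
    st = starts-lengthen [ c ] ([ (λ st → st) , (λ mk′ → ⊥-elim (¬mk′ mk′)) ]′ (marked-∷⁻ mk))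
    ret : Return (a ∷ p ++ [ c ])
    ret with first-return s st mk″
    -- A nonempty `r` would put the marked word `u` inside `p`.
    ... | u , r , eq , ret′ with initLast r
    ... | []      = subst (λ v → Return (a ∷ v)) (≡-sym (≡-trans eq (++-identityʳ u))) ret′
    ... | t ∷ʳ′ d = ⊥-elim (¬mk′ (subst Marked
            (≡-sym (∷ʳ-injectiveˡ p (u ++ t) (≡-trans eq (≡-sym (++-assoc u t [ d ])))))
            (marked-++ʳ t (return-marked ret′))))

  Π-inv : ∀ p → Marked p → S p → Π (inv θ p) ≋ᶠ Π p ⁻
  Π-inv []      mk s = ⊥-elim (¬marked-[] mk)
  Π-inv (a ∷ p) mk s with marked? p
  ... | no ¬mk = begin
    Π (inv θ (a ∷ p))       ≡⟨ cong Π (inv-∷ a p) ⟩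
    Π (inv θ p ++ [ θ a ])  ≈⟨ Π-unmarked-∷ʳ (inv θ p) (λ mk′ → ¬mk (subst Marked (inv-involutive p) (marked-inv mk′))) ⟩
    𝟙                       ≈⟨ ε⁻¹≈ε ⟨
    𝟙 ⁻                     ∎
  ... | yes mk′ = begin
    Π (inv θ (a ∷ p))                                       ≡⟨ cong Π (inv-∷ a p) ⟩
    Π (inv θ p ++ [ θ a ])                                  ≈⟨ Π-∷ʳ (inv θ p) (marked-inv mk′) (subst S (inv-∷ a p) (inverse s)) ⟩
    Π (inv θ p) · newMark (θ (θ a)) (inv θ (inv θ p)) ⁻     ≈⟨ ·-cong (Π-inv p mk′ (suffix-S [ a ] s))
                                                                 (≋-reflexive (cong₂ (λ b q → newMark b q ⁻) (θ-inv a) (inv-involutive p))) ⟩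
    Π p ⁻ · newMark a p ⁻                                   ≈⟨ solve (Π p ∷ newMark a p ∷ []) (x₀ ⁻¹ ∙ x₁ ⁻¹) ((x₁ ∙ x₀) ⁻¹) ≡-refl ⟩
    (newMark a p · Π p) ⁻                                   ∎

  region : Region Marked
  region = record
    { region? = marked? ; region-∷ = marked-∷ ; region-∷ʳ = marked-++ʳ _ ; region-inv = marked-inv }

  -- When `p` is marked, appending `c` does not affect which mixed return word prefixing `a`
  -- completes.
  cocycle : Cocycle Marked Π
  cocycle = record { overlapping = overlapping ; inverts = λ {p} → Π-inv p }
    where
    overlapping : ∀ {a p c} → Marked p → S (a ∷ p ++ [ c ]) →
                  Π (a ∷ p ++ [ c ]) ≋ᶠ Π (a ∷ p) · Π p ⁻ · Π (p ++ [ c ])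
    overlapping {a} {p} {c} mk s = begin
      Π (a ∷ p ++ [ c ])                             ≡⟨ Π-marked (marked-++ʳ [ c ] mk) ⟩
      newMark a (p ++ [ c ]) · Π (p ++ [ c ])        ≡⟨ cong (_· Π (p ++ [ c ])) (newMark-∷ʳ mk) ⟩
      newMark a p · Π (p ++ [ c ])                   ≈⟨ solve (newMark a p ∷ Π p ∷ Π (p ++ [ c ]) ∷ []) (x₀ ∙ x₂) (x₀ ∙ x₁ ∙ x₁ ⁻¹ ∙ x₂) ≡-refl ⟩
      newMark a p · Π p · Π p ⁻ · Π (p ++ [ c ])     ≡⟨ cong (λ g → g · Π p ⁻ · Π (p ++ [ c ])) (Π-marked mk) ⟨
      Π (a ∷ p) · Π p ⁻ · Π (p ++ [ c ])             ∎

  Π-X : ∀ {m} → X m → Π m ≋ᶠ 𝟙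
  Π-X {[]}    x = ≋-refl
  Π-X {a ∷ m} x = ≋-reflexive (Π-unmarked λ mk →
    1+n≰n (≤-trans (≤-reflexive (X-length x)) (marked-length mk)))

  -- Removing the first and the last letter leaves no occurrence, so a single generator is met.
  Π-return : ∀ {u} → Return u → Π u ≋ᶠ generator (erase θ w u)
  Π-return {[]}    ret = ⊥-elim (¬marked-[] (starts⇒marked (return-starts ret)))
  Π-return {a ∷ q} ret with initLast q
  ... | []       = ⊥-elim (¬marked-[] (return-marked ret))
  ... | q′ ∷ʳ′ c = begin
    Π (a ∷ q′ ++ [ c ])                        ≡⟨ Π-marked (return-marked ret) ⟩
    newMark a (q′ ++ [ c ]) · Π (q′ ++ [ c ])  ≈⟨ ·-cong (≋-reflexive (newMark-return ret)) (Π-unmarked-∷ʳ q′ ¬mk) ⟩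
    generator N · 𝟙                            ≈⟨ Group.identityʳ F _ ⟩
    generator N                                ∎
    where
    N = erase θ w (a ∷ q′ ++ [ c ])
    ¬mk : ¬ Marked q′
    ¬mk mk with unmark mk
    ... | v , x , (p , s , ≡-refl) = IsCompleteReturn.noInternal ret (a ∷ p) v (s ++ [ c ]) (λ ()) (snoc-≢[] s)
      (cong (a ∷_) (≡-trans (++-assoc p (v ++ s) [ c ]) (cong (p ++_) (++-assoc v s [ c ])))) x

  module _ (N : ℕ) (uniform : ∀ u → S u → N ≤ length u → Marked u) where
    open Extends (extends N region cocycle ¬marked-[] uniform)

    Φ : Word n → FCarrier
    Φ u = product F (map φ u)

    Φ-++ : ∀ u v → Φ (u ++ v) ≋ᶠ Φ u · Φ v
    Φ-++ = WordProduct.product-map-++ F φ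

    evaluate : Expr n → FCarrier
    evaluate (gen a) = φ a
    evaluate ε       = 𝟙
    evaluate (g ∙ h) = evaluate g · evaluate h
    evaluate (g ⁻¹)  = evaluate g ⁻

    evaluate-cong : ∀ {g h} → g ≋ h → evaluate g ≋ᶠ evaluate h
    evaluate-cong (relator a)   = relation a
    evaluate-cong refl          = ≋-refl
    evaluate-cong (sym e)       = ≋-sym (evaluate-cong e)
    evaluate-cong (trans e f)   = ≋-trans (evaluate-cong e) (evaluate-cong f)
    evaluate-cong (∙-cong e f)  = ·-cong (evaluate-cong e) (evaluate-cong f)
    evaluate-cong (⁻¹-cong e)   = ⁻-cong (evaluate-cong e)
    evaluate-cong (assoc x y z) = Group.assoc F (evaluate x) (evaluate y) (evaluate z)
    evaluate-cong (identityˡ x) = Group.identityˡ F (evaluate x)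
    evaluate-cong (identityʳ x) = Group.identityʳ F (evaluate x)
    evaluate-cong (inverseˡ x)  = Group.inverseˡ F (evaluate x)
    evaluate-cong (inverseʳ x)  = Group.inverseʳ F (evaluate x)

    evaluate-⟦⟧ : ∀ u → evaluate (⟦_⟧ θ u) ≋ᶠ Φ u
    evaluate-⟦⟧ []      = ≋-refl
    evaluate-⟦⟧ (a ∷ u) = ∙-congˡ (evaluate-⟦⟧ u)

    β-++ˡ : ∀ p {m} → Marked m → β (p ++ m) ≋ᶠ β m
    β-++ˡ p mk = proj₂ (go p mk)
      where
      go : ∀ p {m} → Marked m → Marked (p ++ m) × β (p ++ m) ≋ᶠ β m
      go []      mk = mk , ≋-refl
      go (a ∷ p) mk = let mk′ , e = go p mk in marked-∷ mk′ , ≋-trans (β-∷ mk′) e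

    X-marked : ∀ {m} → X m → Marked m
    X-marked {m} x = mark x ([] , [] , ≡-sym (++-identityʳ m))

    X-S : ∀ {m} → X m → S m
    X-S (inj₁ ≡-refl) = w∈S
    X-S (inj₂ ≡-refl) = inverse w∈S

    X-extension : ∀ {m} → X m → 𝟙 ≋ᶠ β (inv θ m) ⁻ · Φ m · β m
    X-extension x = ≋-trans (≋-sym (Π-X x)) (extension (X-marked x) (X-S x))

    -- The common conjugator. Since `Π` is trivial on `X`, the base-point changes transported to the
    -- marks of `w` and of `w⁻` agree, as `before-t` and `after-t` state.
    t : FCarrier
    t = β w

    before-t : ∀ {m} (x : X m) → β (inv θ m) ⁻ · Φ (before x) ≋ᶠ t ⁻
    before-t (inj₁ ≡-refl) = inverseˡ-unique _ _ (≋-sym (X-extension (inj₁ ≡-refl)))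
    before-t (inj₂ ≡-refl) = ≋-trans (Group.identityʳ F _) (≋-reflexive (cong (λ u → β u ⁻) (inv-involutive w)))

    after-t : ∀ {m} (x : X m) → Φ (after x) · β m ≋ᶠ t
    after-t (inj₁ ≡-refl) = Group.identityˡ F _
    after-t (inj₂ ≡-refl) = begin
      Φ w⁻ · β w⁻
        ≈⟨ solve (β (inv θ w⁻) ∷ Φ w⁻ ∷ β w⁻ ∷ []) (x₁ ∙ x₂) (x₀ ∙ (x₀ ⁻¹ ∙ x₁ ∙ x₂)) ≡-refl ⟩
      β (inv θ w⁻) · (β (inv θ w⁻) ⁻ · Φ w⁻ · β w⁻)
        ≈⟨ ∙-congˡ (X-extension (inj₂ ≡-refl)) ⟨
      β (inv θ w⁻) · 𝟙
        ≈⟨ Group.identityʳ F _ ⟩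
      β (inv θ w⁻)
        ≡⟨ cong β (inv-involutive w) ⟩
      t ∎

    -- `extension` is applied to the return word, whose image under `Φ` is split at its two marks.
    -- The changes `β` at its ends are those of the words of `X` found there.
    Φ-return : ∀ {u} → Return u → Φ (erase θ w u) ≋ᶠ t · generator (erase θ w u) · t ⁻
    Φ-return {u} ret = begin
      Φ v
        ≈⟨ solve (t ∷ Φ v ∷ []) x₁ (x₀ ∙ (x₀ ⁻¹ ∙ x₁ ∙ x₀) ∙ x₀ ⁻¹) ≡-refl ⟩
      t · (t ⁻ · Φ v · t) · t ⁻
        ≈⟨ ∙-congʳ (∙-congˡ conjugate) ⟨
      t · generator v · t ⁻ ∎
      where
      open Ends (ends ret)
      v = erase θ w u
      conjugate : generator v ≋ᶠ t ⁻ · Φ v · t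
      conjugate = begin
        generator v
          ≈⟨ Π-return ret ⟨
        Π u
          ≈⟨ extension (starts⇒marked (return-starts ret)) (IsCompleteReturn.member ret) ⟩
        β (inv θ u) ⁻ · Φ u · β u
          ≈⟨ ·-cong (·-cong
               (⁻-cong (≋-trans (≋-reflexive (cong β (≡-trans (cong (inv θ) prefix) (inv-++ m s))))
                                (β-++ˡ (inv θ s) (marked-inv (X-marked x)))))
               (≋-trans (≋-reflexive (cong Φ erased)) (≋-trans (Φ-++ (before x) _) (∙-congˡ (Φ-++ v (after x′))))))
               (≋-trans (≋-reflexive (cong β suffix)) (β-++ˡ p (X-marked x′))) ⟩
        β (inv θ m) ⁻ · (Φ (before x) · (Φ v · Φ (after x′))) · β m′
          ≈⟨ solve (β (inv θ m) ⁻ ∷ Φ (before x) ∷ Φ v ∷ Φ (after x′) ∷ β m′ ∷ [])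
               (x₀ ∙ (x₁ ∙ (x₂ ∙ x₃)) ∙ x₄) ((x₀ ∙ x₁) ∙ x₂ ∙ (x₃ ∙ x₄)) ≡-refl ⟩
        (β (inv θ m) ⁻ · Φ (before x)) · Φ v · (Φ (after x′) · β m′)
          ≈⟨ ·-cong (∙-congʳ (before-t x)) (after-t x′) ⟩
        t ⁻ · Φ v · t ∎

    words : ∀ {gs} → All (elements θ MR) gs → List (Word n)
    words []             = []
    words ((v , _) ∷ as) = v ∷ words as

    evaluate-words : ∀ {gs} (as : All (elements θ MR) gs) →
                     evaluate (product (Gθ θ) gs) ≋ᶠ t · product F (map generator (words as)) · t ⁻
    evaluate-words [] = solve (t ∷ []) ε (x₀ ∙ ε ∙ x₀ ⁻¹) ≡-refl
    evaluate-words {g ∷ gs} ((v , (u , ret , ≡-refl) , eq) ∷ as) = begin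
      evaluate g · evaluate (product (Gθ θ) gs)
        ≈⟨ ·-cong (≋-trans (≋-sym (evaluate-cong eq)) (≋-trans (evaluate-⟦⟧ v) (Φ-return ret))) (evaluate-words as) ⟩
      (t · generator v · t ⁻) · (t · Q · t ⁻)
        ≈⟨ solve (t ∷ generator v ∷ Q ∷ []) ((x₀ ∙ x₁ ∙ x₀ ⁻¹) ∙ (x₀ ∙ x₂ ∙ x₀ ⁻¹)) (x₀ ∙ (x₁ ∙ x₂) ∙ x₀ ⁻¹) ≡-refl ⟩
      t · (generator v · Q) · t ⁻ ∎
      where Q = product F (map generator (words as))

    words-reduced : ∀ {gs} (as : All (elements θ MR) gs) →
                    Linked (λ g h → ¬ (g ∙ h ≋ ε)) gs → Linked (λ u v → v ≢ inv θ u) (words as)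
    words-reduced []           _       = []
    words-reduced (_ ∷ [])     _       = [-]
    words-reduced ((v , _ , e) ∷ (v′ , mr , e′) ∷ as) (d ∷ l) =
      (λ { ≡-refl → d (trans (∙-cong (sym e) (sym e′)) (⟦⟧-inverseʳ v)) }) ∷ words-reduced ((v′ , mr , e′) ∷ as) l

    -- The homomorphism sends the product to a conjugate of a reduced product of free generators.
    nontrivial : (∀ {vs} → Linked (λ u v → v ≢ inv θ u) vs → vs ≢ [] → ¬ (product F (map generator vs) ≋ᶠ 𝟙)) →
                 ∀ gs → gs ≢ [] → All (elements θ MR) gs → Linked (λ g h → ¬ (g ∙ h ≋ ε)) gs →
                 ¬ (product (Gθ θ) gs ≋ ε)
    nontrivial free []       gs≢[] _  _ _  = gs≢[] ≡-refl
    nontrivial free (g ∷ gs) _ as@(_ ∷ _) l eq = free (words-reduced as l) (λ ()) (begin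
      Q                       ≈⟨ solve (t ∷ Q ∷ []) x₁ (x₀ ⁻¹ ∙ (x₀ ∙ x₁ ∙ x₀ ⁻¹) ∙ x₀) ≡-refl ⟩
      t ⁻ · (t · Q · t ⁻) · t ≈⟨ ∙-congʳ (∙-congˡ (≋-trans (≋-sym (evaluate-words as)) (evaluate-cong eq))) ⟩
      t ⁻ · 𝟙 · t             ≈⟨ solve (t ∷ []) (x₀ ⁻¹ ∙ ε ∙ x₀) ε ≡-refl ⟩
      𝟙                       ∎)
      where Q = product F (map generator (words as))

theorem6p17 : (n : ℕ) (θ : Fin n → Fin n) → Involutive _≡_ θ →
    (S : Language n) → IsRecurrent S → IsSpecular θ S →
    (w : Word n) → S w → w ≢ [] → ¬ Overlap w (inv θ w) →
    IsMonoidalBasis (Gθ θ) (elements θ (MixedReturn θ S w))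
theorem6p17 n θ θ-inv S rec specular [] w∈S w≢[] ¬overlap = ⊥-elim (w≢[] ≡-refl)
theorem6p17 n θ θ-inv S rec specular w@(a ∷ w′) w∈S w≢[] ¬overlap = record
  { symmetric  = elements-⁻¹
  ; generates  = generates N marked
  -- The first letter `a` of `w` serves as the base letter of `E []`.
  ; nonTrivial = Freeness.nontrivial θ θ-inv specular []∈S w w∈S w≢[] ¬overlap a
                   F generator generator-inv N marked reduced-nontrivial
  }
  where
  treeSet = IsSpecular.treeSet specular
  []∈S : S []
  []∈S = IsTreeSet.factors treeSet ([] , w , ≡-refl) w∈S
  recurrence : ∀ {u v} → S u → S v → ∃ λ x → S (u ++ x ++ v)
  recurrence s s′ = let x , _ , r = IsRecurrent.recurrent rec s s′ in x , r
  open Generation θ θ-inv specular []∈S recurrence w w∈S w≢[] ¬overlap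
  open UniformRecurrence treeSet []∈S recurrence
  -- The generators are indexed by all words, paired by `inv θ`, so that their equality is
  -- decidable.
  open InvolutiveFreeGroup (≡-dec _≟_) {inv θ} (Inverse.inv-involutive θ θ-inv)
  open ReturnBound a w′ w∈S using (uniformly-recurrent)
  N = proj₁ uniformly-recurrent
  -- Occurrences of `w` alone already mark every long word.
  marked : ∀ u → S u → N ≤ length u → Factor w u ⊎ Factor (inv θ w) u
  marked u s le = inj₁ (proj₂ uniformly-recurrent u s le)
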